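{- Let $V$ be a vertex set of size $n$ and let $\mathcal{Z}$ be a family of trees on $V$. Let $N=\sum_{T\in\mathcal{Z}}|T|$. For any $k\in[1,n]$, in $O(N\log^2 n)$ time one can deterministically compute an $O\left(\frac{n}{k}\cdot\log n\right)$-sized hitting set $H\subseteq V$ of all the $k$-hop root paths in all the trees in $\mathcal{Z}$.
   Context: A tree on $V$ is a rooted out-tree $T$ (all edges directed from parent to child) whose vertex set $V(T)$ is a subset of $V$; $|T|$ denotes its size (number of vertices). A root path of $T$ is the unique path in $T$ from its root to some vertex $t\in V(T)$; it is a $k$-hop root path if it has exactly $k$ edges. A set $H\subseteq V$ is a hitting set of a collection of paths if every path in the collection contains at least one vertex of $H$.
   Formalization: N is assumed polynomially bounded in n (N ≤ d·n^d, the O-constants and word size depending on d), because for unrestricted families, e.g. all simple paths on about n/2 vertices, the size bound is false; the time is O(1 + N log² n). -}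

module Defs where

open import Data.Bool using (Bool; true; false; if_then_else_)
open import Data.Fin using (Fin; toℕ)
open import Data.List using (List; []; _∷_; _++_; length; map; concatMap; sum; upTo)
open import Data.List.Membership.Propositional using (_∈_)
open import Data.List.Relation.Unary.Any using (Any)
open import Data.List.Relation.Unary.Unique.Propositional using (Unique)
open import Data.Nat using (ℕ; zero; suc; _+_; _*_; _∸_; _/_; _^_; _<_; _≡ᵇ_; _<ᵇ_)
open import Data.Nat.Logarithm using (⌈log₂_⌉)
open import Data.Product using (_×_; ∃-syntax)
open import Relation.Binary.PropositionalEquality using (_≡_)

------------------------------------------------------------------------
-- Trees and root paths

data RoseTree (V : Set) : Set where
  node : V → List (RoseTree V) → RoseTree V

root : ∀ {V} → RoseTree V → V
root (node v _) = v

mutual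
  vertices : ∀ {V} → RoseTree V → List V
  vertices (node v ts) = v ∷ verticesF ts

  verticesF : ∀ {V} → List (RoseTree V) → List V
  verticesF []       = []
  verticesF (t ∷ ts) = vertices t ++ verticesF ts

-- The vertex set is V = Fin n.  Distinctness of the labels makes a rose tree
-- a rooted out-tree whose vertex set is a subset of V.
record Tree (n : ℕ) : Set where
  field
    shape    : RoseTree (Fin n)
    distinct : Unique (vertices shape)

open Tree public

size : ∀ {n} → Tree n → ℕ
size T = length (vertices (shape T))

totalSize : ∀ {n} → List (Tree n) → ℕ
totalSize Z = sum (map size Z)

-- A path is the list of its vertices, so it has one vertex more than edges.
data RootPath {V : Set} : RoseTree V → List V → Set where
  here : ∀ {v ts} → RootPath (node v ts) (v ∷ [])
  down : ∀ {v ts t p} → t ∈ ts → RootPath t p → RootPath (node v ts) (v ∷ p)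

KHopRootPath : ∀ {n} → ℕ → List (Tree n) → List (Fin n) → Set
KHopRootPath k Z p = ∃[ T ] (T ∈ Z × RootPath (shape T) p × length p ≡ suc k)

IsHittingSet : ∀ {n} → List (Fin n) → (List (Fin n) → Set) → Set
IsHittingSet H 𝒫 = ∀ p → 𝒫 p → Any (_∈ H) p

------------------------------------------------------------------------
-- Word RAM, as a deterministic imperative language.  A program uses finitely
-- many scalar variables and finitely many random-access arrays of words, both
-- named by natural numbers.  All words are < W.  An operation whose result
-- does not fit into a word has no execution.

data Op : Set where
  add sub mul div lt eq : Op

data Expr : Set where
  lit  : ℕ → Expr
  var  : ℕ → Expr
  _⟨_⟩ : ℕ → Expr → Expr
  bin  : Op → Expr → Expr → Expr

infixr 5 _⨾_
infix  6 _≔_ _⟨_⟩≔_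

data Cmd : Set where
  skip     : Cmd
  _≔_      : ℕ → Expr → Cmd
  _⟨_⟩≔_   : ℕ → Expr → Expr → Cmd
  _⨾_      : Cmd → Cmd → Cmd
  if       : Expr → Cmd → Cmd → Cmd
  while    : Expr → Cmd → Cmd

record Store : Set where
  constructor store
  field
    scalar : ℕ → ℕ
    array  : ℕ → ℕ → ℕ

open Store public

_[_↦_] : ∀ {A : Set} → (ℕ → A) → ℕ → A → ℕ → A
(f [ x ↦ a ]) y = if x ≡ᵇ y then a else f y

setScalar : Store → ℕ → ℕ → Store
setScalar σ x v = store (scalar σ [ x ↦ v ]) (array σ)

setCell : Store → ℕ → ℕ → ℕ → Store
setCell σ a i v = store (scalar σ) (array σ [ a ↦ array σ a [ i ↦ v ] ])

bit : Bool → ℕ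
bit true  = 1
bit false = 0

-- Subtraction is truncated and division by zero gives zero.
⟦_⟧ : Op → ℕ → ℕ → ℕ
⟦ add ⟧ u v       = u + v
⟦ sub ⟧ u v       = u ∸ v
⟦ mul ⟧ u v       = u * v
⟦ div ⟧ u zero    = 0
⟦ div ⟧ u (suc v) = u / suc v
⟦ lt  ⟧ u v       = bit (u <ᵇ v)
⟦ eq  ⟧ u v       = bit (u ≡ᵇ v)

-- Eval W σ e v t: in σ, e evaluates to v in time t (one unit per node of e).
data Eval (W : ℕ) (σ : Store) : Expr → ℕ → ℕ → Set where
  lit  : ∀ {v} → v < W → Eval W σ (lit v) v 1
  var  : ∀ {x} → Eval W σ (var x) (scalar σ x) 1
  cell : ∀ {a e i t} → Eval W σ e i t → Eval W σ (a ⟨ e ⟩) (array σ a i) (suc t)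
  bin  : ∀ {o e₁ e₂ v₁ v₂ t₁ t₂} →
         Eval W σ e₁ v₁ t₁ → Eval W σ e₂ v₂ t₂ → ⟦ o ⟧ v₁ v₂ < W →
         Eval W σ (bin o e₁ e₂) (⟦ o ⟧ v₁ v₂) (suc (t₁ + t₂))

-- Exec W c σ σ′ t: started in σ, c halts in σ′ after time t.
-- Conditions are true when nonzero.
data Exec (W : ℕ) : Cmd → Store → Store → ℕ → Set where
  skip     : ∀ {σ} → Exec W skip σ σ 1
  assign   : ∀ {σ x e v t} → Eval W σ e v t →
             Exec W (x ≔ e) σ (setScalar σ x v) (suc t)
  write    : ∀ {σ a e₁ e₂ i v t₁ t₂} → Eval W σ e₁ i t₁ → Eval W σ e₂ v t₂ →
             Exec W (a ⟨ e₁ ⟩≔ e₂) σ (setCell σ a i v) (suc (t₁ + t₂))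
  seq      : ∀ {σ σ′ σ″ c₁ c₂ t₁ t₂} → Exec W c₁ σ σ′ t₁ → Exec W c₂ σ′ σ″ t₂ →
             Exec W (c₁ ⨾ c₂) σ σ″ (t₁ + t₂)
  if-true  : ∀ {σ σ′ e c₁ c₂ v t₁ t₂} → Eval W σ e (suc v) t₁ → Exec W c₁ σ σ′ t₂ →
             Exec W (if e c₁ c₂) σ σ′ (suc (t₁ + t₂))
  if-false : ∀ {σ σ′ e c₁ c₂ t₁ t₂} → Eval W σ e 0 t₁ → Exec W c₂ σ σ′ t₂ →
             Exec W (if e c₁ c₂) σ σ′ (suc (t₁ + t₂))
  done     : ∀ {σ e c t} → Eval W σ e 0 t → Exec W (while e c) σ σ (suc t)
  loop     : ∀ {σ σ′ σ″ e c v t₁ t₂ t₃} → Eval W σ e (suc v) t₁ →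
             Exec W c σ σ′ t₂ → Exec W (while e c) σ′ σ″ t₃ →
             Exec W (while e c) σ σ″ (suc (t₁ + t₂ + t₃))

record FitsIn (W : ℕ) (σ : Store) : Set where
  field
    scalars : ∀ x → scalar σ x < W
    arrays  : ∀ a i → array σ a i < W

-- As the initial words fit, every word occurring in the execution does.
Runs : ℕ → Cmd → Store → Store → ℕ → Set
Runs W P σ σ′ t = FitsIn W σ × Exec W P σ σ′ t

-- Words of b (1 + ⌈log₂ n⌉) = O(log n) bits.  They can only address an input
-- whose size N is polynomial in n.  Without N = n^O(1) the size bound also fails:
-- hitting every path on about n/2 vertices (given as path-shaped trees) takes
-- about n/2 vertices.
wordBound : ℕ → ℕ → ℕ
wordBound b n = 2 ^ (b * suc ⌈log₂ n ⌉)

------------------------------------------------------------------------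
-- Input and output conventions

mutual
  -- The parents of the vertices, in the order in which `vertices` lists them;
  -- p stands for the parent of the root.
  parents : ∀ {V} → V → RoseTree V → List V
  parents p (node v ts) = p ∷ parentsF v ts

  parentsF : ∀ {V} → V → List (RoseTree V) → List V
  parentsF p []       = []
  parentsF p (t ∷ ts) = parents p t ++ parentsF p ts

-- Words beyond the end of the list are zero.
word : ∀ {n} → List (Fin n) → ℕ → ℕ
word []       _       = 0
word (v ∷ vs) zero    = toℕ v
word (v ∷ vs) (suc i) = word vs i

-- Scalars 0, 1, 2 hold n, k and N.  Array 0 lists the vertices of the trees,
-- one tree after the other, and array 1 the parent of each listed vertex; a
-- root is listed as its own parent, which also marks where a tree begins.
-- All other words are zero.
input : ∀ {n} → ℕ → List (Tree n) → Store
input {n} k Z = store s a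
  where
  s : ℕ → ℕ
  s 0 = n
  s 1 = k
  s 2 = totalSize Z
  s _ = 0

  a : ℕ → ℕ → ℕ
  a 0 = word (concatMap (λ T → vertices (shape T)) Z)
  a 1 = word (concatMap (λ T → parents (root (shape T)) (shape T)) Z)
  a _ = λ _ → 0

-- The output is a list of vertices: its length is in scalar 0, its elements
-- are in array 0.
Outputs : ∀ {n} → Store → List (Fin n) → Set
Outputs σ H = map (array σ 0) (upTo (scalar σ 0)) ≡ map toℕ H

-- Time O(N log² n).  The added 1 matters only when N log² n = 0, where no
-- program could meet the bound.
timeBound : ℕ → ℕ → ℕ → ℕ
timeBound c n N = c * suc (N * ⌈log₂ n ⌉ ^ 2)

{-# OPTIONS --safe #-}
module Submission where

-- Number the vertices of all trees consecutively in preorder.  A k-hop root path is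
-- then a position q of depth k (a target), and it contains the vertex at position i
-- exactly if q lies in the interval i ≤ q < i + size i of the subtree at i.
--
-- Vertices are chosen greedily with a threshold.  In a phase that begins with R live
-- targets, every vertex is visited once and chosen if at least R k / 2n live targets
-- lie below its occurrences, and these targets are then killed.  A phase chooses at
-- most 2n / k vertices.  Each live target lies below more than k vertices, so if at
-- the end no vertex has R k / 2n live targets below it, at most R / 2 targets are
-- alive.  Hence there are O(log N) = O(log n) phases.
--
-- The live targets are the leaves of a segment tree over the positions.  A phase makes
-- one interval query for each position, in total O(N log n) time; a kill is a
-- binary search with queries, O(log² n) time, and there are at most N kills in all.
-- Only cells that belong to listed vertices are ever touched, as n may exceed N log² n.

open import Data.Bool using (Bool; true; false; not; _∨_; T)
open import Data.Empty using (⊥)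
open import Data.Fin using (Fin; toℕ; fromℕ<)
open import Data.Fin.Properties using (toℕ<n; toℕ-injective; toℕ-fromℕ<)
open import Data.List using (List; []; _∷_; _++_; length; map; concatMap; tabulate; applyUpTo; upTo)
open import Data.List.Membership.Propositional using (_∈_)
open import Data.List.Membership.Propositional.Properties using (∈-++⁺ˡ; ∈-++⁺ʳ; ∈-map⁺; ∈-tabulate⁺)
open import Data.List.Properties using (length-++; length-tabulate; map-tabulate; map-upTo; tabulate-cong)
open import Data.List.Relation.Unary.All using (All; _∷_)
import Data.List.Relation.Unary.All as All
import Data.List.Relation.Unary.All.Properties as All
open import Data.List.Relation.Unary.AllPairs using ([]; _∷_)
open import Data.List.Relation.Unary.Any using (here; there)
import Data.List.Relation.Unary.Any as Any
open import Data.List.Relation.Unary.Unique.Propositional using (Unique)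
open import Data.List.Relation.Unary.Unique.Propositional.Properties using (tabulate⁺)
open import Data.Nat
open import Data.Nat.Divisibility using (n∣m*n)
open import Data.Nat.DivMod using (m/n≤m; +-distrib-/-∣ʳ; m*n/n≡m)
open import Data.Nat.Induction using (<-wellFounded)
open import Data.Nat.Logarithm using (⌈log₂_⌉)
open import Data.Nat.Logarithm.Core using (⌈log2⌉)
open import Data.Nat.Properties
open import Data.Nat.Tactic.RingSolver using (solve-∀)
open import Data.Product using (_×_; _,_; proj₁; proj₂; ∃-syntax)
open import Data.Sum using (_⊎_; inj₁; inj₂)
open import Data.Unit using (⊤; tt)
open import Function using (_∘_)
import Induction.WellFounded as WellFounded
open import Relation.Binary.PropositionalEquality
open import Relation.Nullary using (contradiction; ¬_; yes; no)
open import Defs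

-- The threshold replaces the repeated search for a vertex of maximum degree. Degrees only fall, so
-- a vertex rejected in a phase stays rejected until its end, and one visit per vertex suffices in
-- any order. The visit takes place at the last listed occurrence, from which links lead to the
-- earlier ones.
--
-- Time is amortised over all phases. The root cell `A 1` of the segment tree counts the live
-- targets, and `A 1 * killTime b` is held as a budget: each kill lowers the root by one and is paid
-- from it. For this reason `while-rule` carries a time budget and returns what is left of it.
--
-- As N is polynomial in n, 2N < 2 ^ b holds for b = (2d + 1) ⌈log₂ n⌉. This one number bounds the
-- rounds of a query, of a binary search and of an update, and the number of phases.
--
-- Two degenerate inputs shape the proof. For n ≤ 1 the logarithm is 0, and the size bound forces
-- the empty list. For N = 0 only constant time is allowed, so not even the fixed cost of b phases
-- may be charged.

-- Execution of straight-line code, and framing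

value : Store → Expr → ℕ
value σ (lit v)       = v
value σ (var x)       = scalar σ x
value σ (a ⟨ e ⟩)     = array σ a (value σ e)
value σ (bin o e₁ e₂) = ⟦ o ⟧ (value σ e₁) (value σ e₂)

cost : Expr → ℕ
cost (lit _)       = 1
cost (var _)       = 1
cost (_ ⟨ e ⟩)     = suc (cost e)
cost (bin _ e₁ e₂) = suc (cost e₁ + cost e₂)

-- exe and duration are meaningful for straight-line commands only.
exe : Cmd → Store → Store
exe (x ≔ e)        σ = setScalar σ x (value σ e)
exe (a ⟨ e₁ ⟩≔ e₂) σ = setCell σ a (value σ e₁) (value σ e₂)
exe (c ⨾ d)        σ = exe d (exe c σ)
exe _              σ = σ

duration : Cmd → ℕ
duration (_ ≔ e)        = suc (cost e)
duration (_ ⟨ e₁ ⟩≔ e₂) = suc (cost e₁ + cost e₂)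
duration (c ⨾ d)        = duration c + duration d
duration _              = 1

-- Boolean-valued, so that for concrete code and a concrete name the condition `T (not ...)`
-- computes to `⊤` and `_` proves it.
writesScalar writesArray : Cmd → ℕ → Bool
writesScalar skip         y = false
writesScalar (x ≔ _)      y = x ≡ᵇ y
writesScalar (_ ⟨ _ ⟩≔ _) y = false
writesScalar (c ⨾ d)      y = writesScalar c y ∨ writesScalar d y
writesScalar (if _ c d)   y = writesScalar c y ∨ writesScalar d y
writesScalar (while _ c)  y = writesScalar c y
writesArray skip         b = false
writesArray (_ ≔ _)      b = false
writesArray (a ⟨ _ ⟩≔ _) b = a ≡ᵇ b
writesArray (c ⨾ d)      b = writesArray c b ∨ writesArray d b
writesArray (if _ c d)   b = writesArray c b ∨ writesArray d b
writesArray (while _ c)  b = writesArray c b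

record Same (c : Cmd) (σ σ′ : Store) : Set where
  constructor same
  field
    scalar≡ : ∀ x → T (not (writesScalar c x)) → scalar σ′ x ≡ scalar σ x
    array≡  : ∀ a → T (not (writesArray c a)) → array σ′ a ≡ array σ a

open Same public

Same-refl : ∀ {c σ} → Same c σ σ
Same-refl = same (λ _ _ → refl) (λ _ _ → refl)

Same-trans : ∀ {c σ₁ σ₂ σ₃} → Same c σ₁ σ₂ → Same c σ₂ σ₃ → Same c σ₁ σ₃
Same-trans p q = same (λ x h → trans (scalar≡ q x h) (scalar≡ p x h))
                      (λ a h → trans (array≡ q a h) (array≡ p a h))

not-∨ˡ : ∀ a {b} → T (not (a ∨ b)) → T (not a)
not-∨ˡ false _ = tt

not-∨ʳ : ∀ a {b} → T (not (a ∨ b)) → T (not b)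
not-∨ʳ false h = h

Same-⊆ : ∀ {c d σ σ′} →
         (∀ x → T (not (writesScalar d x)) → T (not (writesScalar c x))) →
         (∀ a → T (not (writesArray d a)) → T (not (writesArray c a))) →
         Same c σ σ′ → Same d σ σ′
Same-⊆ f g s = same (λ x → scalar≡ s x ∘ f x) (λ a → array≡ s a ∘ g a)

frame : ∀ {W c σ σ′ t} → Exec W c σ σ′ t → Same c σ σ′
frame skip = Same-refl
frame (assign {σ} {x} _) = same scalars (λ _ _ → refl)
  where
  scalars : ∀ y → T (not (x ≡ᵇ y)) → (scalar σ [ x ↦ _ ]) y ≡ scalar σ y
  scalars y h with x ≡ᵇ y
  ... | false = refl
frame (write {σ} {a} _ _) = same (λ _ _ → refl) arrays
  where
  arrays : ∀ b → T (not (a ≡ᵇ b)) → (array σ [ a ↦ _ ]) b ≡ array σ b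
  arrays b h with a ≡ᵇ b
  ... | false = refl
frame (seq {c₁ = c} {d} p q) =
  Same-trans (Same-⊆ (λ x → not-∨ˡ (writesScalar c x)) (λ a → not-∨ˡ (writesArray c a)) (frame p))
             (Same-⊆ (λ x → not-∨ʳ (writesScalar c x)) (λ a → not-∨ʳ (writesArray c a)) (frame q))
frame (if-true {c₁ = c} _ p) =
  Same-⊆ (λ x → not-∨ˡ (writesScalar c x)) (λ a → not-∨ˡ (writesArray c a)) (frame p)
frame (if-false {c₁ = c} _ p) =
  Same-⊆ (λ x → not-∨ʳ (writesScalar c x)) (λ a → not-∨ʳ (writesArray c a)) (frame p)
frame (done _) = Same-refl
frame (loop _ p q) = Same-trans (Same-⊆ (λ _ h → h) (λ _ h → h) (frame p))
                                (Same-⊆ (λ _ h → h) (λ _ h → h) (frame q))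

-- A logic of total correctness with running time

bit≤1 : ∀ b → bit b ≤ 1
bit≤1 true  = ≤-refl
bit≤1 false = z≤n

module Logic (W : ℕ) (4≤W : 4 ≤ W) where

  -- Only literals, sums and products can overflow.
  Safe : Store → Expr → Set
  Safe σ (lit v)         = T (v <ᵇ 4)
  Safe σ (var x)         = ⊤
  Safe σ (a ⟨ e ⟩)       = Safe σ e
  Safe σ (bin add e₁ e₂) = Safe σ e₁ × Safe σ e₂ × value σ e₁ + value σ e₂ < W
  Safe σ (bin mul e₁ e₂) = Safe σ e₁ × Safe σ e₂ × value σ e₁ * value σ e₂ < W
  Safe σ (bin _ e₁ e₂)   = Safe σ e₁ × Safe σ e₂

  -- Overflow is the only way in which the total function `value` can differ from `Eval`. The
  -- assumption `4 ≤ W` covers the literals and the results of comparisons.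
  evaluates : ∀ {σ} → FitsIn W σ → ∀ e → Safe σ e →
              Eval W σ e (value σ e) (cost e) × value σ e < W
  evaluates f (lit v) s = lit v<W , v<W
    where v<W = ≤-trans (<ᵇ⇒< v 4 s) 4≤W
  evaluates f (var x) s = var , FitsIn.scalars f x
  evaluates f (a ⟨ e ⟩) s = cell (proj₁ (evaluates f e s)) , FitsIn.arrays f a _
  evaluates {σ} f (bin add e₁ e₂) (s₁ , s₂ , v<W) =
    bin (proj₁ (evaluates f e₁ s₁)) (proj₁ (evaluates f e₂ s₂)) v<W , v<W
  evaluates f (bin mul e₁ e₂) (s₁ , s₂ , v<W) =
    bin (proj₁ (evaluates f e₁ s₁)) (proj₁ (evaluates f e₂ s₂)) v<W , v<W
  evaluates {σ} f (bin sub e₁ e₂) (s₁ , s₂) = bin p₁ (proj₁ (evaluates f e₂ s₂)) v<W , v<W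
    where
    p₁  = proj₁ (evaluates f e₁ s₁)
    v<W = ≤-<-trans (m∸n≤m (value σ e₁) (value σ e₂)) (proj₂ (evaluates f e₁ s₁))
  evaluates {σ} f (bin div e₁ e₂) (s₁ , s₂) = bin p₁ (proj₁ (evaluates f e₂ s₂)) v<W , v<W
    where
    p₁ = proj₁ (evaluates f e₁ s₁)
    quotient≤ : ∀ u v → ⟦ div ⟧ u v ≤ u
    quotient≤ u zero    = z≤n
    quotient≤ u (suc v) = m/n≤m u (suc v)
    v<W = ≤-<-trans (quotient≤ (value σ e₁) (value σ e₂)) (proj₂ (evaluates f e₁ s₁))
  evaluates {σ} f (bin lt e₁ e₂) (s₁ , s₂) =
    bin (proj₁ (evaluates f e₁ s₁)) (proj₁ (evaluates f e₂ s₂)) v<W , v<W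
    where v<W = ≤-trans (s≤s (bit≤1 (value σ e₁ <ᵇ value σ e₂))) (≤-trans (s≤s (s≤s z≤n)) 4≤W)
  evaluates {σ} f (bin eq e₁ e₂) (s₁ , s₂) =
    bin (proj₁ (evaluates f e₁ s₁)) (proj₁ (evaluates f e₂ s₂)) v<W , v<W
    where v<W = ≤-trans (s≤s (bit≤1 (value σ e₁ ≡ᵇ value σ e₂))) (≤-trans (s≤s (s≤s z≤n)) 4≤W)

  update-< : ∀ {f : ℕ → ℕ} x {a} → (∀ y → f y < W) → a < W → ∀ y → (f [ x ↦ a ]) y < W
  update-< x f< a< y with x ≡ᵇ y
  ... | true  = a<
  ... | false = f< y

  setScalar-fits : ∀ {σ x v} → FitsIn W σ → v < W → FitsIn W (setScalar σ x v)
  setScalar-fits {x = x} f v< = record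
    { scalars = update-< x (FitsIn.scalars f) v< ; arrays = FitsIn.arrays f }

  setCell-fits : ∀ {σ a i v} → FitsIn W σ → v < W → FitsIn W (setCell σ a i v)
  setCell-fits {σ} {a} {i} {v} f v< = record
    { scalars = FitsIn.scalars f ; arrays = arrays }
    where
    arrays : ∀ b j → (array σ [ a ↦ array σ a [ i ↦ v ] ]) b j < W
    arrays b j with a ≡ᵇ b
    ... | true  = update-< i (FitsIn.arrays f a) v< j
    ... | false = FitsIn.arrays f b j

  -- `FitsIn` is threaded through here, so that no specification mentions it. Being a record keeps
  -- `c`, `Q` and `σ` inferable.
  record Wp (c : Cmd) (Q : Store → ℕ → Set) (σ : Store) : Set where
    constructor wp
    field
      run : FitsIn W σ → ∃[ σ′ ] ∃[ t ] (Exec W c σ σ′ t × FitsIn W σ′ × Q σ′ t)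

  open Wp public

  -- The frame comes for free with each use, so that specifications state only what changes.
  conseq : ∀ {c P Q σ} → Wp c P σ → (∀ {σ′ t} → Same c σ σ′ → P σ′ t → Q σ′ t) → Wp c Q σ
  conseq p h .run f =
    let (σ′ , t , e , f′ , q) = run p f in σ′ , t , e , f′ , h (frame e) q

  infixr 4 _then_

  _then_ : ∀ {c d P Q σ} → Wp c P σ →
           (∀ {σ₁ t₁} → Same c σ σ₁ → P σ₁ t₁ → Wp d (λ σ₂ t₂ → Q σ₂ (t₁ + t₂)) σ₁) →
           Wp (c ⨾ d) Q σ
  (p then h) .run f =
    let (σ₁ , t₁ , e₁ , f₁ , q₁) = run p f
        (σ₂ , t₂ , e₂ , f₂ , q₂) = run (h (frame e₁) q₁) f₁
    in σ₂ , t₁ + t₂ , seq e₁ e₂ , f₂ , q₂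

  SafeBlock : Cmd → Store → Set
  SafeBlock skip           σ = ⊤
  SafeBlock (_ ≔ e)        σ = Safe σ e
  SafeBlock (_ ⟨ e₁ ⟩≔ e₂) σ = Safe σ e₁ × Safe σ e₂
  SafeBlock (c ⨾ d)        σ = SafeBlock c σ × SafeBlock d (exe c σ)
  SafeBlock (if _ _ _)     σ = ⊥
  SafeBlock (while _ _)    σ = ⊥

  executes : ∀ {σ} → FitsIn W σ → ∀ c → SafeBlock c σ →
             Exec W c σ (exe c σ) (duration c) × FitsIn W (exe c σ)
  executes f skip s = skip , f
  executes f (x ≔ e) s =
    let (p , v<) = evaluates f e s in assign p , setScalar-fits {x = x} f v<
  executes f (a ⟨ e₁ ⟩≔ e₂) (s₁ , s₂) =
    let (p₁ , _)  = evaluates f e₁ s₁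
        (p₂ , v<) = evaluates f e₂ s₂
    in write p₁ p₂ , setCell-fits {a = a} {value _ e₁} f v<
  executes f (c ⨾ d) (s₁ , s₂) =
    let (p₁ , f₁) = executes f c s₁
        (p₂ , f₂) = executes f₁ d s₂
    in seq p₁ p₂ , f₂

  -- Straight-line code is executed by normalisation: for concrete `c` both arguments of `Q`
  -- compute.
  block : ∀ {c Q σ} → SafeBlock c σ → Q (exe c σ) (duration c) → Wp c Q σ
  block {c} {σ = σ} s q .run f =
    let (p , f′) = executes f c s in exe c σ , duration c , p , f′ , q

  block-then : ∀ {c d Q σ} → SafeBlock c σ →
               Wp d (λ σ′ t → Q σ′ (duration c + t)) (exe c σ) → Wp (c ⨾ d) Q σ
  block-then {c} {σ = σ} s q .run f =
    let (p , f₁) = executes f c s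
        (σ₂ , t₂ , e₂ , f₂ , q₂) = run q f₁
    in σ₂ , duration c + t₂ , seq p e₂ , f₂ , q₂

  if-rule : ∀ {e c d Q σ} → Safe σ e →
            (∀ {v} → value σ e ≡ suc v → Wp c (λ σ′ t → Q σ′ (suc (cost e + t))) σ) →
            (value σ e ≡ 0 → Wp d (λ σ′ t → Q σ′ (suc (cost e + t))) σ) →
            Wp (if e c d) Q σ
  if-rule {e} {σ = σ} s p q .run f with value σ e | proj₁ (evaluates f e s) | p | q
  ... | zero  | ev | p | q =
    let (σ′ , t , x , f′ , r) = run (q refl) f in σ′ , _ , if-false ev x , f′ , r
  ... | suc v | ev | p | q =
    let (σ′ , t , x , f′ , r) = run (p refl) f in σ′ , _ , if-true ev x , f′ , r

  -- I m σ: the invariant with m units of time left for the iterations.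
  while-rule : ∀ {e c σ₀ m} (I : ℕ → Store → Set) → (∀ σ → Safe σ e) →
    (∀ {m σ v} → Same c σ₀ σ → I m σ → value σ e ≡ suc v →
       Wp c (λ σ′ t → ∃[ m′ ] (I m′ σ′ × suc (cost e + t + m′) ≤ m)) σ) →
    I m σ₀ →
    Wp (while e c)
       (λ σ′ t → ∃[ m′ ] (I m′ σ′ × value σ′ e ≡ 0 × t + m′ ≤ m + suc (cost e))) σ₀
  while-rule {e} {c} {σ₀} {m₀} I safe step i₀ = wp (go m₀ ≤-refl Same-refl i₀)
    where
    -- The time budget doubles as termination measure: every iteration uses at least one unit of it.
    go : ∀ fuel {m σ} → m ≤ fuel → Same c σ₀ σ → I m σ → FitsIn W σ →
         ∃[ σ′ ] ∃[ t ] (Exec W (while e c) σ σ′ t × FitsIn W σ′ ×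
           ∃[ m′ ] (I m′ σ′ × value σ′ e ≡ 0 × t + m′ ≤ m + suc (cost e)))
    go fuel {m} {σ} m≤ s i f with value σ e in eq | proj₁ (evaluates f e (safe σ))
    ... | zero  | ev = σ , _ , done ev , f , m , i , eq , ≤-reflexive (+-comm (suc (cost e)) m)
    ... | suc v | ev with run (step s i eq) f
    ... | σ₁ , t₁ , x₁ , f₁ , m₁ , i₁ , le with fuel
    ...   | zero = contradiction (≤-trans le m≤) λ ()
    ...   | suc fuel with go fuel (≤-pred (≤-trans (s≤s (m≤n+m m₁ _)) (≤-trans le m≤)))
                             (Same-trans s (frame x₁)) i₁ f₁
    ...     | σ₂ , t₂ , x₂ , f₂ , m₂ , i₂ , z , le₂ =
      σ₂ , _ , loop ev x₁ x₂ , f₂ , m₂ , i₂ , z , bound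
      where
      open ≤-Reasoning
      bound : suc (cost e + t₁ + t₂) + m₂ ≤ m + suc (cost e)
      bound = begin
        suc (cost e + t₁ + t₂) + m₂              ≡⟨ cong suc (+-assoc (cost e + t₁) t₂ m₂) ⟩
        suc (cost e + t₁) + (t₂ + m₂)            ≤⟨ +-monoʳ-≤ (suc (cost e + t₁)) le₂ ⟩
        suc (cost e + t₁) + (m₁ + suc (cost e))  ≡⟨ +-assoc (suc (cost e + t₁)) m₁ _ ⟨
        suc (cost e + t₁ + m₁) + suc (cost e)    ≤⟨ +-monoˡ-≤ (suc (cost e)) le ⟩
        m + suc (cost e)                         ∎

  -- I j σ: the invariant when at most j iterations remain.
  for-rule : ∀ {e c σ₀ j} (t₀ : ℕ) (I : ℕ → Store → Set) → (∀ σ → Safe σ e) →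
    (∀ {j σ v} → Same c σ₀ σ → I j σ → value σ e ≡ suc v →
       ∃[ j′ ] (j ≡ suc j′ × Wp c (λ σ′ t → I j′ σ′ × t ≤ t₀) σ)) →
    I j σ₀ →
    Wp (while e c)
       (λ σ′ t → (∃[ j′ ] I j′ σ′) × value σ′ e ≡ 0 ×
                 t ≤ j * suc (cost e + t₀) + suc (cost e)) σ₀
  for-rule {e} {c} {σ₀} {j₀} t₀ I safe step i₀ =
    conseq (while-rule Iters safe step′ (j₀ , refl , i₀))
      λ _ (m , (j , _ , i) , z , le) → (j , i) , z , ≤-trans (m≤m+n _ m) le
    where
    Iters : ℕ → Store → Set
    Iters m σ = ∃[ j ] (m ≡ j * suc (cost e + t₀) × I j σ)
    step′ : ∀ {m σ v} → Same c σ₀ σ → Iters m σ → value σ e ≡ suc v →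
            Wp c (λ σ′ t → ∃[ m′ ] (Iters m′ σ′ × suc (cost e + t + m′) ≤ m)) σ
    step′ s (j , refl , i) v with step s i v
    ... | j′ , refl , p = conseq p λ _ (i′ , t≤) →
      _ , (j′ , refl , i′) , s≤s (+-monoˡ-≤ _ (+-monoʳ-≤ (cost e) t≤))

-- Updates and tests

update-≡ : ∀ (f : ℕ → ℕ) x a → (f [ x ↦ a ]) x ≡ a
update-≡ f x a with x ≡ᵇ x in eq
... | true  = refl
... | false = contradiction (subst T eq (≡⇒≡ᵇ x x refl)) λ ()

update-≢ : ∀ (f : ℕ → ℕ) {x y} a → x ≢ y → (f [ x ↦ a ]) y ≡ f y
update-≢ f {x} {y} a x≢y with x ≡ᵇ y in eq
... | true  = contradiction (≡ᵇ⇒≡ x y (subst T (sym eq) tt)) x≢y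
... | false = refl

-- The Kronecker delta, in the form in which `⟦ eq ⟧` computes it, so that program values and
-- counting sums agree by definition.
δ : ℕ → ℕ → ℕ
δ x y = bit (x ≡ᵇ y)

δ-refl : ∀ x → δ x x ≡ 1
δ-refl zero    = refl
δ-refl (suc x) = δ-refl x

δ-≢ : ∀ {x y} → x ≢ y → δ x y ≡ 0
δ-≢ {x} {y} x≢y with x ≡ᵇ y in eq
... | true  = contradiction (≡ᵇ⇒≡ x y (subst T (sym eq) tt)) x≢y
... | false = refl

δ≢0⇒≡ : ∀ {x y v} → δ x y ≡ suc v → x ≡ y
δ≢0⇒≡ {x} {y} h with x ≡ᵇ y in eq
... | true  = ≡ᵇ⇒≡ x y (subst T (sym eq) tt)

δ≡0⇒≢ : ∀ {x y} → δ x y ≡ 0 → x ≢ y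
δ≡0⇒≢ {x} h refl = contradiction (trans (sym (δ-refl x)) h) λ ()

δ≤1 : ∀ x y → δ x y ≤ 1
δ≤1 x y = bit≤1 (x ≡ᵇ y)

lt≢0⇒< : ∀ {x y v} → bit (x <ᵇ y) ≡ suc v → x < y
lt≢0⇒< {x} {y} h with x <ᵇ y in eq
... | true = <ᵇ⇒< x y (subst T (sym eq) tt)

lt≡0⇒≥ : ∀ {x y} → bit (x <ᵇ y) ≡ 0 → y ≤ x
lt≡0⇒≥ {x} {y} h with x <ᵇ y in eq
... | false = ≮⇒≥ λ x<y → subst T eq (<⇒<ᵇ x<y)

<⇒lt≡1 : ∀ {x y} → x < y → bit (x <ᵇ y) ≡ 1
<⇒lt≡1 {x} {y} x<y with x <ᵇ y in eq
... | true  = refl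
... | false = contradiction (subst T eq (<⇒<ᵇ x<y)) λ ()

-- Halving

data Halved : ℕ → Set where
  even : ∀ y → Halved (y + y)
  odd  : ∀ y → Halved (suc (y + y))

halved : ∀ x → Halved x
halved zero = even 0
halved (suc x) with halved x
... | even y = odd y
... | odd y  = subst Halved (cong suc (+-suc y y)) (even (suc y))

even/2 : ∀ y → (y + y) / 2 ≡ y
even/2 y = trans (cong (_/ 2) (double y)) (m*n/n≡m y 2)
  where
  double : ∀ y → y + y ≡ y * 2
  double = solve-∀

odd/2 : ∀ y → suc (y + y) / 2 ≡ y
odd/2 y = trans (cong (λ z → suc z / 2) (double y))
                (trans (+-distrib-/-∣ʳ 1 {d = 2} (n∣m*n y)) (m*n/n≡m y 2))
  where
  double : ∀ y → y + y ≡ y * 2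
  double = solve-∀

suc-odd/2 : ∀ y → (suc (y + y) + 1) / 2 ≡ suc y
suc-odd/2 y = trans (cong (_/ 2) (double y)) (even/2 (suc y))
  where
  double : ∀ y → suc (y + y) + 1 ≡ suc y + suc y
  double = solve-∀

suc-even/2 : ∀ y → (y + y + 1) / 2 ≡ y
suc-even/2 y = trans (cong (_/ 2) (+-comm (y + y) 1)) (odd/2 y)

double-injective : ∀ {x y} → x + x ≡ y + y → x ≡ y
double-injective {x} {y} h = trans (sym (even/2 x)) (trans (cong (_/ 2) h) (even/2 y))

double≢odd : ∀ {x y} → x + x ≢ suc (y + y)
double≢odd {x} {y} h with trans (sym (even/2 x)) (trans (cong (_/ 2) h) (odd/2 y))
... | refl = 1+n≢n (sym h)

half-< : ∀ {x b} → x < b + b → x / 2 < b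
half-< {x} {b} h with halved x
... | even y rewrite even/2 y = ≰⇒> λ b≤y → <⇒≱ h (+-mono-≤ b≤y b≤y)
... | odd y rewrite odd/2 y = ≰⇒> λ b≤y → <⇒≱ h (≤-trans (+-mono-≤ b≤y b≤y) (n≤1+n _))

-- Finite sums

sumTo : ℕ → (ℕ → ℕ) → ℕ
sumTo zero    f = 0
sumTo (suc m) f = sumTo m f + f m

sumTo-mono : ∀ m {f g} → (∀ i → i < m → f i ≤ g i) → sumTo m f ≤ sumTo m g
sumTo-mono zero    h = z≤n
sumTo-mono (suc m) h = +-mono-≤ (sumTo-mono m λ i i< → h i (m<n⇒m<1+n i<)) (h m ≤-refl)

sumTo-cong : ∀ m {f g} → (∀ i → i < m → f i ≡ g i) → sumTo m f ≡ sumTo m g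
sumTo-cong zero    h = refl
sumTo-cong (suc m) h = cong₂ _+_ (sumTo-cong m λ i i< → h i (m<n⇒m<1+n i<)) (h m ≤-refl)

sumTo-const : ∀ m c → sumTo m (λ _ → c) ≡ m * c
sumTo-const zero    c = refl
sumTo-const (suc m) c = trans (cong (_+ c) (sumTo-const m c)) (+-comm (m * c) c)

sumTo-+ : ∀ m f g → sumTo m (λ i → f i + g i) ≡ sumTo m f + sumTo m g
sumTo-+ zero    f g = refl
sumTo-+ (suc m) f g = trans (cong (_+ (f m + g m)) (sumTo-+ m f g)) (interchange (sumTo m f) _ _ _)
  where
  interchange : ∀ a b c d → a + b + (c + d) ≡ a + c + (b + d)
  interchange = solve-∀

sumTo-* : ∀ m c f → sumTo m (λ i → c * f i) ≡ c * sumTo m f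
sumTo-* zero    c f = sym (*-zeroʳ c)
sumTo-* (suc m) c f = trans (cong (_+ c * f m) (sumTo-* m c f)) (sym (*-distribˡ-+ c _ (f m)))

sumTo-swap : ∀ m n (f : ℕ → ℕ → ℕ) →
             sumTo m (λ i → sumTo n (f i)) ≡ sumTo n (λ j → sumTo m λ i → f i j)
sumTo-swap zero    n f = sym (trans (sumTo-const n 0) (*-zeroʳ n))
sumTo-swap (suc m) n f =
  trans (cong (_+ sumTo n (f m)) (sumTo-swap m n f)) (sym (sumTo-+ n _ (f m)))

sumTo-≤ : ∀ {l m} f → l ≤ m → sumTo l f ≤ sumTo m f
sumTo-≤ {l} {m} f l≤m with m≤n⇒m<n∨m≡n l≤m
... | inj₂ refl = ≤-refl
sumTo-≤ {l} {suc m} f _ | inj₁ l<m = ≤-trans (sumTo-≤ f (≤-pred l<m)) (m≤m+n _ (f m))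

term≤sumTo : ∀ {i m} f → i < m → f i ≤ sumTo m f
term≤sumTo {i} f i<m = ≤-trans (m≤n+m (f i) (sumTo i f)) (sumTo-≤ f i<m)

sumTo-update : ∀ {x m} f a → x < m → sumTo m (f [ x ↦ a ]) + f x ≡ sumTo m f + a
sumTo-update {x} {suc m} f a x<m with x ≟ m
... | yes refl = trans (cong₂ (λ s u → s + u + f x) below (update-≡ f x a)) (swap (sumTo m f) a (f x))
  where
  below : sumTo m (f [ x ↦ a ]) ≡ sumTo m f
  below = sumTo-cong m λ i i< → update-≢ f a (<⇒≢ i< ∘ sym)
  swap : ∀ s a b → s + a + b ≡ s + b + a
  swap = solve-∀
... | no x≢m = begin
  sumTo m g + g m + f x    ≡⟨ cong (λ u → sumTo m g + u + f x) (update-≢ f a x≢m) ⟩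
  sumTo m g + f m + f x    ≡⟨ swap (sumTo m g) (f m) (f x) ⟩
  sumTo m g + f x + f m    ≡⟨ cong (_+ f m) (sumTo-update f a (≤∧≢⇒< (≤-pred x<m) x≢m)) ⟩
  sumTo m f + a + f m      ≡⟨ swap (sumTo m f) a (f m) ⟩
  sumTo m f + f m + a      ∎
  where
  open ≡-Reasoning
  g = f [ x ↦ a ]
  swap : ∀ s a b → s + a + b ≡ s + b + a
  swap = solve-∀

sumTo-δ≤1 : ∀ x m → sumTo m (δ x) ≤ 1
sumTo-δ≤1 x zero = z≤n
sumTo-δ≤1 x (suc m) with x ≟ m
... | no x≢m = subst (_≤ 1) (sym (trans (cong (sumTo m (δ x) +_) (δ-≢ x≢m)) (+-identityʳ _))) (sumTo-δ≤1 x m)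
... | yes refl = ≤-reflexive (cong₂ _+_ zeros (δ-refl x))
  where
  zeros : sumTo m (δ x) ≡ 0
  zeros = trans (sumTo-cong m λ i i< → δ-≢ (<⇒≢ i< ∘ sym)) (trans (sumTo-const m 0) (*-zeroʳ m))

sumTo-δ : ∀ {x m} → x < m → sumTo m (δ x) ≡ 1
sumTo-δ {x} {m} x<m = ≤-antisym (sumTo-δ≤1 x m)
  (subst (_≤ sumTo m (δ x)) (δ-refl x) (term≤sumTo (δ x) x<m))

sumTo≤1 : ∀ m f → (∀ i → i < m → f i ≤ 1) →
          (∀ {i j} → i < m → j < m → 1 ≤ f i → 1 ≤ f j → i ≡ j) → sumTo m f ≤ 1
sumTo≤1 zero    f _ _ = z≤n
sumTo≤1 (suc m) f f≤1 uniq with f m in eq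
... | zero  = subst (_≤ 1) (sym (+-identityʳ _))
                (sumTo≤1 m f (λ i i< → f≤1 i (m<n⇒m<1+n i<))
                  λ i< j< → uniq (m<n⇒m<1+n i<) (m<n⇒m<1+n j<))
... | suc v = subst (_≤ 1) (cong (_+ suc v) (sym zeros)) (subst (_≤ 1) eq (f≤1 m ≤-refl))
  where
  zero-below : ∀ i → i < m → f i ≡ 0
  zero-below i i< with f i in eqᵢ
  ... | zero  = refl
  ... | suc w = contradiction (uniq (m<n⇒m<1+n i<) ≤-refl (subst (1 ≤_) (sym eqᵢ) (s≤s z≤n))
                                    (subst (1 ≤_) (sym eq) (s≤s z≤n))) (<⇒≢ i<)
  zeros : sumTo m f ≡ 0
  zeros = trans (sumTo-cong m zero-below) (trans (sumTo-const m 0) (*-zeroʳ m))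

sumFrom : (ℕ → ℕ) → ℕ → ℕ → ℕ
sumFrom f p zero    = 0
sumFrom f p (suc r) = f p + sumFrom f (suc p) r

sumTo-sumFrom : ∀ f p r → sumTo p f + sumFrom f p r ≡ sumTo (p + r) f
sumTo-sumFrom f p zero    = trans (+-identityʳ _) (cong (λ m → sumTo m f) (sym (+-identityʳ p)))
sumTo-sumFrom f p (suc r) = trans (sym (+-assoc (sumTo p f) (f p) _))
  (trans (sumTo-sumFrom f (suc p) r) (cong (λ m → sumTo m f) (sym (+-suc p r))))

drop-zero : ∀ {a b c} → a ≡ b + c → c ≡ 0 → a ≡ b
drop-zero {b = b} e refl = trans e (+-identityʳ b)

add-zero : ∀ {a b c} → a ≡ b → c ≡ 0 → a ≡ b + c
add-zero {b = b} e refl = trans e (sym (+-identityʳ b))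

-- Segment tree

-- Leaves N, …, 2N − 1; for N not a power of two some cells below N are sums
-- over no interval, which does no harm.
SegTree : ℕ → (ℕ → ℕ) → Set
SegTree N A = ∀ j → 1 ≤ j → j < N → A j ≡ A (j + j) + A (suc (j + j))

-- The children of the nodes 1, ..., m - 1 are exactly the cells 2, ..., 2m - 1. This identity
-- between prefix sums carries all reasoning about levels; no node is ever assigned an interval of
-- leaves.
sumTo-double : ∀ {N A} → SegTree N A → ∀ m → 1 ≤ m → m ≤ N → sumTo (m + m) A ≡ sumTo m A + A 1
sumTo-double tree (suc zero) _ _ = refl
sumTo-double {N} {A} tree (suc (suc m)) _ m≤ = begin
  sumTo (suc m + suc (suc m)) A + A (suc m + suc (suc m))
    ≡⟨ cong (λ x → sumTo x A + A x) (+-suc (suc m) (suc m)) ⟩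
  sumTo (suc m + suc m) A + A (suc m + suc m) + A (suc (suc m + suc m))
    ≡⟨ +-assoc (sumTo (suc m + suc m) A) _ _ ⟩
  sumTo (suc m + suc m) A + (A (suc m + suc m) + A (suc (suc m + suc m)))
    ≡⟨ cong₂ _+_ (sumTo-double tree (suc m) (s≤s z≤n) (<⇒≤ m≤)) (sym (tree (suc m) (s≤s z≤n) m≤)) ⟩
  sumTo (suc m) A + A 1 + A (suc m)
    ≡⟨ exchange (sumTo (suc m) A) (A 1) (A (suc m)) ⟩
  sumTo (suc m) A + A (suc m) + A 1 ∎
  where
  open ≡-Reasoning
  exchange : ∀ a b c → a + b + c ≡ a + c + b
  exchange = solve-∀

double-cancel-≤ : ∀ {a b} → a + a ≤ suc (b + b) → a ≤ b
double-cancel-≤ {a} {b} h = ≮⇒≥ λ b<a →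
  1+n≰n (≤-trans (subst (_≤ a + a) (cong suc (+-suc b b)) (+-mono-≤ b<a b<a)) h)

module _ (A : ℕ → ℕ) where

  -- The factor `lo ∸ (lo / 2 + lo / 2)` is lo mod 2. An odd `lo` is a right child whose sibling
  -- lies outside the interval, so its cell is counted separately before passing to parents.
  round-up : ∀ lo → let a = (lo + 1) / 2 in
    lo ≤ a + a × a + a ≤ suc lo ×
    sumTo (a + a) A ≡ sumTo lo A + (lo ∸ (lo / 2 + lo / 2)) * A lo
  round-up lo with halved lo
  ... | even y rewrite suc-even/2 y | even/2 y | n∸n≡0 (y + y) =
    ≤-refl , n≤1+n _ , sym (+-identityʳ _)
  ... | odd y rewrite suc-odd/2 y | odd/2 y | m+n∸n≡m 1 (y + y) | +-suc y y =
    n≤1+n _ , ≤-refl , cong (sumTo (suc (y + y)) A +_) (sym (*-identityˡ _))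

  round-down : ∀ hi → let b = hi / 2 in
    b + b ≤ hi × hi ≤ suc (b + b) ×
    sumTo hi A ≡ sumTo (b + b) A + (hi ∸ (hi / 2 + hi / 2)) * A (hi ∸ 1)
  round-down hi with halved hi
  ... | even y rewrite even/2 y | n∸n≡0 (y + y) = ≤-refl , n≤1+n _ , sym (+-identityʳ _)
  ... | odd y rewrite odd/2 y | m+n∸n≡m 1 (y + y) =
    n≤1+n _ , ≤-refl , cong (sumTo (y + y) A +_) (sym (*-identityˡ _))

  -- The equation says, without subtraction, that the interval from `lo` to `hi` sums to `t` minus
  -- `acc`. Once the borders are even, halving them removes the same `A 1` from both prefix sums by
  -- `sumTo-double`, and it cancels.
  up-a-level : ∀ {N lo hi acc t} → SegTree N A → 1 ≤ lo → lo < hi → hi ≤ N + N →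
    sumTo hi A + acc ≡ sumTo lo A + t →
    1 ≤ (lo + 1) / 2 × (lo + 1) / 2 ≤ hi / 2 × hi / 2 ≤ N ×
    sumTo (hi / 2) A + (acc + (lo ∸ (lo / 2 + lo / 2)) * A lo
                            + (hi ∸ (hi / 2 + hi / 2)) * A (hi ∸ 1))
      ≡ sumTo ((lo + 1) / 2) A + t
  up-a-level {N} {lo} {hi} {acc} {t} tree 1≤lo lo<hi hi≤ eqn = 1≤a , a≤b , b≤N , eq′
    where
    a = (lo + 1) / 2
    b = hi / 2
    x = (lo ∸ (lo / 2 + lo / 2)) * A lo
    y = (hi ∸ (hi / 2 + hi / 2)) * A (hi ∸ 1)
    up   = round-up lo
    dn = round-down hi
    1≤a : 1 ≤ a
    1≤a = n≢0⇒n>0 λ a≡0 → <⇒≱ 1≤lo (subst (λ z → lo ≤ z + z) a≡0 (proj₁ up))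
    a≤b : a ≤ b
    a≤b = double-cancel-≤ (≤-trans (proj₁ (proj₂ up)) (≤-trans lo<hi (proj₁ (proj₂ dn))))
    b≤N : b ≤ N
    b≤N = double-cancel-≤ (≤-trans (proj₁ dn) (≤-trans hi≤ (n≤1+n _)))
    open ≡-Reasoning
    r₁ : ∀ s u acc x y → s + (acc + x + y) + u ≡ s + u + y + acc + x
    r₁ = solve-∀
    r₂ : ∀ s t x → s + t + x ≡ s + x + t
    r₂ = solve-∀
    eq′ : sumTo b A + (acc + x + y) ≡ sumTo a A + t
    eq′ = +-cancelʳ-≡ (A 1) _ _ (begin
      sumTo b A + (acc + x + y) + A 1    ≡⟨ r₁ (sumTo b A) (A 1) acc x y ⟩
      sumTo b A + A 1 + y + acc + x      ≡⟨ cong (λ z → z + y + acc + x)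
                                              (sym (sumTo-double tree b (≤-trans 1≤a a≤b) b≤N)) ⟩
      sumTo (b + b) A + y + acc + x      ≡⟨ cong (λ z → z + acc + x) (sym (proj₂ (proj₂ dn))) ⟩
      sumTo hi A + acc + x               ≡⟨ cong (_+ x) eqn ⟩
      sumTo lo A + t + x                 ≡⟨ r₂ (sumTo lo A) t x ⟩
      sumTo lo A + x + t                 ≡⟨ cong (_+ t) (sym (proj₂ (proj₂ up))) ⟩
      sumTo (a + a) A + t                ≡⟨ cong (_+ t) (sumTo-double tree a 1≤a (≤-trans a≤b b≤N)) ⟩
      sumTo a A + A 1 + t                ≡⟨ r₂ (sumTo a A) (A 1) t ⟩
      sumTo a A + t + A 1                ∎)

-- A cell one larger than the sum of its children is repaired by decrementing it, which passes the
-- defect on to its parent. The parent of the root is 0, where nothing is required.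
decrement-node : ∀ {N} B h → 1 ≤ h → 1 ≤ B h →
  (∀ j → 1 ≤ j → j < N → B j ≡ B (j + j) + B (suc (j + j)) + δ j h) →
  let B′ = B [ h ↦ B h ∸ 1 ] in
  ∀ j → 1 ≤ j → j < N → B′ j ≡ B′ (j + j) + B′ (suc (j + j)) + δ j (h / 2)
decrement-node B h 1≤h 1≤Bh tree j 1≤j j<N with j ≟ h
... | yes refl
  rewrite update-≡ B h (B h ∸ 1)
        | update-≢ B {h} {h + h} (B h ∸ 1) (<⇒≢ (m<m+n h 1≤h))
        | update-≢ B {h} {suc (h + h)} (B h ∸ 1) (<⇒≢ (s≤s (m≤m+n h h)))
        | δ-≢ {h} {h / 2} (<⇒≢ (half-< {h} (m<m+n h 1≤h)) ∘ sym)
  = trans (cong (_∸ 1) (trans (tree h 1≤j j<N) (cong (B (h + h) + B (suc (h + h)) +_) (δ-refl h))))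
          (trans (m+n∸n≡m _ 1) (sym (+-identityʳ _)))
... | no j≢h with halved h
...   | even y rewrite even/2 y | update-≢ B (B (y + y) ∸ 1) (j≢h ∘ sym)
                     | update-≢ B {y + y} {suc (j + j)} (B (y + y) ∸ 1) (double≢odd {y} {j})
                     | tree j 1≤j j<N | δ-≢ j≢h with j ≟ y
...     | yes refl rewrite update-≡ B (j + j) (B (j + j) ∸ 1) | δ-refl j =
  shift (B (j + j)) (B (suc (j + j))) 1≤Bh
  where
  shift : ∀ a c → 1 ≤ a → a + c + 0 ≡ a ∸ 1 + c + 1
  shift (suc a) c _ = shuffle a c
    where
    shuffle : ∀ a c → suc a + c + 0 ≡ a + c + 1
    shuffle = solve-∀
...     | no j≢y rewrite update-≢ B {y + y} {j + j} (B (y + y) ∸ 1) (j≢y ∘ sym ∘ double-injective)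
                       | δ-≢ j≢y = refl
decrement-node B h 1≤h 1≤Bh tree j 1≤j j<N | no j≢h
      | odd y rewrite odd/2 y | update-≢ B (B (suc (y + y)) ∸ 1) (j≢h ∘ sym)
                    | update-≢ B {suc (y + y)} {j + j} (B (suc (y + y)) ∸ 1) (double≢odd {j} {y} ∘ sym)
                    | tree j 1≤j j<N | δ-≢ j≢h with j ≟ y
...     | yes refl rewrite update-≡ B (suc (j + j)) (B (suc (j + j)) ∸ 1) | δ-refl j =
  shift (B (j + j)) (B (suc (j + j))) 1≤Bh
  where
  shift : ∀ a c → 1 ≤ c → a + c + 0 ≡ a + (c ∸ 1) + 1
  shift a (suc c) _ = shuffle a c
    where
    shuffle : ∀ a c → a + suc c + 0 ≡ a + c + 1
    shuffle = solve-∀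
...     | no j≢y rewrite update-≢ B {suc (y + y)} {suc (j + j)} (B (suc (y + y)) ∸ 1)
                           (j≢y ∘ sym ∘ double-injective ∘ suc-injective)
                       | δ-≢ j≢y = refl

-- Bounds the results of the queries made by `find`, so that they fit into a word.
leaf-sum≤root : ∀ {N A lo hi} → SegTree N A → 1 ≤ N → N ≤ lo → hi ≤ N + N →
                sumTo hi A ≤ sumTo lo A + A 1
leaf-sum≤root {N} {A} tree 1≤N N≤lo hi≤ =
  ≤-trans (sumTo-≤ A hi≤) (≤-trans (≤-reflexive (sumTo-double tree N 1≤N ≤-refl))
                                   (+-monoˡ-≤ (A 1) (sumTo-≤ A N≤lo)))

upper-half≤ : ∀ {x b} → x ≤ b + b → x ∸ x / 2 ≤ b
upper-half≤ {x} {b} h with halved x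
... | even y rewrite even/2 y | m+n∸n≡m y y = double-cancel-≤ (≤-trans h (n≤1+n _))
... | odd y rewrite odd/2 y | m+n∸n≡m (suc y) y = ≰⇒> λ b≤y → <⇒≱ h (+-mono-≤ b≤y b≤y)

lower-half≤ : ∀ {x b} → x ≤ b + b → x / 2 ≤ b
lower-half≤ {x} {b} h with halved x
... | even y rewrite even/2 y = double-cancel-≤ (≤-trans h (n≤1+n _))
... | odd y rewrite odd/2 y = double-cancel-≤ (≤-trans (n≤1+n _) (≤-trans h (n≤1+n _)))

half≤ : ∀ x → x / 2 ≤ x
half≤ x = lower-half≤ (m≤m+n x x)

-- Variables and arrays of the program

lenᵛ kᵛ Nᵛ nᵛ iᵛ vᵛ loᵛ hiᵛ accᵛ jᵛ cntᵛ thrᵛ lᵛ rᵛ mᵛ hᵛ : ℕ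
lenᵛ = 0
kᵛ   = 1
Nᵛ   = 2
nᵛ   = 3
iᵛ   = 4
vᵛ   = 5
loᵛ  = 6
hiᵛ  = 7
accᵛ = 8
jᵛ   = 9
cntᵛ = 10
thrᵛ = 11
lᵛ   = 12
rᵛ   = 13
mᵛ   = 14
hᵛ   = 15

-- Vᵃ is both the input and the output; Cᵃ keeps a copy of the input.
Vᵃ Pᵃ Dᵃ depᵃ Sᵃ szᵃ headᵃ nxtᵃ Aᵃ Cᵃ : ℕ
Vᵃ    = 0
Pᵃ    = 1
Dᵃ    = 2
depᵃ  = 3
Sᵃ    = 4
szᵃ   = 5
headᵃ = 6
nxtᵃ  = 7
Aᵃ    = 8
Cᵃ    = 9

infixl 10 _⊗_ _⊘_
infixl 9 _⊕_ _⊖_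
infix  8 _≺_ _≐_

_⊕_ _⊖_ _⊗_ _⊘_ _≺_ _≐_ : Expr → Expr → Expr
_⊕_ = bin add
_⊖_ = bin sub
_⊗_ = bin mul
_⊘_ = bin div
_≺_ = bin lt
_≐_ = bin eq

mod2 : ℕ → Expr
mod2 x = var x ⊖ (var x ⊘ lit 2 ⊕ var x ⊘ lit 2)

queryBody query : Cmd
queryBody =
    accᵛ ≔ var accᵛ ⊕ mod2 loᵛ ⊗ (Aᵃ ⟨ var loᵛ ⟩)
                    ⊕ mod2 hiᵛ ⊗ (Aᵃ ⟨ var hiᵛ ⊖ lit 1 ⟩)
  ⨾ loᵛ ≔ (var loᵛ ⊕ lit 1) ⊘ lit 2
  ⨾ hiᵛ ≔ var hiᵛ ⊘ lit 2
query = accᵛ ≔ lit 0 ⨾ while (var loᵛ ≺ var hiᵛ) queryBody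

updateBody update : Cmd
updateBody =
    Aᵃ ⟨ var hᵛ ⟩≔ (Aᵃ ⟨ var hᵛ ⟩) ⊖ lit 1
  ⨾ hᵛ ≔ var hᵛ ⊘ lit 2
update = hᵛ ≔ var lᵛ ⨾ while (var hᵛ) updateBody

findBody find : Cmd
findBody =
    (mᵛ ≔ var lᵛ ⊕ (var rᵛ ⊖ var lᵛ) ⊘ lit 2 ⨾ loᵛ ≔ var lᵛ ⨾ hiᵛ ≔ var mᵛ)
  ⨾ query
  ⨾ if (var accᵛ) (rᵛ ≔ var mᵛ) (lᵛ ≔ var mᵛ)
find = while (lit 1 ≺ var rᵛ ⊖ var lᵛ) findBody

-- A loop of at most `b` rounds with test cost c and body time t takes `b * suc (c + t) + suc c`, as
-- in `for-rule`. The other literals are the costs of the code around the loops or around an inner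
-- call.
queryTime updateTime findTime : ℕ → ℕ
queryTime b  = 2 + (b * suc (3 + duration queryBody) + 4)
updateTime b = 2 + (b * suc (1 + duration updateBody) + 2)
findTime b   = b * suc (5 + (12 + (queryTime b + 4))) + 6

2^suc : ∀ b → 2 ^ suc b ≡ 2 ^ b + 2 ^ b
2^suc b = cong (2 ^ b +_) (+-identityʳ _)

-- Correctness of query, update and search in the segment tree

module TreePrograms (W : ℕ) (4≤W : 4 ≤ W) where
  open Logic W 4≤W

  -- By `up-a-level` the equation is invariant, and where the borders meet it says that the
  -- accumulator is `t`. Since `hi` is halved but stays positive, there are at most `b` rounds. The
  -- accumulator never exceeds `t`, so it cannot overflow.
  query-spec : ∀ {σ N b t A lo hi} →
    array σ Aᵃ ≡ A → scalar σ loᵛ ≡ lo → scalar σ hiᵛ ≡ hi →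
    SegTree N A → 1 ≤ lo → lo ≤ hi → hi ≤ N + N → hi < 2 ^ b → N + N + 1 < W → t < W →
    sumTo hi A ≡ sumTo lo A + t →
    Wp query (λ σ′ τ → scalar σ′ accᵛ ≡ t × τ ≤ queryTime b) σ
  query-spec {σ} {N} {b} {t} refl refl refl tree 1≤lo lo≤hi hi≤ hi<2^ N<W t<W eqn =
    block-then _ (conseq (for-rule {j = b} (duration queryBody) I (λ _ → _) step
                           (1≤lo , lo≤hi , hi≤ , hi<2^ , trans (+-identityʳ _) eqn))
      λ {σ′} s ((_ , _ , lo≤hi , _ , _ , eqn) , z , τ≤) →
        let lo≡hi = ≤-antisym lo≤hi (lt≡0⇒≥ z)
        in +-cancelˡ-≡ (sumTo (scalar σ′ hiᵛ) A) _ _ (trans eqn (cong (λ x → sumTo x A + t) lo≡hi)) ,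
           +-monoʳ-≤ 2 τ≤)
    where
    A = array σ Aᵃ
    I : ℕ → Store → Set
    I b σ = 1 ≤ lo × lo ≤ hi × hi ≤ N + N × hi < 2 ^ b × sumTo hi A + scalar σ accᵛ ≡ sumTo lo A + t
      where
      lo = scalar σ loᵛ
      hi = scalar σ hiᵛ
    step : ∀ {b σ₁ v} → Same queryBody (setScalar σ accᵛ 0) σ₁ → I b σ₁ →
           bit (scalar σ₁ loᵛ <ᵇ scalar σ₁ hiᵛ) ≡ suc v →
           ∃[ b′ ] (b ≡ suc b′ × Wp queryBody (λ σ′ τ → I b′ σ′ × τ ≤ duration queryBody) σ₁)
    step {zero} s (1≤lo , lo≤hi , _ , hi< , _) _ =
      contradiction (≤-trans hi< (≤-trans 1≤lo lo≤hi)) 1+n≰n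
    step {suc b} {σ₁} s (1≤lo , lo≤hi , hi≤ , hi< , eqn) z =
      b , refl , block safe ((1≤lo′ , lo′≤hi′ , ≤-trans hi′≤N (m≤m+n N N) , hi′< , eq₁) , ≤-refl)
      where
      lo  = scalar σ₁ loᵛ
      hi  = scalar σ₁ hiᵛ
      acc = scalar σ₁ accᵛ
      A₁  = array σ₁ Aᵃ
      A₁≡A : A₁ ≡ A
      A₁≡A = array≡ s Aᵃ _
      x = (lo ∸ (lo / 2 + lo / 2)) * A₁ lo
      y = (hi ∸ (hi / 2 + hi / 2)) * A₁ (hi ∸ 1)
      level = up-a-level A tree 1≤lo (lt≢0⇒< z) hi≤ eqn
      1≤lo′   = proj₁ level
      lo′≤hi′ = proj₁ (proj₂ level)
      hi′≤N   = proj₁ (proj₂ (proj₂ level))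
      eq₁ : sumTo (hi / 2) A + (acc + x + y) ≡ sumTo ((lo + 1) / 2) A + t
      eq₁ = subst (λ B → sumTo (hi / 2) A + (acc + (lo ∸ (lo / 2 + lo / 2)) * B lo
                          + (hi ∸ (hi / 2 + hi / 2)) * B (hi ∸ 1)) ≡ sumTo ((lo + 1) / 2) A + t)
                  (sym A₁≡A) (proj₂ (proj₂ (proj₂ level)))
      hi′< : hi / 2 < 2 ^ b
      hi′< = half-< (subst (hi <_) (2^suc b) hi<)
      acc′<W : acc + x + y < W
      acc′<W = ≤-<-trans (+-cancelˡ-≤ (sumTo (hi / 2) A) _ _
        (≤-trans (≤-reflexive eq₁) (+-monoˡ-≤ t (sumTo-≤ A lo′≤hi′)))) t<W
      hi<W : hi < W
      hi<W = ≤-<-trans hi≤ (≤-<-trans (m≤m+n _ 1) N<W)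
      safe : SafeBlock queryBody σ₁
      safe = ( ( _
               , ((_ , _ , _ , ≤-<-trans (proj₁ (round-down A lo)) (≤-<-trans lo≤hi hi<W)) , _
                 , ≤-<-trans (≤-trans (m≤n+m x acc) (m≤m+n _ y)) acc′<W)
               , ≤-<-trans (m≤m+n _ y) acc′<W )
             , ( (_ , _ , _ , ≤-<-trans (proj₁ (round-down A hi)) hi<W) , _
               , ≤-<-trans (m≤n+m y (acc + x)) acc′<W )
             , acc′<W )
           , ((_ , _ , ≤-<-trans (+-monoˡ-≤ 1 (≤-trans lo≤hi hi≤)) N<W) , _) , _

  -- The first round decrements the leaf; from then on `hᵛ` is below `N`, so no leaf changes again.
  -- Each later cell is positive because it still exceeds the sum of its children by one. At
  -- `hᵛ = 0` the defect has left the tree.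
  update-spec : ∀ {σ N b A l} → array σ Aᵃ ≡ A → scalar σ lᵛ ≡ l →
    SegTree N A → 1 ≤ N → N ≤ l → l < N + N → l < 2 ^ b → 1 ≤ A l →
    Wp update (λ σ′ τ → SegTree N (array σ′ Aᵃ) ×
                        (∀ x → N ≤ x → array σ′ Aᵃ x ≡ (A [ l ↦ A l ∸ 1 ]) x) ×
                        τ ≤ updateTime b) σ
  update-spec {σ} {N} {b} refl refl tree 1≤N N≤l l< l<2^ 1≤Al =
    block-then _ (conseq (for-rule {j = b} (duration updateBody) I (λ _ → _) step
                           (l<2^ , initial , inj₁ (refl , refl)))
      λ {σ′} _ ((_ , _ , tree′ , leaves) , z , τ≤) →
        (λ j 1≤j j<N → drop-zero (tree′ j 1≤j j<N) (exact j (scalar σ′ hᵛ) 1≤j z)) ,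
        final {σ′} leaves z ,
        +-monoʳ-≤ 2 τ≤)
    where
    A = array σ Aᵃ
    l = scalar σ lᵛ
    A′ = A [ l ↦ A l ∸ 1 ]
    Leaves : Store → Set
    Leaves σ = (scalar σ hᵛ ≡ l × array σ Aᵃ ≡ A) ⊎
               (scalar σ hᵛ < N × (∀ x → N ≤ x → array σ Aᵃ x ≡ A′ x))
    -- Only the parent of the node just decremented deviates, by one.
    I : ℕ → Store → Set
    I b σ = h < 2 ^ b × (∀ j → 1 ≤ j → j < N → B j ≡ B (j + j) + B (suc (j + j)) + δ j h) × Leaves σ
      where
      h = scalar σ hᵛ
      B = array σ Aᵃ
    initial : ∀ j → 1 ≤ j → j < N → A j ≡ A (j + j) + A (suc (j + j)) + δ j l
    initial j 1≤j j<N = add-zero (tree j 1≤j j<N) (δ-≢ (<⇒≢ (<-≤-trans j<N N≤l)))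
    exact : ∀ j h → 1 ≤ j → h ≡ 0 → δ j h ≡ 0
    exact (suc j) _ _ refl = refl
    final : ∀ {σ} → Leaves σ → scalar σ hᵛ ≡ 0 → ∀ x → N ≤ x → array σ Aᵃ x ≡ A′ x
    final (inj₂ (_ , leaves)) _ = leaves
    final (inj₁ (h≡l , _)) z = contradiction (≤-trans 1≤N (subst (N ≤_) (trans (sym h≡l) z) N≤l)) λ ()
    step : ∀ {b σ₁ v} → Same updateBody (setScalar σ hᵛ l) σ₁ → I b σ₁ → scalar σ₁ hᵛ ≡ suc v →
           ∃[ b′ ] (b ≡ suc b′ × Wp updateBody (λ σ′ τ → I b′ σ′ × τ ≤ duration updateBody) σ₁)
    step {zero} _ (h< , _) z = contradiction (subst (_< 1) z h<) λ { (s≤s ()) }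
    step {suc b} {σ₁} {v} _ (h< , tree₁ , leaves) z =
      b , refl , block _ ((h′< , decrement-node B h 1≤h (positive leaves) tree₁ , inj₂ (advance leaves)) , ≤-refl)
      where
      h = scalar σ₁ hᵛ
      B = array σ₁ Aᵃ
      1≤h : 1 ≤ h
      1≤h = subst (1 ≤_) (sym z) (s≤s z≤n)
      h′< : h / 2 < 2 ^ b
      h′< = half-< (subst (h <_) (2^suc b) h<)
      positive : Leaves σ₁ → 1 ≤ B h
      positive (inj₁ (h≡l , B≡A)) = subst₂ (λ C x → 1 ≤ C x) (sym B≡A) (sym h≡l) 1≤Al
      positive (inj₂ (h<N , _)) = subst (1 ≤_) (sym (tree₁ h 1≤h h<N))
        (≤-trans (≤-reflexive (sym (δ-refl h))) (m≤n+m (δ h h) _))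
      advance : Leaves σ₁ → h / 2 < N × (∀ x → N ≤ x → (B [ h ↦ B h ∸ 1 ]) x ≡ A′ x)
      advance (inj₁ (h≡l , B≡A)) = half-< (subst (_< N + N) (sym h≡l) l<) ,
        λ x _ → subst₂ (λ C y → (C [ y ↦ C y ∸ 1 ]) x ≡ A′ x) (sym B≡A) (sym h≡l) refl
      advance (inj₂ (h<N , leaves)) = ≤-<-trans (half≤ h) h<N ,
        λ x N≤x → trans (update-≢ B _ (<⇒≢ (<-≤-trans h<N N≤x))) (leaves x N≤x)

  -- Binary search for a nonzero cell: unequal prefix sums at `l` and `r` certify that one lies
  -- between them. The gap is at most `2 ^ c` with `c` rounds left, and at gap one the cell `l`
  -- itself is positive.
  find-spec : ∀ {σ N b A l r} →
    array σ Aᵃ ≡ A → scalar σ lᵛ ≡ l → scalar σ rᵛ ≡ r →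
    SegTree N A → 1 ≤ N → N ≤ l → r ≤ N + N → r < 2 ^ b → N + N + 1 < W → A 1 < W →
    sumTo l A < sumTo r A →
    Wp find (λ σ′ τ → let l′ = scalar σ′ lᵛ in
                      l ≤ l′ × l′ < r × 1 ≤ A l′ × τ ≤ findTime b) σ
  find-spec {σ} {N} {b} refl refl refl tree 1≤N N≤l r≤ r<2^ N<W A1<W some =
    conseq (for-rule {j = b} _ I (λ _ → _) step
             (≤-refl , ≤-refl , some , ≤-trans (m∸n≤m r₀ l₀) (<⇒≤ r<2^)))
      λ {σ′} _ ((_ , l≤ , r≤ , some , _) , z , τ≤) →
        let r≤1+l = ≤-trans (m≤n+m∸n (scalar σ′ rᵛ) (scalar σ′ lᵛ))
                      (subst (scalar σ′ lᵛ + (scalar σ′ rᵛ ∸ scalar σ′ lᵛ) ≤_) (+-comm (scalar σ′ lᵛ) 1)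
                        (+-monoʳ-≤ (scalar σ′ lᵛ) (lt≡0⇒≥ z)))
        in l≤ , <-≤-trans (sumTo-reflects some) r≤ ,
           +-cancelˡ-< (sumTo (scalar σ′ lᵛ) A) 0 _
             (subst (_< sumTo (scalar σ′ lᵛ) A + A (scalar σ′ lᵛ)) (sym (+-identityʳ _))
               (<-≤-trans some (sumTo-≤ A r≤1+l))) ,
           τ≤
    where
    A  = array σ Aᵃ
    l₀ = scalar σ lᵛ
    r₀ = scalar σ rᵛ
    sumTo-reflects : ∀ {x y} → sumTo x A < sumTo y A → x < y
    sumTo-reflects h = ≰⇒> λ y≤x → <⇒≱ h (sumTo-≤ A y≤x)
    I : ℕ → Store → Set
    I c σ = l₀ ≤ l × r ≤ r₀ × sumTo l A < sumTo r A × r ∸ l ≤ 2 ^ c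
      where
      l = scalar σ lᵛ
      r = scalar σ rᵛ
    step : ∀ {c σ₁ v} → Same findBody σ σ₁ → I c σ₁ →
           bit (1 <ᵇ scalar σ₁ rᵛ ∸ scalar σ₁ lᵛ) ≡ suc v →
           ∃[ c′ ] (c ≡ suc c′ × Wp findBody (λ σ′ τ → I c′ σ′ × τ ≤ 12 + (queryTime b + 4)) σ₁)
    step {zero} s (_ , _ , _ , d≤) z = contradiction (≤-trans (lt≢0⇒< z) d≤) 1+n≰n
    step {suc c} {σ₁} s (l₀≤l , r≤r₀ , some₁ , d≤) z =
      c , refl , block-then ((_ , _ , m<W) , _)
        (query-spec {b = b} {t = sumTo m A₁ ∸ sumTo l A₁} refl refl refl
          tree₁ (≤-trans (≤-trans 1≤N N≤l) l₀≤l) (m≤m+n l _) (≤-trans m≤r r≤N+N)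
          (≤-<-trans (≤-trans m≤r r≤r₀) r<2^) N<W t<W (sym (m+[n∸m]≡n (sumTo-≤ A₁ (m≤m+n l _))))
        then λ {σ₂} s₂ (acc≡ , τ≤) → if-rule _
          (λ {v} acc≢0 → block _
            ((subst (l₀ ≤_) (sym (scalar≡ s₂ lᵛ _)) l₀≤l ,
              subst (_≤ r₀) (sym (scalar≡ s₂ mᵛ _)) (≤-trans m≤r r≤r₀) ,
              subst₂ (λ x y → sumTo x A < sumTo y A) (sym (scalar≡ s₂ lᵛ _)) (sym (scalar≡ s₂ mᵛ _))
                (left-nonempty (trans (sym acc≡) acc≢0)) ,
              subst₂ (λ x y → y ∸ x ≤ 2 ^ c) (sym (scalar≡ s₂ lᵛ _)) (sym (scalar≡ s₂ mᵛ _)) left≤) ,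
             +-monoʳ-≤ 12 (+-monoˡ-≤ 4 τ≤)))
          (λ acc≡0 → block _
            ((subst (l₀ ≤_) (sym (scalar≡ s₂ mᵛ _)) (≤-trans l₀≤l (m≤m+n l _)) ,
              subst (_≤ r₀) (sym (scalar≡ s₂ rᵛ _)) r≤r₀ ,
              subst₂ (λ x y → sumTo x A < sumTo y A) (sym (scalar≡ s₂ mᵛ _)) (sym (scalar≡ s₂ rᵛ _))
                (right-nonempty (trans (sym acc≡) acc≡0)) ,
              subst₂ (λ x y → y ∸ x ≤ 2 ^ c) (sym (scalar≡ s₂ mᵛ _)) (sym (scalar≡ s₂ rᵛ _)) right≤) ,
             +-monoʳ-≤ 12 (+-monoˡ-≤ 4 τ≤))))
      where
      A₁ = array σ₁ Aᵃ
      A₁≡A : A₁ ≡ A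
      A₁≡A = array≡ s Aᵃ _
      l = scalar σ₁ lᵛ
      r = scalar σ₁ rᵛ
      m = l + (r ∸ l) / 2
      tree₁ : SegTree N A₁
      tree₁ = subst (SegTree N) (sym A₁≡A) tree
      r≤N+N = ≤-trans r≤r₀ r≤
      l≤r : l ≤ r
      l≤r = <⇒≤ (sumTo-reflects some₁)
      m≤r : m ≤ r
      m≤r = subst (m ≤_) (m+[n∸m]≡n l≤r) (+-monoʳ-≤ l (half≤ (r ∸ l)))
      m<W : m < W
      m<W = ≤-<-trans (≤-trans m≤r r≤N+N) (≤-<-trans (m≤m+n _ 1) N<W)
      t<W : sumTo m A₁ ∸ sumTo l A₁ < W
      t<W = ≤-<-trans (m≤n+o⇒m∸n≤o (sumTo m A₁) (sumTo l A₁)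
              (leaf-sum≤root tree₁ 1≤N (≤-trans N≤l l₀≤l) (≤-trans m≤r r≤N+N)))
              (subst (λ B → B 1 < W) (sym A₁≡A) A1<W)
      left-nonempty : ∀ {v} → sumTo m A₁ ∸ sumTo l A₁ ≡ suc v → sumTo l A < sumTo m A
      left-nonempty e = subst (λ B → sumTo l B < sumTo m B) A₁≡A
        (≰⇒> λ m≤l → contradiction (trans (sym (m≤n⇒m∸n≡0 m≤l)) e) λ ())
      right-nonempty : sumTo m A₁ ∸ sumTo l A₁ ≡ 0 → sumTo m A < sumTo r A
      right-nonempty e = ≤-<-trans
        (subst (λ B → sumTo m B ≤ sumTo l B) A₁≡A (m∸n≡0⇒m≤n e)) some₁
      d≤′ : r ∸ l ≤ 2 ^ c + 2 ^ c
      d≤′ = subst (r ∸ l ≤_) (2^suc c) d≤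
      left≤ : m ∸ l ≤ 2 ^ c
      left≤ = subst (_≤ 2 ^ c) (sym (m+n∸m≡n l _)) (lower-half≤ d≤′)
      right≤ : r ∸ m ≤ 2 ^ c
      right≤ = subst (_≤ 2 ^ c) (∸-+-assoc r l _) (upper-half≤ d≤′)

sumTo-positive : ∀ m f → 1 ≤ sumTo m f → ∃[ i ] (i < m × 1 ≤ f i)
sumTo-positive (suc m) f h with f m in e
... | suc v = m , ≤-refl , subst (1 ≤_) (sym e) (s≤s z≤n)
... | zero  = let (i , i<m , p) = sumTo-positive m f (subst (1 ≤_) (+-identityʳ _) h)
              in i , m<n⇒m<1+n i<m , p

sumTo-zero : ∀ m f → (∀ i → i < m → f i ≡ 0) → sumTo m f ≡ 0
sumTo-zero m f h = trans (sumTo-cong m h) (trans (sumTo-const m 0) (*-zeroʳ m))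

sumTo-shift : ∀ l x f → sumTo (l + x) f ≡ sumTo l f + sumTo x (λ i → f (l + i))
sumTo-shift l zero    f = trans (cong (λ m → sumTo m f) (+-identityʳ l)) (sym (+-identityʳ _))
sumTo-shift l (suc x) f = trans (cong (λ m → sumTo m f) (+-suc l x))
  (trans (cong (_+ f (l + x)) (sumTo-shift l x f)) (+-assoc (sumTo l f) _ _))

sumTo-below : ∀ m {x} f → x ≤ m → sumTo m (λ q → bit (q <ᵇ x) * f q) ≡ sumTo x f
sumTo-below m {x} f x≤m with m≤n⇒m<n∨m≡n x≤m
... | inj₂ refl = sumTo-cong m λ q q<m → trans (cong (_* f q) (<⇒lt≡1 q<m)) (*-identityˡ (f q))
sumTo-below (suc m) {x} f _ | inj₁ x<1+m = trans
  (cong (sumTo m (λ q → bit (q <ᵇ x) * f q) +_) (cong (_* f m) outside))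
  (trans (+-identityʳ _) (sumTo-below m f (≤-pred x<1+m)))
  where
  outside : bit (m <ᵇ x) ≡ 0
  outside with bit (m <ᵇ x) in e
  ... | zero  = refl
  ... | suc _ = contradiction (lt≢0⇒< {m} e) (≤⇒≯ (≤-pred x<1+m))

sumTo-weighted-swap : ∀ m n (w : ℕ → ℕ) (f : ℕ → ℕ → ℕ) →
  sumTo m (λ i → w i * sumTo n (f i)) ≡ sumTo n (λ j → sumTo m λ i → w i * f i j)
sumTo-weighted-swap m n w f =
  trans (sumTo-cong m λ i _ → sym (sumTo-* n (w i) (f i))) (sumTo-swap m n _)

-- Occurrences of a vertex

-- One more than the last occurrence of v among V 0, …, V (m − 1), or zero.
lastOcc : (ℕ → ℕ) → ℕ → ℕ → ℕ
lastOcc V zero    = λ _ → 0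
lastOcc V (suc m) = lastOcc V m [ V m ↦ suc m ]

module _ (V : ℕ → ℕ) where

  lastOcc≤ : ∀ m v → lastOcc V m v ≤ m
  lastOcc≤ zero    v = z≤n
  lastOcc≤ (suc m) v with V m ≡ᵇ v
  ... | true  = ≤-refl
  ... | false = m≤n⇒m≤1+n (lastOcc≤ m v)

  lastOcc-occ : ∀ m v {x} → lastOcc V m v ≡ suc x → V x ≡ v
  lastOcc-occ (suc m) v h with V m ≟ v
  ... | yes refl = cong V (suc-injective (trans (sym h) (update-≡ (lastOcc V m) (V m) (suc m))))
  ... | no V≢v = lastOcc-occ m v (trans (sym (update-≢ (lastOcc V m) (suc m) V≢v)) h)

  occ≤lastOcc : ∀ m {x} → x < m → suc x ≤ lastOcc V m (V x)
  occ≤lastOcc (suc m) {x} x<1+m with V m ≟ V x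
  ... | yes e rewrite sym e | update-≡ (lastOcc V m) (V m) (suc m) = x<1+m
  ... | no V≢V rewrite update-≢ (lastOcc V m) (suc m) V≢V =
    occ≤lastOcc m (≤∧≢⇒< (≤-pred x<1+m) (V≢V ∘ sym ∘ cong V))

  -- Nothing is lost past the last occurrence. At an occurrence `m` this is the jump to the
  -- preceding one, which the loops along `nxtᵃ` perform.
  sumTo-lastOcc : ∀ m v f → (∀ i → V i ≢ v → f i ≡ 0) → sumTo m f ≡ sumTo (lastOcc V m v) f
  sumTo-lastOcc zero    v f h = refl
  sumTo-lastOcc (suc m) v f h with V m ≟ v
  ... | yes refl rewrite update-≡ (lastOcc V m) (V m) (suc m) = refl
  ... | no V≢v rewrite update-≢ (lastOcc V m) (suc m) V≢v =
    drop-zero (cong (_+ f m) (sumTo-lastOcc m v f h)) (h m V≢v)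

  -- A phase follows the occurrences of a vertex only from the last one, so that the
  -- lengths of these chains add up to at most N.
  chain : ℕ → ℕ → ℕ
  chain N p = δ (lastOcc V N (V p)) (suc p) * sumTo (suc p) (λ i → δ (V i) (V p))

  -- A position is counted only in the chain that starts at the last occurrence of its label;
  -- exchanging the sums counts it once.
  sum-chain≤ : ∀ N → sumTo N (chain N) ≤ N
  sum-chain≤ N = begin
    sumTo N (chain N)                                       ≤⟨ sumTo-mono N chain≤ ⟩
    sumTo N (λ p → sumTo N λ i → δ (lastOcc V N (V i)) (suc p))  ≡⟨ sumTo-swap N N _ ⟩
    sumTo N (λ i → sumTo N λ p → δ (lastOcc V N (V i)) (suc p))
      ≤⟨ sumTo-mono N (λ i _ → one (lastOcc V N (V i))) ⟩
    sumTo N (λ _ → 1)                                       ≡⟨ trans (sumTo-const N 1) (*-identityʳ N) ⟩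
    N                                                       ∎
    where
    open ≤-Reasoning
    one : ∀ x → sumTo N (λ p → δ x (suc p)) ≤ 1
    one zero    = ≤-trans (≤-reflexive (sumTo-zero N _ λ _ _ → refl)) z≤n
    one (suc x) = sumTo-δ≤1 x N
    chain≤ : ∀ p → p < N → chain N p ≤ sumTo N λ i → δ (lastOcc V N (V i)) (suc p)
    chain≤ p p<N with lastOcc V N (V p) ≟ suc p
    ... | no h≢ rewrite δ-≢ h≢ = z≤n
    ... | yes h rewrite h | δ-refl p = ≤-trans (≤-reflexive (+-identityʳ _)) (≤-trans
      (sumTo-mono (suc p) same-chain) (sumTo-≤ (λ i → δ (lastOcc V N (V i)) (suc p)) p<N))
      where
      same-chain : ∀ i → i < suc p → δ (V i) (V p) ≤ δ (lastOcc V N (V i)) (suc p)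
      same-chain i _ with V i ≟ V p
      ... | no V≢V rewrite δ-≢ V≢V = z≤n
      ... | yes e rewrite e | h | δ-refl p = δ≤1 (V p) (V p)

-- Covered targets

-- Position i covers the positions of its subtree, i ≤ q < i + sz i.
cov : (ℕ → ℕ) → ℕ → ℕ → ℕ
cov sz i q = bit (q <ᵇ i + sz i) ∸ bit (q <ᵇ i)

module _ (sz : ℕ → ℕ) where

  cov≤1 : ∀ i q → cov sz i q ≤ 1
  cov≤1 i q = ≤-trans (m∸n≤m (bit (q <ᵇ i + sz i)) (bit (q <ᵇ i))) (bit≤1 _)

  cov⇒ : ∀ {i q} → 1 ≤ cov sz i q → i ≤ q × q < i + sz i
  cov⇒ {i} {q} h with bit (q <ᵇ i) in e₁ | bit (q <ᵇ i + sz i) in e₂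
  ... | zero  | suc _ = lt≡0⇒≥ e₁ , lt≢0⇒< e₂
  ... | suc x | suc y = contradiction (≤-trans h (≤-trans (m∸n≤m y x) (≤-pred (subst (_≤ 1) e₂ (bit≤1 (q <ᵇ i + sz i)))))) 1+n≰n

  cov⇐ : ∀ {i q} → i ≤ q → q < i + sz i → cov sz i q ≡ 1
  cov⇐ {i} {q} i≤q q< with bit (q <ᵇ i) in e
  ... | zero  = <⇒lt≡1 q<
  ... | suc _ = contradiction (lt≢0⇒< {q} e) (≤⇒≯ i≤q)

  lt-split : ∀ i q → bit (q <ᵇ i + sz i) ≡ bit (q <ᵇ i) + cov sz i q
  lt-split i q = sym (m+[n∸m]≡n monotone)
    where
    monotone : bit (q <ᵇ i) ≤ bit (q <ᵇ i + sz i)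
    monotone with bit (q <ᵇ i) in e
    ... | zero  = z≤n
    ... | suc x = subst (suc x ≤_) (sym (<⇒lt≡1 (<-≤-trans (lt≢0⇒< {q} e) (m≤m+n i (sz i)))))
                    (subst (_≤ 1) e (bit≤1 (q <ᵇ i)))

-- The interface between the forest and the greedy analysis. `separated` reflects that labels do not
-- repeat along a root path, `deep` that a k-hop root path has many vertices.
record Instance (n k N : ℕ) (V sz tgt : ℕ → ℕ) : Set where
  field
    vertex<   : ∀ {i} → i < N → V i < n
    end≤      : ∀ {i} → i < N → i + sz i ≤ N
    separated : ∀ {q i i′} → q < N → i < N → i′ < N →
                1 ≤ cov sz i q → 1 ≤ cov sz i′ q → V i ≡ V i′ → i ≡ i′
    deep      : ∀ {q} → q < N → 1 ≤ tgt q → k ≤ sumTo N (λ i → cov sz i q)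

-- Degrees and double counting

module Counting {n k N : ℕ} {V sz tgt : ℕ → ℕ} (inst : Instance n k N V sz tgt) where
  open Instance inst

  leaves : (ℕ → ℕ) → ℕ
  leaves A = sumTo N λ q → A (N + q)

  below : (ℕ → ℕ) → ℕ → ℕ
  below A i = sumTo N λ q → cov sz i q * A (N + q)

  degree : (ℕ → ℕ) → ℕ → ℕ
  degree A v = sumTo N λ i → δ (V i) v * below A i

  _⊑_ : (ℕ → ℕ) → (ℕ → ℕ) → Set
  A ⊑ B = ∀ q → q < N → A (N + q) ≤ B (N + q)

  root≡leaves : ∀ {A} → SegTree N A → 1 ≤ N → A 1 ≡ leaves A
  root≡leaves {A} tree 1≤N = +-cancelˡ-≡ (sumTo N A) _ _
    (trans (sym (sumTo-double tree N 1≤N ≤-refl)) (sumTo-shift N N A))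

  -- This is the equation that `query-spec` expects, so a query over the leaves of the subtree at
  -- `i` yields `below A i`.
  segment-sum : ∀ A {i} → i < N → sumTo (N + i + sz i) A ≡ sumTo (N + i) A + below A i
  segment-sum A {i} i<N = begin
    sumTo (N + i + sz i) A                   ≡⟨ cong (λ m → sumTo m A) (+-assoc N i (sz i)) ⟩
    sumTo (N + (i + sz i)) A                 ≡⟨ sumTo-shift N (i + sz i) A ⟩
    sumTo N A + sumTo (i + sz i) a           ≡⟨ cong (sumTo N A +_) split ⟩
    sumTo N A + (sumTo i a + below A i)      ≡⟨ +-assoc (sumTo N A) _ _ ⟨
    sumTo N A + sumTo i a + below A i        ≡⟨ cong (_+ below A i) (sumTo-shift N i A) ⟨
    sumTo (N + i) A + below A i              ∎
    where
    open ≡-Reasoning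
    a : ℕ → ℕ
    a q = A (N + q)
    split : sumTo (i + sz i) a ≡ sumTo i a + below A i
    split = begin
      sumTo (i + sz i) a                             ≡⟨ sumTo-below N a (end≤ i<N) ⟨
      sumTo N (λ q → bit (q <ᵇ i + sz i) * a q)
        ≡⟨ sumTo-cong N (λ q _ → trans (cong (_* a q) (lt-split sz i q)) (*-distribʳ-+ (a q) (bit (q <ᵇ i)) _)) ⟩
      sumTo N (λ q → bit (q <ᵇ i) * a q + cov sz i q * a q)  ≡⟨ sumTo-+ N _ _ ⟩
      sumTo N (λ q → bit (q <ᵇ i) * a q) + below A i
        ≡⟨ cong (_+ below A i) (sumTo-below N a (<⇒≤ i<N)) ⟩
      sumTo i a + below A i                          ∎

  below-mono : ∀ {A B} → A ⊑ B → ∀ i → below A i ≤ below B i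
  below-mono A⊑B i = sumTo-mono N λ q q<N → *-monoʳ-≤ (cov sz i q) (A⊑B q q<N)

  below≤leaves : ∀ A i → below A i ≤ leaves A
  below≤leaves A i = sumTo-mono N λ q _ →
    ≤-trans (*-monoˡ-≤ (A (N + q)) (cov≤1 sz i q)) (≤-reflexive (*-identityˡ _))

  degree-mono : ∀ {A B} → A ⊑ B → ∀ v → degree A v ≤ degree B v
  degree-mono {A} {B} A⊑B v = sumTo-mono N λ i _ → *-monoʳ-≤ (δ (V i) v) (below-mono {A} {B} A⊑B i)

  degree-zero : ∀ {A v} → (∀ {i} → i < N → V i ≡ v → below A i ≡ 0) → degree A v ≡ 0
  degree-zero {A} {v} h = sumTo-zero N _ term
    where
    term : ∀ i → i < N → δ (V i) v * below A i ≡ 0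
    term i i<N with V i ≟ v
    ... | yes e  = trans (cong (δ (V i) v *_) (h i<N e)) (*-zeroʳ (δ (V i) v))
    ... | no V≢v = cong (_* below A i) (δ-≢ V≢v)

  factors≥1 : ∀ {x y} → 1 ≤ x * y → 1 ≤ x × 1 ≤ y
  factors≥1 {suc x} {suc y} _ = s≤s z≤n , s≤s z≤n
  factors≥1 {suc x} {zero}  h = contradiction (subst (1 ≤_) (*-zeroʳ x) h) λ ()

  -- A target has at most one ancestor labelled v, so killing the occurrences of v
  -- kills degree A v targets.
  degree-drop : ∀ {A B v} → B ⊑ A → (∀ {i} → i < N → V i ≡ v → below B i ≡ 0) →
                leaves B + degree A v ≤ leaves A
  degree-drop {A} {B} {v} B⊑A killed = begin
    leaves B + degree A v
      ≡⟨ cong (leaves B +_) (sumTo-weighted-swap N N (λ i → δ (V i) v) _) ⟩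
    leaves B + sumTo N (λ q → sumTo N λ i → δ (V i) v * (cov sz i q * A (N + q)))
      ≡⟨ cong (leaves B +_) (sumTo-cong N λ q _ → trans
           (sumTo-cong N λ i _ → rotate (δ (V i) v) (cov sz i q) (A (N + q)))
           (sumTo-* N (A (N + q)) (λ i → δ (V i) v * cov sz i q))) ⟩
    leaves B + sumTo N (λ q → A (N + q) * ancestors q)
      ≡⟨ sumTo-+ N _ _ ⟨
    sumTo N (λ q → B (N + q) + A (N + q) * ancestors q)
      ≤⟨ sumTo-mono N pointwise ⟩
    leaves A ∎
    where
    open ≤-Reasoning
    rotate : ∀ x y z → x * (y * z) ≡ z * (x * y)
    rotate = solve-∀
    ancestors : ℕ → ℕ
    ancestors q = sumTo N λ i → δ (V i) v * cov sz i q
    occurs : ∀ {i q} → 1 ≤ δ (V i) v * cov sz i q → V i ≡ v × 1 ≤ cov sz i q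
    occurs {i} {q} h with factors≥1 {δ (V i) v} h
    ... | p , c with δ (V i) v in e
    ...   | suc _ = δ≢0⇒≡ e , c
    ancestors≤1 : ∀ {q} → q < N → ancestors q ≤ 1
    ancestors≤1 {q} q<N = sumTo≤1 N _
      (λ i _ → *-mono-≤ (δ≤1 (V i) v) (cov≤1 sz i q))
      λ i< j< p₁ p₂ → let (e₁ , c₁) = occurs p₁; (e₂ , c₂) = occurs p₂
                      in separated q<N i< j< c₁ c₂ (trans e₁ (sym e₂))
    pointwise : ∀ q → q < N → B (N + q) + A (N + q) * ancestors q ≤ A (N + q)
    pointwise q q<N with ancestors q in e
    ... | zero  = subst (_≤ A (N + q))
                    (sym (trans (cong (B (N + q) +_) (*-zeroʳ (A (N + q)))) (+-identityʳ _))) (B⊑A q q<N)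
    ... | suc x = subst (λ b → b + A (N + q) * suc x ≤ A (N + q)) (sym dead)
                    (≤-trans (*-monoʳ-≤ (A (N + q)) (subst (_≤ 1) e (ancestors≤1 q<N)))
                             (≤-reflexive (*-identityʳ _)))
      where
      dead : B (N + q) ≡ 0
      dead with sumTo-positive N (λ i → δ (V i) v * cov sz i q) (subst (1 ≤_) (sym e) (s≤s z≤n))
      ... | i , i<N , p with occurs p
      ...   | V≡v , c = n≤0⇒n≡0 (≤-trans
        (≤-trans (≤-reflexive (sym (*-identityˡ _))) (*-monoˡ-≤ (B (N + q)) c))
        (≤-trans (term≤sumTo (λ q → cov sz i q * B (N + q)) q<N) (≤-reflexive (killed i<N V≡v))))

  -- Pairs of a live target and a position covering it are counted in two ways, by target and by
  -- vertex. Everything is multiplied by `n * k`, so that the threshold R k / 2n never appears as a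
  -- quotient.
  halves : ∀ {A R} → 1 ≤ n → 1 ≤ k → (∀ q → q < N → A (N + q) ≤ tgt q) →
           (∀ {i} → i < N → degree A (V i) * (n + n) ≤ R * k) →
           leaves A + leaves A ≤ R
  halves {A} {R} 1≤n 1≤k leaf≤ small = *-cancelʳ-≤ _ _ (n * k) {{>-nonZero (*-mono-≤ 1≤n 1≤k)}} (begin
    (leaves A + leaves A) * (n * k)             ≡⟨ r₁ (leaves A) n k ⟩
    k * leaves A * (n + n)                      ≤⟨ *-monoˡ-≤ (n + n) paths ⟩
    sumTo n (degree A) * (n + n)                ≡⟨ *-comm _ (n + n) ⟩
    (n + n) * sumTo n (degree A)                ≡⟨ sumTo-* n (n + n) (degree A) ⟨
    sumTo n (λ v → (n + n) * degree A v)        ≤⟨ sumTo-mono n (λ v _ → small′ v) ⟩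
    sumTo n (λ _ → R * k)                       ≡⟨ sumTo-const n (R * k) ⟩
    n * (R * k)                                 ≡⟨ r₂ n R k ⟩
    R * (n * k)                                 ∎)
    where
    open ≤-Reasoning
    r₁ : ∀ x n k → (x + x) * (n * k) ≡ k * x * (n + n)
    r₁ = solve-∀
    r₂ : ∀ n r k → n * (r * k) ≡ r * (n * k)
    r₂ = solve-∀
    -- The hypothesis concerns only listed vertices, as only these are visited; an unlisted one has
    -- degree 0.
    small′ : ∀ v → (n + n) * degree A v ≤ R * k
    small′ v with degree A v in e
    ... | zero  = ≤-trans (≤-reflexive (*-zeroʳ (n + n))) z≤n
    ... | suc x with sumTo-positive N _ (subst (1 ≤_) (sym e) (s≤s z≤n))
    ...   | i , i<N , p with δ (V i) v in e′ | factors≥1 {δ (V i) v} p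
    ...     | suc _ | _ rewrite sym e | sym (δ≢0⇒≡ {V i} e′) = subst (_≤ R * k) (*-comm _ (n + n)) (small i<N)
    a≤ : ∀ q → q < N → k * A (N + q) ≤ A (N + q) * sumTo N (λ i → cov sz i q)
    a≤ q q<N with A (N + q) in e
    ... | zero  = ≤-reflexive (*-zeroʳ k)
    ... | suc x = ≤-trans (≤-reflexive (*-comm k (suc x)))
      (*-monoʳ-≤ (suc x) (deep q<N (≤-trans (subst (1 ≤_) (sym e) (s≤s z≤n)) (leaf≤ q q<N))))
    paths : k * leaves A ≤ sumTo n (degree A)
    paths = begin
      k * leaves A                                     ≡⟨ sumTo-* N k _ ⟨
      sumTo N (λ q → k * A (N + q))                    ≤⟨ sumTo-mono N a≤ ⟩
      sumTo N (λ q → A (N + q) * sumTo N (λ i → cov sz i q))  ≡⟨ sumTo-weighted-swap N N (λ q → A (N + q)) (λ q i → cov sz i q) ⟩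
      sumTo N (λ i → sumTo N λ q → A (N + q) * cov sz i q)
        ≡⟨ sumTo-cong N (λ i _ → sumTo-cong N λ q _ → *-comm (A (N + q)) _) ⟩
      sumTo N (below A)
        ≡⟨ sumTo-cong N (λ i i<N → sym (trans (cong (below A i *_) (sumTo-δ (vertex< i<N))) (*-identityʳ _))) ⟩
      sumTo N (λ i → below A i * sumTo n (δ (V i)))    ≡⟨ sumTo-weighted-swap N n (below A) _ ⟩
      sumTo n (λ v → sumTo N λ i → below A i * δ (V i) v)
        ≡⟨ sumTo-cong n (λ v _ → sumTo-cong N λ i _ → *-comm (below A i) _) ⟩
      sumTo n (degree A)                               ∎

  -- The exact drop of the root is what pays for the kill in `kill-spec`.
  kill-leaf : ∀ {A B q} → SegTree N A → SegTree N B → q < N → 1 ≤ A (N + q) →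
    (∀ x → N ≤ x → B x ≡ (A [ N + q ↦ A (N + q) ∸ 1 ]) x) →
    B ⊑ A × A 1 ≡ suc (B 1) × (∀ {q′} → q ≢ q′ → B (N + q′) ≡ A (N + q′))
  kill-leaf {A} {B} {q} treeA treeB q<N alive leaf = B⊑A , root′ , other
    where
    1≤N : 1 ≤ N
    1≤N = ≤-trans (s≤s z≤n) q<N
    a : ℕ → ℕ
    a q = A (N + q)
    other : ∀ {q′} → q ≢ q′ → B (N + q′) ≡ A (N + q′)
    other {q′} q≢q′ = trans (leaf (N + q′) (m≤m+n N q′)) (update-≢ A _ (q≢q′ ∘ +-cancelˡ-≡ N q q′))
    here′ : B (N + q) ≡ a q ∸ 1
    here′ = trans (leaf (N + q) (m≤m+n N q)) (update-≡ A (N + q) _)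
    B⊑A : B ⊑ A
    B⊑A q′ _ with q ≟ q′
    ... | yes refl = ≤-trans (≤-reflexive here′) (m∸n≤m (a q) 1)
    ... | no q≢q′  = ≤-reflexive (other q≢q′)
    updated : ∀ q′ → q′ < N → B (N + q′) ≡ (a [ q ↦ a q ∸ 1 ]) q′
    updated q′ _ with q ≟ q′
    ... | yes refl = trans here′ (sym (update-≡ a q _))
    ... | no q≢q′  = trans (other q≢q′) (sym (update-≢ a _ q≢q′))
    one-less : ∀ x y z → 1 ≤ x → y + x ≡ z + (x ∸ 1) → z ≡ suc y
    one-less (suc x) y z _ e = sym (+-cancelʳ-≡ x _ _ (trans (sym (+-suc y x)) e))
    root′ : A 1 ≡ suc (B 1)
    root′ = trans (root≡leaves treeA 1≤N) (trans
      (one-less (a q) (leaves B) (leaves A) alive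
        (trans (cong (_+ a q) (sumTo-cong N updated)) (sumTo-update a (a q ∸ 1) q<N)))
      (cong suc (sym (root≡leaves treeB 1≤N))))

  -- The case of `degree-drop` in which every target is dead afterwards.
  degree≤leaves : ∀ A v → degree A v ≤ leaves A
  degree≤leaves A v = ≤-trans (m≤n+m _ (leaves (λ _ → 0)))
    (degree-drop {A} {λ _ → 0} {v} (λ _ _ → z≤n) λ {i} _ _ → sumTo-zero N _ λ q _ → *-zeroʳ (cov sz i q))

-- Greedy phases

-- `jᵛ` holds one more than a position, and 0 at the end of a chain, as `lastOcc` does. `killBody`
-- stays at an occurrence until its interval is empty and only then advances. The test in `process`
-- compares the count times 2n with R k, which avoids a division.
segment probe tally advance countBody count killBody kill pick process visit phase phases : Cmd
segment =
    lᵛ ≔ var Nᵛ ⊕ (var jᵛ ⊖ lit 1)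
  ⨾ rᵛ ≔ var lᵛ ⊕ szᵃ ⟨ var jᵛ ⊖ lit 1 ⟩
  ⨾ loᵛ ≔ var lᵛ
  ⨾ hiᵛ ≔ var rᵛ
probe = segment ⨾ query
advance = jᵛ ≔ nxtᵃ ⟨ var jᵛ ⊖ lit 1 ⟩
tally = cntᵛ ≔ var cntᵛ ⊕ var accᵛ ⨾ advance
countBody = probe ⨾ tally
count = (cntᵛ ≔ lit 0 ⨾ jᵛ ≔ var iᵛ ⊕ lit 1) ⨾ while (var jᵛ) countBody
killBody = probe ⨾ if (var accᵛ) (find ⨾ update) advance
kill = while (var jᵛ) killBody
pick =
    (Vᵃ ⟨ var lenᵛ ⟩≔ var vᵛ ⨾ lenᵛ ≔ var lenᵛ ⊕ lit 1 ⨾ jᵛ ≔ var iᵛ ⊕ lit 1)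
  ⨾ kill
process = count ⨾ if (var cntᵛ ⊗ (var nᵛ ⊕ var nᵛ) ≺ var thrᵛ) skip pick
visit =
    vᵛ ≔ Cᵃ ⟨ var iᵛ ⟩
  ⨾ if (headᵃ ⟨ var vᵛ ⟩ ≐ var iᵛ ⊕ lit 1) process skip
  ⨾ iᵛ ≔ var iᵛ ⊕ lit 1
phase =
    (thrᵛ ≔ Aᵃ ⟨ lit 1 ⟩ ⊗ var kᵛ ⨾ iᵛ ≔ lit 0)
  ⨾ while (var iᵛ ≺ var Nᵛ) visit
phases = while (Aᵃ ⟨ lit 1 ⟩) phase

-- `killTime` and `advanceTime` belong to the two kinds of iteration of `kill`, which are charged
-- differently: one to the live targets, one to the occurrences.
probeTime countTime killTime advanceTime : ℕ → ℕ
probeTime b   = duration segment + queryTime b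
countTime b   = suc (1 + (probeTime b + duration tally))
killTime b    = suc (1 + (probeTime b + suc (1 + (findTime b + updateTime b))))
advanceTime b = suc (1 + (probeTime b + suc (1 + duration advance)))

module _ (n k N : ℕ) (V sz : ℕ → ℕ) where

  -- Takes components instead of a store, so that rewriting with the frame equations carries it from
  -- one store to another.
  record Tables (k′ N′ n′ : ℕ) (size head next copy : ℕ → ℕ) : Set where
    field
      k≡    : k′ ≡ k
      N≡    : N′ ≡ N
      n≡    : n′ ≡ n
      size≡ : ∀ {i} → i < N → size i ≡ sz i
      head≡ : ∀ v → head v ≡ lastOcc V N v
      next≡ : ∀ {i} → i < N → next i ≡ lastOcc V i (V i)
      copy≡ : ∀ {i} → i < N → copy i ≡ V i

  Static : Store → Set
  Static σ = Tables (scalar σ kᵛ) (scalar σ Nᵛ) (scalar σ nᵛ)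
                    (array σ szᵃ) (array σ headᵃ) (array σ nxtᵃ) (array σ Cᵃ)

  static-same : ∀ {c σ σ′} → Same c σ σ′ →
    {_ : T (not (writesScalar c kᵛ))} {_ : T (not (writesScalar c Nᵛ))} {_ : T (not (writesScalar c nᵛ))}
    {_ : T (not (writesArray c szᵃ))} {_ : T (not (writesArray c headᵃ))}
    {_ : T (not (writesArray c nxtᵃ))} {_ : T (not (writesArray c Cᵃ))} →
    Static σ → Static σ′
  static-same s {a} {b} {c} {d} {e} {f} {g} st
    rewrite scalar≡ s kᵛ a | scalar≡ s Nᵛ b | scalar≡ s nᵛ c
          | array≡ s szᵃ d | array≡ s headᵃ e | array≡ s nxtᵃ f | array≡ s Cᵃ g = st

-- Walking along the occurrences of a vertex

module Occurrences (W : ℕ) (4≤W : 4 ≤ W) {n k N : ℕ} {V sz tgt : ℕ → ℕ}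
  (inst : Instance n k N V sz tgt) (b : ℕ) (N<W : N + N + 1 < W) (2N<2^b : N + N < 2 ^ b) where

  open Logic W 4≤W
  open TreePrograms W 4≤W
  open Instance inst
  open Counting inst

  N≤W : ∀ {x} → x ≤ N → x < W
  N≤W x≤N = ≤-<-trans x≤N (≤-<-trans (≤-trans (m≤m+n N N) (m≤m+n _ 1)) N<W)

  St : Store → Set
  St = Static n k N V sz

  probe-spec : ∀ {σ A i} → array σ Aᵃ ≡ A → scalar σ jᵛ ≡ suc i → i < N →
    St σ → SegTree N A → A 1 ≤ N →
    Wp probe (λ σ′ τ → scalar σ′ accᵛ ≡ below A i × scalar σ′ lᵛ ≡ N + i ×
                       scalar σ′ rᵛ ≡ N + i + sz i × τ ≤ probeTime b) σ
  probe-spec {σ} {A} {i} refl j≡ i<N st tree A1≤N =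
    block-then ((_ , _ , l<W) , ((_ , _ , r<W) , _))
      (conseq (query-spec {b = b} {t = below A i} refl l≡ r≡ tree
                (≤-trans (≤-trans (s≤s z≤n) i<N) (m≤m+n N i)) (m≤m+n _ (sz i)) r≤
                (≤-<-trans r≤ 2N<2^b) N<W below<W (segment-sum A i<N))
        λ s (acc≡ , τ≤) → acc≡ , trans (scalar≡ s lᵛ _) l≡ , trans (scalar≡ s rᵛ _) r≡ ,
                          +-monoʳ-≤ (duration segment) τ≤)
    where
    open Tables st
    l≡ : scalar σ Nᵛ + (scalar σ jᵛ ∸ 1) ≡ N + i
    l≡ = cong₂ _+_ N≡ (cong (_∸ 1) j≡)
    r≡ : scalar σ Nᵛ + (scalar σ jᵛ ∸ 1) + array σ szᵃ (scalar σ jᵛ ∸ 1) ≡ N + i + sz i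
    r≡ = cong₂ _+_ l≡ (trans (cong (λ x → array σ szᵃ (x ∸ 1)) j≡) (size≡ i<N))
    r≤ : N + i + sz i ≤ N + N
    r≤ = ≤-trans (≤-reflexive (+-assoc N i (sz i))) (+-monoʳ-≤ N (end≤ i<N))
    2N<W : ∀ {x} → x ≤ N + N → x < W
    2N<W x≤ = ≤-<-trans x≤ (≤-<-trans (m≤m+n _ 1) N<W)
    l<W : scalar σ Nᵛ + (scalar σ jᵛ ∸ 1) < W
    l<W = subst (_< W) (sym l≡) (2N<W (+-monoʳ-≤ N (<⇒≤ i<N)))
    r<W = subst (_< W) (sym r≡) (2N<W r≤)
    below<W : below A i < W
    below<W = N≤W (≤-trans (below≤leaves A i)
      (≤-trans (≤-reflexive (sym (root≡leaves tree (≤-trans (s≤s z≤n) i<N)))) A1≤N))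

  -- The count so far plus the contributions of the positions before `jᵛ` stays constant: by
  -- `sumTo-lastOcc`, a step along the chain removes exactly one nonvanishing term.
  count-spec : ∀ {σ A p} → array σ Aᵃ ≡ A → scalar σ iᵛ ≡ p → p < N →
    St σ → SegTree N A → A 1 ≤ N →
    Wp count (λ σ′ τ → scalar σ′ cntᵛ ≡ sumTo (suc p) (λ i → δ (V i) (V p) * below A i) ×
                       τ ≤ 6 + (sumTo (suc p) (λ i → δ (V i) (V p)) * countTime b + 2)) σ
  count-spec {σ} {A} {p} refl refl p<N st tree A1≤N =
    block-then ((_ , _ , _ , N≤W (subst (_≤ N) (+-comm 1 p) p<N)))
      (conseq (for-rule (probeTime b + duration tally) I (λ _ → _) step
                 (subst (_≤ N) (+-comm 1 p) p<N , occ , cong (λ m → sumTo m f) (+-comm 1 p) ,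
                  cong (λ m → sumTo m g) (+-comm p 1)))
        λ { {σ′} _ ((_ , _ , _ , _ , total) , j≡0 , τ≤) →
            trans (sym (+-identityʳ _)) (trans (cong (λ m → scalar σ′ cntᵛ + sumTo m g) (sym j≡0)) total) ,
            +-monoʳ-≤ 6 τ≤ })
    where
    open Tables
    v = V p
    f g : ℕ → ℕ
    f i = δ (V i) v
    g i = δ (V i) v * below A i
    total≤N : sumTo (suc p) g ≤ N
    total≤N = ≤-trans (sumTo-≤ g p<N) (≤-trans (degree≤leaves A v)
      (≤-trans (≤-reflexive (sym (root≡leaves tree (≤-trans (s≤s z≤n) p<N)))) A1≤N))
    I : ℕ → Store → Set
    I c σ = j ≤ N × (∀ {x} → j ≡ suc x → V x ≡ v) × c ≡ sumTo j f ×
            scalar σ cntᵛ + sumTo j g ≡ sumTo (suc p) g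
      where
      j = scalar σ jᵛ
    occ : ∀ {x} → p + 1 ≡ suc x → V x ≡ v
    occ e = cong V (sym (suc-injective (trans (+-comm 1 p) e)))
    step : ∀ {c σ₁ i} → Same countBody (setScalar (setScalar σ cntᵛ 0) jᵛ (p + 1)) σ₁ → I c σ₁ →
           scalar σ₁ jᵛ ≡ suc i →
           ∃[ c′ ] (c ≡ suc c′ × Wp countBody (λ σ′ τ → I c′ σ′ × τ ≤ probeTime b + duration tally) σ₁)
    step {c} {σ₁} {i} s (j≤N , occ , c≡ , total) j≡ =
      sumTo j′ f , trans c≡ c-suc ,
      (probe-spec (array≡ s Aᵃ _) j≡ i<N st₁ tree A1≤N then λ {σ₂} s₂ (acc≡ , _ , _ , τ≤) →
        let next : array σ₂ nxtᵃ (scalar σ₂ jᵛ ∸ 1) ≡ j′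
            next = trans (cong₂ (λ a x → a (x ∸ 1)) (array≡ s₂ nxtᵃ _) (trans (scalar≡ s₂ jᵛ _) j≡))
                         (trans (next≡ st₁ i<N) (cong (lastOcc V i) V≡v))
            cnt≡ : scalar σ₂ cntᵛ + scalar σ₂ accᵛ ≡ scalar σ₁ cntᵛ + below A i
            cnt≡ = cong₂ _+_ (scalar≡ s₂ cntᵛ _) acc≡
            total′ : scalar σ₂ cntᵛ + scalar σ₂ accᵛ + sumTo j′ g ≡ sumTo (suc p) g
            total′ = trans (cong (_+ sumTo j′ g) cnt≡) sum′
        in block ((_ , _ , N≤W (≤-trans (m≤m+n _ (sumTo j′ g)) (≤-trans (≤-reflexive total′) total≤N))) , _)
             ((subst (_≤ N) (sym next) (≤-trans (lastOcc≤ V i v) (<⇒≤ i<N)) ,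
               (λ e → lastOcc-occ V i v (trans (sym next) e)) ,
               cong (λ m → sumTo m f) (sym next) ,
               trans (cong (λ m → scalar σ₂ cntᵛ + scalar σ₂ accᵛ + sumTo m g) next) total′) ,
              +-monoˡ-≤ (duration tally) τ≤))
      where
      st₁ : St σ₁
      st₁ = static-same n k N V sz s st
      i<N : i < N
      i<N = subst (_≤ N) j≡ j≤N
      V≡v : V i ≡ v
      V≡v = occ j≡
      j′ = lastOcc V i v
      c-suc : sumTo (scalar σ₁ jᵛ) f ≡ suc (sumTo j′ f)
      c-suc = trans (cong (λ m → sumTo m f) j≡) (trans
        (cong₂ _+_ (sumTo-lastOcc V i v f λ _ → δ-≢) (trans (cong (λ x → δ x v) V≡v) (δ-refl v)))
        (+-comm _ 1))
      g-suc : sumTo (scalar σ₁ jᵛ) g ≡ sumTo j′ g + below A i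
      g-suc = trans (cong (λ m → sumTo m g) j≡) (cong₂ _+_
        (sumTo-lastOcc V i v g λ x V≢v → cong (_* below A x) (δ-≢ V≢v))
        (trans (cong (λ x → δ x v * below A i) V≡v) (trans (cong (_* below A i) (δ-refl v)) (*-identityˡ _))))
      sum′ : scalar σ₁ cntᵛ + below A i + sumTo j′ g ≡ sumTo (suc p) g
      sum′ = trans (r (scalar σ₁ cntᵛ) _ _) (trans (cong (scalar σ₁ cntᵛ +_) (sym g-suc)) total)
        where
        r : ∀ x y z → x + y + z ≡ x + (z + y)
        r = solve-∀

  -- The state of the killing loop, with `j` its loop variable: `cleared` speaks of the occurrences
  -- already passed, hence of all of them at `j = 0`. `dead` keeps the reason for each kill, from
  -- which the hitting property follows.
  record Killed (v j : ℕ) (A₀ A : ℕ → ℕ) : Set where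
    field
      tree    : SegTree N A
      A1≤N    : A 1 ≤ N
      shrinks : A ⊑ A₀
      dead    : ∀ {q} → q < N → A (N + q) ≡ A₀ (N + q) ⊎ ∃[ i ] (i < N × V i ≡ v × 1 ≤ cov sz i q)
      cleared : ∀ {i} → i < N → V i ≡ v → j ≤ i → below A i ≡ 0

  -- The budget is one `killTime b` for each live target and one `advanceTime b` for each occurrence
  -- still ahead. An iteration either kills a target or leaves an occurrence, so it uses up one of
  -- these units. The unspent part appears on the left, for later kills.
  kill-spec : ∀ {σ A p v} → array σ Aᵃ ≡ A → scalar σ jᵛ ≡ suc p → p < N → V p ≡ v →
    St σ → SegTree N A → A 1 ≤ N →
    (∀ {i} → i < N → V i ≡ v → suc p ≤ i → below A i ≡ 0) →
    Wp kill (λ σ′ τ → Killed v 0 A (array σ′ Aᵃ) ×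
       τ + array σ′ Aᵃ 1 * killTime b ≤
         A 1 * killTime b + sumTo (suc p) (λ i → δ (V i) v) * advanceTime b + 2) σ
  kill-spec {σ} {A₀} {p} {v} refl j≡ p<N Vp≡v st tree₀ A1≤N₀ beyond =
    conseq (while-rule I (λ _ → _) step
      ( subst (_≤ N) (sym j≡) p<N
      , (λ e → trans (cong V (suc-injective (trans (sym e) j≡))) Vp≡v)
      , record { tree = tree₀ ; A1≤N = A1≤N₀ ; shrinks = λ _ _ → ≤-refl ; dead = λ _ → inj₁ refl
               ; cleared = λ i<N e j≤i → beyond i<N e (subst (_≤ _) j≡ j≤i) }
      , cong (λ m → A₀ 1 * killTime b + sumTo m f * advanceTime b) (sym j≡)))
      λ { {σ′} {τ} _ (m′ , (_ , _ , killed , m≡) , j≡0 , τ≤) →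
        subst (λ j → Killed v j A₀ (array σ′ Aᵃ)) j≡0 killed ,
        ≤-trans (+-monoʳ-≤ τ (≤-trans (m≤m+n _ _) (≤-reflexive (sym m≡)))) τ≤ }
    where
    open Tables
    f : ℕ → ℕ
    f i = δ (V i) v
    I : ℕ → Store → Set
    I m σ = j ≤ N × (∀ {x} → j ≡ suc x → V x ≡ v) × Killed v j A₀ A ×
            m ≡ A 1 * killTime b + sumTo j f * advanceTime b
      where
      j = scalar σ jᵛ
      A = array σ Aᵃ
    step : ∀ {m σ₁ i} → Same killBody σ σ₁ → I m σ₁ → scalar σ₁ jᵛ ≡ suc i →
           Wp killBody (λ σ′ τ → ∃[ m′ ] (I m′ σ′ × suc (1 + τ + m′) ≤ m)) σ₁
    step {m} {σ₁} {i} s (j≤N , occ , killed , m≡) j₁≡ =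
      probe-spec refl j₁≡ i<N st₁ tree A1≤N then λ {σ₂} {τ₂} s₂ (acc≡ , l≡ , r≡ , τ₂≤) →
        let A₂≡A : array σ₂ Aᵃ ≡ A
            A₂≡A = array≡ s₂ Aᵃ _
            next : array σ₂ nxtᵃ (scalar σ₂ jᵛ ∸ 1) ≡ j′
            next = trans (cong₂ (λ a x → a (x ∸ 1)) (array≡ s₂ nxtᵃ _) (trans (scalar≡ s₂ jᵛ _) j₁≡))
                         (trans (next≡ st₁ i<N) (cong (lastOcc V i) V≡v))
        in if-rule _
          (λ {w} acc≢0 →
            find-spec {b = b} A₂≡A l≡ r≡ tree (≤-trans (s≤s z≤n) i<N) (m≤m+n N i) r≤
              (≤-<-trans r≤ 2N<2^b) N<W (N≤W A1≤N) (nonempty (trans (sym acc≡) acc≢0))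
            then λ {σ₃} s₃ (l≤l′ , l′<r , alive , τ₃≤) →
              let q    = scalar σ₃ lᵛ ∸ N
                  N≤l′ = ≤-trans (m≤m+n N i) l≤l′
                  l′≡  = sym (m+[n∸m]≡n N≤l′)
                  i≤q  = +-cancelˡ-≤ N i q (subst (N + i ≤_) l′≡ l≤l′)
                  q<   = +-cancelˡ-< N q (i + sz i) (subst₂ _<_ l′≡ (+-assoc N i (sz i)) l′<r)
                  q<N  = <-≤-trans q< (end≤ i<N)
                  l′<2N = subst (_< N + N) (sym l′≡) (+-monoʳ-< N q<N)
                  alive′ = subst (λ x → 1 ≤ A x) l′≡ alive
              in conseq (update-spec {b = b} (trans (array≡ s₃ Aᵃ _) A₂≡A) l′≡ tree
                          (≤-trans (s≤s z≤n) i<N) (m≤m+n N q) (+-monoʳ-< N q<N)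
                          (<-trans (+-monoʳ-< N q<N) 2N<2^b) alive′)
                λ {σ₄} s₄ (tree′ , leaf , τ₄≤) →
                  let j₄≡j = trans (scalar≡ s₄ jᵛ _) (trans (scalar≡ s₃ jᵛ _) (scalar≡ s₂ jᵛ _))
                  in kill-step {σ₄} {q} i≤q q< q<N alive′ j₄≡j tree′ leaf
                       (+-mono-≤ τ₂≤ (s≤s (s≤s (+-mono-≤ τ₃≤ τ₄≤)))))
          (λ acc≡0 → block _ (advance-step {σ₂} {τ₂ + suc (1 + duration advance)} next
             (trans (sym acc≡) acc≡0) A₂≡A (+-monoˡ-≤ _ τ₂≤)))
      where
      open Killed killed
      A = array σ₁ Aᵃ
      st₁ : St σ₁
      st₁ = static-same n k N V sz s st
      i<N : i < N
      i<N = subst (_≤ N) j₁≡ j≤N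
      V≡v : V i ≡ v
      V≡v = occ j₁≡
      j′ = lastOcc V i v
      r≤ : N + i + sz i ≤ N + N
      r≤ = ≤-trans (≤-reflexive (+-assoc N i (sz i))) (+-monoʳ-≤ N (end≤ i<N))
      nonempty : ∀ {w} → below A i ≡ suc w → sumTo (N + i) A < sumTo (N + i + sz i) A
      nonempty e = subst (sumTo (N + i) A <_) (sym (segment-sum A i<N))
        (m<m+n _ (subst (1 ≤_) (sym e) (s≤s z≤n)))
      f-suc : sumTo (scalar σ₁ jᵛ) f ≡ suc (sumTo j′ f)
      f-suc = trans (cong (λ m → sumTo m f) j₁≡) (trans
        (cong₂ _+_ (sumTo-lastOcc V i v f λ _ → δ-≢) (trans (cong (λ x → δ x v) V≡v) (δ-refl v)))
        (+-comm _ 1))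
      kill-step : ∀ {σ′ q τ} → i ≤ q → q < i + sz i → q < N → 1 ≤ A (N + q) →
        scalar σ′ jᵛ ≡ scalar σ₁ jᵛ → SegTree N (array σ′ Aᵃ) →
        (∀ x → N ≤ x → array σ′ Aᵃ x ≡ (A [ N + q ↦ A (N + q) ∸ 1 ]) x) →
        τ ≤ probeTime b + suc (1 + (findTime b + updateTime b)) →
        ∃[ m′ ] (I m′ σ′ × suc (1 + τ + m′) ≤ m)
      kill-step {σ′} {q} {τ} i≤q q< q<N alive j≡j₁ tree′ leaf τ≤ =
        A′ 1 * killTime b + C , ( subst (_≤ N) (sym j≡j₁) j≤N , (λ e → occ (trans (sym j≡j₁) e))
            , record { tree = tree′ ; A1≤N = ≤-trans (n≤1+n _) (≤-trans (≤-reflexive (sym (proj₁ (proj₂ facts)))) A1≤N)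
                     ; shrinks = λ q q< → ≤-trans (proj₁ facts q q<) (shrinks q q<)
                     ; dead = dead′ ; cleared = λ {x} i<N e j≤i →
                         n≤0⇒n≡0 (≤-trans (below-mono {A′} {A} (proj₁ facts) x)
                           (≤-reflexive (cleared i<N e (subst (_≤ _) j≡j₁ j≤i)))) }
            , cong (λ x → A′ 1 * killTime b + sumTo x f * advanceTime b) (sym j≡j₁) ) , time
        where
        A′ = array σ′ Aᵃ
        facts = kill-leaf tree tree′ q<N alive leaf
        dead′ : ∀ {q′} → q′ < N → A′ (N + q′) ≡ A₀ (N + q′) ⊎ ∃[ i ] (i < N × V i ≡ v × 1 ≤ cov sz i q′)
        dead′ {q′} q′<N with q ≟ q′
        ... | yes refl = inj₂ (i , i<N , V≡v , ≤-reflexive (sym (cov⇐ sz i≤q q<)))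
        ... | no q≢q′ with dead q′<N
        ...   | inj₁ e = inj₁ (trans (proj₂ (proj₂ facts) q≢q′) e)
        ...   | inj₂ h = inj₂ h
        C = sumTo (scalar σ₁ jᵛ) f * advanceTime b
        open ≤-Reasoning
        time : suc (1 + τ + (A′ 1 * killTime b + C)) ≤ m
        time = begin
          suc (1 + τ + (A′ 1 * killTime b + C))  ≤⟨ s≤s (s≤s (+-monoˡ-≤ (A′ 1 * killTime b + C) τ≤)) ⟩
          killTime b + (A′ 1 * killTime b + C)   ≡⟨ +-assoc (killTime b) (A′ 1 * killTime b) C ⟨
          suc (A′ 1) * killTime b + C            ≡⟨ cong (λ x → x * killTime b + C) (proj₁ (proj₂ facts)) ⟨
          A 1 * killTime b + C                   ≡⟨ m≡ ⟨
          m                                      ∎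
      advance-step : ∀ {σ₂ τ} → array σ₂ nxtᵃ (scalar σ₂ jᵛ ∸ 1) ≡ j′ → below A i ≡ 0 → array σ₂ Aᵃ ≡ A →
        τ ≤ probeTime b + suc (1 + duration advance) →
        ∃[ m′ ] (I m′ (exe advance σ₂) × suc (1 + τ + m′) ≤ m)
      advance-step {σ₂} {τ} next empty A₂≡A τ≤ =
        R + sumTo j′ f * advanceTime b , ( subst (_≤ N) (sym next) (≤-trans (lastOcc≤ V i v) (<⇒≤ i<N))
            , (λ e → lastOcc-occ V i v (trans (sym next) e))
            , subst₂ (λ j B → Killed v j A₀ B) (sym next) (sym A₂≡A)
                record { tree = tree ; A1≤N = A1≤N ; shrinks = shrinks ; dead = dead ; cleared = cleared′ }
            , cong₂ (λ B x → B 1 * killTime b + sumTo x f * advanceTime b) (sym A₂≡A) (sym next) ) , time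
        where
        cleared′ : ∀ {x} → x < N → V x ≡ v → j′ ≤ x → below A x ≡ 0
        cleared′ {x} x<N e j′≤x with x ≟ i
        ... | yes refl = empty
        ... | no x≢i with x <? i
        -- No occurrence lies strictly between the preceding one and `i`.
        ...   | yes x<i = contradiction (≤-trans (subst (λ u → suc x ≤ lastOcc V i u) e (occ≤lastOcc V i x<i)) j′≤x) 1+n≰n
        ...   | no x≮i = cleared x<N e (subst (_≤ x) (sym j₁≡) (≤∧≢⇒< (≮⇒≥ x≮i) (x≢i ∘ sym)))
        R = A 1 * killTime b
        open ≤-Reasoning
        r : ∀ x y z → x + (y + z) ≡ y + (x + z)
        r = solve-∀
        time : suc (1 + τ + (R + sumTo j′ f * advanceTime b)) ≤ m
        time = begin
          suc (1 + τ + (R + sumTo j′ f * advanceTime b))  ≤⟨ s≤s (s≤s (+-monoˡ-≤ _ τ≤)) ⟩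
          advanceTime b + (R + sumTo j′ f * advanceTime b)  ≡⟨ r (advanceTime b) R _ ⟩
          R + suc (sumTo j′ f) * advanceTime b  ≡⟨ cong (λ x → R + x * advanceTime b) f-suc ⟨
          R + sumTo (scalar σ₁ jᵛ) f * advanceTime b ≡⟨ m≡ ⟨
          m ∎

-- Each occurrence may be walked over twice, for counting and for killing. The literals 47 and 14
-- cover the fixed cost of a visit and of a phase, loop tests included.
chainTime : ℕ → ℕ
phaseTime : ℕ → ℕ → ℕ
chainTime b = countTime b + advanceTime b
phaseTime N b = 14 + N * (47 + chainTime b)

-- Invariants of the greedy phases

module Greedy (W : ℕ) (4≤W : 4 ≤ W) {n k N : ℕ} {V sz tgt : ℕ → ℕ}
  (inst : Instance n k N V sz tgt) (b : ℕ) (N<W : N + N + 1 < W) (2N<2^b : N + N < 2 ^ b)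
  (product<W : N * (n + n) < W) (1≤k : 1 ≤ k) (k≤n : k ≤ n) where

  open Logic W 4≤W
  open Instance inst
  open Counting inst
  open Occurrences W 4≤W inst b N<W 2N<2^b

  -- `room` holds because every chosen vertex has killed a target of its own; it keeps the output
  -- length within a word. `spent` is what prevents a vertex from being chosen twice.
  record Live (A : ℕ → ℕ) (len : ℕ) (out : ℕ → ℕ) : Set where
    field
      tree     : SegTree N A
      room     : len + A 1 ≤ N
      leaf≤    : ∀ {q} → q < N → A (N + q) ≤ tgt q
      hit      : ∀ {q} → q < N → A (N + q) ≡ tgt q ⊎
                 ∃[ x ] ∃[ i ] (x < len × i < N × 1 ≤ cov sz i q × out x ≡ V i)
      out<     : ∀ {x} → x < len → out x < n
      out-injective : ∀ {x y} → x < len → y < len → out x ≡ out y → x ≡ y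
      spent    : ∀ {x} → x < len → degree A (out x) ≡ 0

    A1≤N : A 1 ≤ N
    A1≤N = ≤-trans (m≤n+m _ len) room

  -- The new vertex has positive degree while the chosen ones have degree 0, so it is fresh.
  pick-live : ∀ {A B len out p} → Live A len out → p < N → 1 ≤ degree A (V p) →
    Killed (V p) 0 A B →
    Live B (suc len) (out [ len ↦ V p ]) × degree B (V p) ≡ 0 × B 1 + degree A (V p) ≤ A 1
  pick-live {A} {B} {len} {out} {p} live p<N 1≤deg killed = record
    { tree = K.tree
    ; room = ≤-trans (≤-reflexive (r (B 1) len))
        (≤-trans (+-monoʳ-≤ len (≤-trans (+-monoʳ-≤ (B 1) 1≤deg) drop)) (Live.room live))
    ; leaf≤ = λ q<N → ≤-trans (K.shrinks _ q<N) (Live.leaf≤ live q<N)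
    ; hit = hit
    ; out< = out<
    ; out-injective = out-injective
    ; spent = spent
    } , zero-degree , drop
    where
    module K = Killed killed
    v = V p
    1≤N : 1 ≤ N
    1≤N = ≤-trans (s≤s z≤n) p<N
    r : ∀ x l → suc (l + x) ≡ l + (x + 1)
    r = solve-∀
    drop : B 1 + degree A v ≤ A 1
    drop = subst₂ (λ x y → x + degree A v ≤ y) (sym (root≡leaves K.tree 1≤N))
      (sym (root≡leaves (Live.tree live) 1≤N)) (degree-drop {A} {B} K.shrinks λ i<N e → K.cleared i<N e z≤n)
    zero-degree : degree B v ≡ 0
    zero-degree = degree-zero {B} λ i<N e → K.cleared i<N e z≤n
    new : (out [ len ↦ v ]) len ≡ v
    new = update-≡ out len v
    old : ∀ {x} → x < len → (out [ len ↦ v ]) x ≡ out x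
    old x< = update-≢ out v (<⇒≢ x< ∘ sym)
    hit : ∀ {q} → q < N → B (N + q) ≡ tgt q ⊎
          ∃[ x ] ∃[ i ] (x < suc len × i < N × 1 ≤ cov sz i q × (out [ len ↦ v ]) x ≡ V i)
    hit q<N with K.dead q<N
    ... | inj₂ (i , i<N , e , c) = inj₂ (len , i , ≤-refl , i<N , c , trans new (sym e))
    ... | inj₁ e with Live.hit live q<N
    ...   | inj₁ e′ = inj₁ (trans e e′)
    ...   | inj₂ (x , i , x< , i< , c , e′) = inj₂ (x , i , m<n⇒m<1+n x< , i< , c , trans (old x<) e′)
    out< : ∀ {x} → x < suc len → (out [ len ↦ v ]) x < n
    out< x<1+len with m<1+n⇒m<n∨m≡n x<1+len
    ... | inj₁ x<  = subst (_< n) (sym (old x<)) (Live.out< live x<)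
    ... | inj₂ refl = subst (_< n) (sym new) (vertex< p<N)
    fresh : ∀ {x} → x < len → out x ≢ v
    fresh x< e = contradiction (subst (1 ≤_) (trans (cong (degree A) (sym e)) (Live.spent live x<)) 1≤deg) λ ()
    out-injective : ∀ {x y} → x < suc len → y < suc len →
               (out [ len ↦ v ]) x ≡ (out [ len ↦ v ]) y → x ≡ y
    out-injective x<1+len y<1+len e with m<1+n⇒m<n∨m≡n x<1+len | m<1+n⇒m<n∨m≡n y<1+len
    ... | inj₁ x<  | inj₁ y<  = Live.out-injective live x< y< (trans (sym (old x<)) (trans e (old y<)))
    ... | inj₁ x<  | inj₂ refl = contradiction (trans (sym (old x<)) (trans e new)) (fresh x<)
    ... | inj₂ refl | inj₁ y<  = contradiction (trans (sym (old y<)) (trans (sym e) new)) (fresh y<)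
    ... | inj₂ refl | inj₂ refl = refl
    spent : ∀ {x} → x < suc len → degree B ((out [ len ↦ v ]) x) ≡ 0
    spent x<1+len with m<1+n⇒m<n∨m≡n x<1+len
    ... | inj₁ x<  = n≤0⇒n≡0 (subst (λ u → degree B u ≤ 0) (sym (old x<))
                       (≤-trans (degree-mono {B} {A} K.shrinks _) (≤-reflexive (Live.spent live x<))))
    ... | inj₂ refl = subst (λ u → degree B u ≡ 0) (sym new) zero-degree

  -- `picks` is a potential inequality: a pick adds `thr` on the left but lowers the root by at
  -- least thr / 2n. `small` covers the vertices whose last occurrence lies before position `p`.
  record Scan (thr p len₀ R₀ : ℕ) (A : ℕ → ℕ) (len : ℕ) (out : ℕ → ℕ) : Set where
    field
      live  : Live A len out
      small : ∀ {i} → i < N → lastOcc V N (V i) ≤ p → degree A (V i) * (n + n) ≤ thr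
      picks : len * thr + A 1 * (n + n) ≤ len₀ * thr + R₀ * (n + n)

  skip-scan : ∀ {thr p len₀ R₀ A len out} → Scan thr p len₀ R₀ A len out →
    (∀ {i} → i < N → lastOcc V N (V i) ≡ suc p → degree A (V i) * (n + n) ≤ thr) →
    Scan thr (suc p) len₀ R₀ A len out
  skip-scan {thr} {p} {A = A} scan here′ = record
    { live = live ; picks = picks ; small = small′ }
    where
    open Scan scan
    small′ : ∀ {i} → i < N → lastOcc V N (V i) ≤ suc p → degree A (V i) * (n + n) ≤ thr
    small′ i<N h with m≤n⇒m<n∨m≡n h
    ... | inj₁ h< = small i<N (≤-pred h<)
    ... | inj₂ e  = here′ i<N e

  -- Vertices rejected earlier stay small since degrees only fall, and the picked vertex now has
  -- degree 0.
  pick-scan : ∀ {thr p len₀ R₀ A B len out} → Scan thr p len₀ R₀ A len out → p < N →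
    lastOcc V N (V p) ≡ suc p → 1 ≤ thr → thr ≤ degree A (V p) * (n + n) →
    Killed (V p) 0 A B →
    Scan thr (suc p) len₀ R₀ B (suc len) (out [ len ↦ V p ])
  pick-scan {thr} {p} {len₀} {R₀} {A} {B} {len} {out} scan p<N last≡ 1≤thr thr≤ killed = record
    { live = proj₁ picked
    ; small = small′
    ; picks = begin
        suc len * thr + B 1 * (n + n)              ≤⟨ +-monoˡ-≤ _ (+-monoˡ-≤ (len * thr) thr≤) ⟩
        d * (n + n) + len * thr + B 1 * (n + n)    ≡⟨ r d (n + n) (len * thr) (B 1) ⟩
        len * thr + (B 1 + d) * (n + n)            ≤⟨ +-monoʳ-≤ (len * thr) (*-monoˡ-≤ (n + n) drop) ⟩
        len * thr + A 1 * (n + n)                  ≤⟨ picks ⟩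
        len₀ * thr + R₀ * (n + n)                  ∎
    }
    where
    open Scan scan
    open ≤-Reasoning
    d = degree A (V p)
    1≤d : 1 ≤ d
    1≤d = proj₁ (factors≥1 {d} (≤-trans 1≤thr thr≤))
    picked = pick-live live p<N 1≤d killed
    drop = proj₂ (proj₂ picked)
    r : ∀ d m l x → d * m + l + x * m ≡ l + (x + d) * m
    r = solve-∀
    small′ : ∀ {i} → i < N → lastOcc V N (V i) ≤ suc p → degree B (V i) * (n + n) ≤ thr
    small′ {i} i<N h with m≤n⇒m<n∨m≡n h
    ... | inj₁ h< = ≤-trans (*-monoˡ-≤ (n + n) (degree-mono {B} {A} (Killed.shrinks killed) (V i))) (small i<N (≤-pred h<))
    ... | inj₂ e  = subst (λ u → degree B u * (n + n) ≤ thr) (lastOcc-occ V N (V i) e)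
                      (≤-trans (≤-reflexive (cong (_* (n + n)) (proj₁ (proj₂ picked)))) z≤n)

  process-spec : ∀ {σ A len out p thr len₀ R₀} →
    array σ Aᵃ ≡ A → scalar σ lenᵛ ≡ len → array σ Vᵃ ≡ out →
    scalar σ iᵛ ≡ p → scalar σ vᵛ ≡ V p → scalar σ thrᵛ ≡ thr →
    p < N → lastOcc V N (V p) ≡ suc p → 1 ≤ thr → St σ → Scan thr p len₀ R₀ A len out →
    Wp process (λ σ′ τ →
      Scan thr (suc p) len₀ R₀ (array σ′ Aᵃ) (scalar σ′ lenᵛ) (array σ′ Vᵃ) ×
      τ + array σ′ Aᵃ 1 * killTime b ≤ A 1 * killTime b + (29 + chain V N p * chainTime b)) σ
  process-spec {σ} {A} {len} {out} {p} {thr} {len₀} {R₀} refl refl refl refl v≡ refl p<N last≡ 1≤thr st scan =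
    count-spec refl refl p<N st tree A1≤N then λ {σ₁} {τ₁} s₁ (cnt≡ , τ₁≤) →
      let st₁ = static-same n k N V sz s₁ st
          cnt≡degree = trans cnt≡ total≡
          n₁≡ = Tables.n≡ st₁
          product≡ : scalar σ₁ cntᵛ * (scalar σ₁ nᵛ + scalar σ₁ nᵛ) ≡ degree A (V p) * (n + n)
          product≡ = cong₂ (λ x y → x * (y + y)) cnt≡degree n₁≡
          thr₁≡ = scalar≡ s₁ thrᵛ _
          len₁≡ = scalar≡ s₁ lenᵛ _
          A₁≡   = array≡ s₁ Aᵃ _
          out₁≡ = array≡ s₁ Vᵃ _
      in if-rule
        (( _ , (_ , _ , subst (λ x → x + x < W) (sym n₁≡) 2n<W) ,
           subst (_< W) (sym product≡) (≤-<-trans (*-monoˡ-≤ (n + n) deg≤N) product<W)) , _)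
        (λ few → block _
          ( subst₂ (λ B l → Scan thr (suc p) len₀ R₀ B l (array σ₁ Vᵃ)) (sym A₁≡) (sym len₁≡)
              (subst (Scan thr (suc p) len₀ R₀ A len) (sym out₁≡)
                (skip-scan scan λ i<N e → subst (λ u → degree A u * (n + n) ≤ thr) (lastOcc-occ V N _ e)
                  (<⇒≤ (subst₂ _<_ product≡ thr₁≡ (lt≢0⇒< few)))))
          , time {R = A 1 * killTime b} τ₁≤ (subst (λ B → 1 + B 1 * killTime b ≤ A 1 * killTime b + (L * advanceTime b + 13))
              (sym A₁≡) (subst (_≤ A 1 * killTime b + (L * advanceTime b + 13)) (+-comm _ 1)
                (+-monoʳ-≤ (A 1 * killTime b) (≤-trans (s≤s z≤n) (m≤n+m 13 (L * advanceTime b))))))))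
        (λ many →
          let thr≤ = subst₂ _≤_ thr₁≡ product≡ (lt≡0⇒≥ many)
          in block-then
          (_ , (_ , _ , N≤W (subst (_≤ N) (trans (+-comm 1 len) (cong (_+ 1) (sym len₁≡))) (len<N thr≤))) ,
               (_ , _ , N≤W (subst (_≤ N) (trans (+-comm 1 p) (cong (_+ 1) (sym (scalar≡ s₁ iᵛ _)))) p<N)))
          (conseq (kill-spec {v = V p} A₁≡ (trans (cong (_+ 1) (scalar≡ s₁ iᵛ _)) (+-comm p 1)) p<N refl st₁ tree A1≤N
                     λ i<N e p<i → contradiction (≤-trans (s≤s p<i) (≤-trans (occ≤lastOcc V N i<N)
                       (≤-reflexive (trans (cong (lastOcc V N) e) last≡)))) 1+n≰n)
            λ {σ′} {τ} s₂ (killed , τ≤) →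
              let len′≡ = trans (scalar≡ s₂ lenᵛ _) (trans (cong (_+ 1) len₁≡) (+-comm len 1))
                  v₁≡   = trans (scalar≡ s₁ vᵛ _) v≡
                  out′≡ = trans (array≡ s₂ Vᵃ _) (trans
                    (cong₂ (λ f l → f [ l ↦ scalar σ₁ vᵛ ]) out₁≡ len₁≡) (cong (out [ len ↦_]) v₁≡))
              in subst₂ (Scan thr (suc p) len₀ R₀ (array σ′ Aᵃ)) (sym len′≡) (sym out′≡)
                   (pick-scan scan p<N last≡ 1≤thr thr≤ killed) ,
                 time {τ₁} {11 + τ} τ₁≤ (≤-trans (+-monoʳ-≤ 11 τ≤)
                   (≤-reflexive (shuffle (A 1 * killTime b) (L * advanceTime b))))))
    where
    open Scan scan
    open Live live
    L = sumTo (suc p) (λ i → δ (V i) (V p))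
    chain≡ : chain V N p ≡ L
    chain≡ = trans (cong (_* L) (trans (cong (λ x → δ x (suc p)) last≡) (δ-refl p))) (*-identityˡ L)
    total≡ : sumTo (suc p) (λ i → δ (V i) (V p) * below A i) ≡ degree A (V p)
    total≡ = trans (cong (λ m → sumTo m g) (sym last≡))
      (sym (sumTo-lastOcc V N (V p) g λ i V≢ → cong (_* below A i) (δ-≢ V≢)))
      where
      g : ℕ → ℕ
      g i = δ (V i) (V p) * below A i
    1≤N : 1 ≤ N
    1≤N = ≤-trans (s≤s z≤n) p<N
    2n<W : n + n < W
    2n<W = ≤-<-trans (≤-trans (≤-reflexive (sym (*-identityˡ _))) (*-monoˡ-≤ (n + n) 1≤N)) product<W
    deg≤A1 : degree A (V p) ≤ A 1
    deg≤A1 = ≤-trans (degree≤leaves A (V p)) (≤-reflexive (sym (root≡leaves tree 1≤N)))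
    deg≤N = ≤-trans deg≤A1 A1≤N
    len<N : thr ≤ degree A (V p) * (n + n) → suc len ≤ N
    len<N thr≤ = ≤-trans (≤-reflexive (+-comm 1 len)) (≤-trans
      (+-monoʳ-≤ len (≤-trans (proj₁ (factors≥1 {degree A (V p)} (≤-trans 1≤thr thr≤))) deg≤A1)) room)
    shuffle : ∀ x y → 11 + (x + y + 2) ≡ x + (y + 13)
    shuffle = solve-∀
    -- Serves both branches: skipping is estimated by the bound for picking.
    time : ∀ {τ₁ τ R R′} → τ₁ ≤ 6 + (L * countTime b + 2) → τ + R′ ≤ R + (L * advanceTime b + 13) →
           τ₁ + suc (7 + τ) + R′ ≤ R + (29 + chain V N p * chainTime b)
    time {τ₁} {τ} {R} {R′} h₁ h₂ = begin
      τ₁ + suc (7 + τ) + R′      ≡⟨ r₁ τ₁ τ R′ ⟩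
      τ₁ + (τ + R′) + 8          ≤⟨ +-monoˡ-≤ 8 (+-mono-≤ h₁ h₂) ⟩
      6 + (L * countTime b + 2) + (R + (L * advanceTime b + 13)) + 8 ≡⟨ r₂ L (countTime b) (advanceTime b) R ⟩
      R + (29 + L * chainTime b) ≡⟨ cong (λ x → R + (29 + x * chainTime b)) chain≡ ⟨
      R + (29 + chain V N p * chainTime b) ∎
      where
      open ≤-Reasoning
      r₁ : ∀ a b c → a + suc (7 + b) + c ≡ a + (b + c) + 8
      r₁ = solve-∀
      r₂ : ∀ l c a r → 6 + (l * c + 2) + (r + (l * a + 13)) + 8 ≡ r + (29 + l * (c + a))
      r₂ = solve-∀

  visitTime : ℕ → ℕ
  visitTime p = 47 + chain V N p * chainTime b

  -- The summand 4 is the loop test in `phase`, so that the bound has the form that `while-rule`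
  -- asks for.
  visit-spec : ∀ {σ A len out p thr len₀ R₀} →
    array σ Aᵃ ≡ A → scalar σ lenᵛ ≡ len → array σ Vᵃ ≡ out → scalar σ iᵛ ≡ p → scalar σ thrᵛ ≡ thr →
    p < N → 1 ≤ thr → St σ → Scan thr p len₀ R₀ A len out →
    Wp visit (λ σ′ τ → scalar σ′ iᵛ ≡ suc p ×
      Scan thr (suc p) len₀ R₀ (array σ′ Aᵃ) (scalar σ′ lenᵛ) (array σ′ Vᵃ) ×
      4 + τ + array σ′ Aᵃ 1 * killTime b ≤ A 1 * killTime b + visitTime p) σ
  visit-spec {σ} {A} {len} {out} {p} {thr} {len₀} {R₀} refl refl refl refl refl p<N 1≤thr st scan =
    block-then _ (if-rule {Q = Mid} (_ , (_ , _ , i+1<W))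
      (λ hit → conseq (process-spec refl refl refl refl copy refl p<N (last≡ (δ≢0⇒≡ hit)) 1≤thr st scan)
        λ {σ′} {τ} s (scan′ , τ≤) → scalar≡ s iᵛ _ , scan′ , head-time {τ} {array σ′ Aᵃ 1 * killTime b} τ≤)
      (λ miss → block _ (refl , skip-scan scan (λ i<N e → contradiction e (other (δ≡0⇒≢ miss) i<N)) , miss-time))
    then λ {σ₁} {τ₁} s (i≡ , scan′ , τ≤) →
      block (_ , _ , subst (λ x → x + 1 < W) (sym i≡) i+1<W)
        (trans (cong (_+ 1) i≡) (+-comm p 1) , scan′ ,
         ≤-trans (≤-reflexive (cong (_+ array σ₁ Aᵃ 1 * killTime b) (r τ₁)))
           (≤-trans (+-monoʳ-≤ 11 τ≤) (≤-reflexive (r′ (A 1 * killTime b) (chain V N p * chainTime b))))))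
    where
    copy = Tables.copy≡ st p<N
    i+1<W : p + 1 < W
    i+1<W = N≤W (subst (_≤ N) (+-comm 1 p) p<N)
    Mid : Store → ℕ → Set
    Mid σ′ τ = scalar σ′ iᵛ ≡ p ×
      Scan thr (suc p) len₀ R₀ (array σ′ Aᵃ) (scalar σ′ lenᵛ) (array σ′ Vᵃ) ×
      τ + array σ′ Aᵃ 1 * killTime b ≤ A 1 * killTime b + (36 + chain V N p * chainTime b)
    headOf = array σ headᵃ (array σ Cᵃ p)
    headOf≡ : headOf ≡ lastOcc V N (V p)
    headOf≡ = trans (Tables.head≡ st _) (cong (lastOcc V N) copy)
    last≡ : headOf ≡ p + 1 → lastOcc V N (V p) ≡ suc p
    last≡ e = trans (sym headOf≡) (trans e (+-comm p 1))
    -- A label with last occurrence `p` is `V p` itself, so after a miss `small` extends to `suc p`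
    -- vacuously.
    other : headOf ≢ p + 1 → ∀ {i} → i < N → lastOcc V N (V i) ≢ suc p
    other ne {i} i<N e = ne (trans headOf≡ (trans (trans (cong (lastOcc V N) (lastOcc-occ V N (V i) e)) e) (+-comm 1 p)))
    head-time : ∀ {τ R} → τ + R ≤ A 1 * killTime b + (29 + chain V N p * chainTime b) →
                suc (6 + τ) + R ≤ A 1 * killTime b + (36 + chain V N p * chainTime b)
    head-time h = ≤-trans (+-monoʳ-≤ 7 h) (≤-reflexive (r (A 1 * killTime b) (chain V N p * chainTime b)))
      where
      r : ∀ x y → 7 + (x + (29 + y)) ≡ x + (36 + y)
      r = solve-∀
    miss-time : suc (6 + 1) + A 1 * killTime b ≤ A 1 * killTime b + (36 + chain V N p * chainTime b)
    miss-time = ≤-trans (≤-reflexive (+-comm 8 _)) (+-monoʳ-≤ (A 1 * killTime b)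
      (≤-trans (m≤m+n 8 28) (m≤m+n 36 _)))
    r : ∀ t → 4 + (3 + (t + 4)) ≡ 11 + t
    r = solve-∀
    r′ : ∀ x y → 11 + (x + (36 + y)) ≡ x + (47 + y)
    r′ = solve-∀

  -- After the scan `small` covers every listed vertex, and `halves` applies with R the initial
  -- root. The threshold is this root times k, so `picks` can be divided by the root, which leaves
  -- the bound on the number of picks.
  phase-spec : ∀ {σ A len out} →
    array σ Aᵃ ≡ A → scalar σ lenᵛ ≡ len → array σ Vᵃ ≡ out → 1 ≤ A 1 → St σ → Live A len out →
    Wp phase (λ σ′ τ → let A′ = array σ′ Aᵃ; len′ = scalar σ′ lenᵛ in
      Live A′ len′ (array σ′ Vᵃ) × A′ 1 + A′ 1 ≤ A 1 × len′ * k ≤ len * k + (n + n) ×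
      τ + A′ 1 * killTime b ≤ A 1 * killTime b + (11 + N * (47 + chainTime b))) σ
  phase-spec {σ} {A} {len} {out} refl refl refl 1≤A1 st live =
    block-then ((_ , _ , thr<W) , _) (conseq
      (while-rule I (λ _ → _) step (0 , N , refl , refl , scan₀ , refl))
      λ { {σ′} {τ} s (m′ , (p , r , i≡ , p+r≡N , scan , m≡) , exit , τ≤) →
        let live′ = Scan.live scan
            N≤p = subst (N ≤_) i≡ (subst (_≤ scalar σ′ iᵛ) (trans (scalar≡ s Nᵛ _) N≡) (lt≡0⇒≥ exit))
            A′ = array σ′ Aᵃ
            leaves≡ = root≡leaves (Live.tree live′) 1≤N
        in live′ ,
           subst (λ x → x + x ≤ A 1) (sym leaves≡) (halves {A′} 1≤n 1≤k (λ q q<N → Live.leaf≤ live′ q<N)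
             (λ {i} i<N → subst (degree A′ (V i) * (n + n) ≤_) thr≡ (Scan.small scan i<N (≤-trans (lastOcc≤ V N _) N≤p)))) ,
           len-bound (scalar σ′ lenᵛ) (≤-trans (m≤m+n _ (A′ 1 * (n + n))) (Scan.picks scan)) ,
           (begin
             7 + τ + A′ 1 * killTime b
               ≤⟨ +-monoʳ-≤ (7 + τ) (≤-trans (m≤m+n _ (sumFrom visitTime p r)) (≤-reflexive (sym m≡))) ⟩
             7 + τ + m′                                   ≤⟨ +-monoʳ-≤ 7 τ≤ ⟩
             7 + (A 1 * killTime b + sumFrom visitTime 0 N + 4)
               ≡⟨ shuffle (A 1 * killTime b) (sumFrom visitTime 0 N) ⟩
             A 1 * killTime b + (11 + sumFrom visitTime 0 N)
               ≤⟨ +-monoʳ-≤ (A 1 * killTime b) (+-monoʳ-≤ 11 visits) ⟩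
             A 1 * killTime b + (11 + N * (47 + chainTime b)) ∎) })
    where
    open Tables st
    open ≤-Reasoning
    1≤N : 1 ≤ N
    1≤N = ≤-trans 1≤A1 (Live.A1≤N live)
    1≤n : 1 ≤ n
    1≤n = ≤-trans 1≤k k≤n
    thr = A 1 * scalar σ kᵛ
    thr≡ : thr ≡ A 1 * k
    thr≡ = cong (A 1 *_) k≡
    thr<W : thr < W
    thr<W = ≤-<-trans (≤-trans (≤-reflexive thr≡) (*-mono-≤ (Live.A1≤N live) (≤-trans k≤n (m≤m+n n n)))) product<W
    1≤thr : 1 ≤ thr
    1≤thr = subst (1 ≤_) (sym thr≡) (*-mono-≤ 1≤A1 1≤k)
    shuffle : ∀ x y → 7 + (x + y + 4) ≡ x + (11 + y)
    shuffle = solve-∀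
    scan₀ : Scan thr 0 len (A 1) A len out
    scan₀ = record
      { live = live ; picks = ≤-refl
      ; small = λ {i} i<N h → contradiction (≤-trans (occ≤lastOcc V N i<N) h) λ () }
    len-bound : ∀ l → l * thr ≤ len * thr + A 1 * (n + n) → l * k ≤ len * k + (n + n)
    len-bound l h = *-cancelˡ-≤ (A 1) {{>-nonZero 1≤A1}} (begin
      A 1 * (l * k)                       ≡⟨ r (A 1) l k ⟩
      l * (A 1 * k)                       ≡⟨ cong (l *_) thr≡ ⟨
      l * thr                             ≤⟨ h ⟩
      len * thr + A 1 * (n + n)           ≡⟨ cong (λ x → len * x + A 1 * (n + n)) thr≡ ⟩
      len * (A 1 * k) + A 1 * (n + n)     ≡⟨ cong (_+ A 1 * (n + n)) (r (A 1) len k) ⟨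
      A 1 * (len * k) + A 1 * (n + n)     ≡⟨ *-distribˡ-+ (A 1) (len * k) (n + n) ⟨
      A 1 * (len * k + (n + n))           ∎)
      where
      r : ∀ a l k → a * (l * k) ≡ l * (a * k)
      r = solve-∀
    visits : sumFrom visitTime 0 N ≤ N * (47 + chainTime b)
    visits = begin
      sumFrom visitTime 0 N                           ≡⟨ sumTo-sumFrom visitTime 0 N ⟩
      sumTo N visitTime                               ≡⟨ sumTo-+ N (λ _ → 47) _ ⟩
      sumTo N (λ _ → 47) + sumTo N (λ p → chain V N p * chainTime b)
        ≡⟨ cong₂ _+_ (sumTo-const N 47) (trans (sumTo-cong N λ p _ → *-comm (chain V N p) (chainTime b))
                                                (sumTo-* N (chainTime b) (chain V N))) ⟩
      N * 47 + chainTime b * sumTo N (chain V N)      ≤⟨ +-monoʳ-≤ (N * 47) (*-monoʳ-≤ (chainTime b) (sum-chain≤ V N)) ⟩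
      N * 47 + chainTime b * N                        ≡⟨ r N (chainTime b) ⟩
      N * (47 + chainTime b)                          ∎
      where
      r : ∀ n c → n * 47 + c * n ≡ n * (47 + c)
      r = solve-∀
    I : ℕ → Store → Set
    I m σ = ∃[ p ] ∃[ r ] (scalar σ iᵛ ≡ p × p + r ≡ N ×
      Scan thr p len (A 1) (array σ Aᵃ) (scalar σ lenᵛ) (array σ Vᵃ) ×
      m ≡ array σ Aᵃ 1 * killTime b + sumFrom visitTime p r)
    σ₀ = setScalar (setScalar σ thrᵛ thr) iᵛ 0
    step : ∀ {m σ₁ v} → Same visit σ₀ σ₁ → I m σ₁ → bit (scalar σ₁ iᵛ <ᵇ scalar σ₁ Nᵛ) ≡ suc v →
           Wp visit (λ σ′ τ → ∃[ m′ ] (I m′ σ′ × suc (3 + τ + m′) ≤ m)) σ₁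
    step {m} {σ₁} s (p , zero , i≡ , p+r≡N , scan , m≡) z =
      contradiction (subst₂ _<_ i≡ (trans (trans (scalar≡ s Nᵛ _) N≡) (trans (sym p+r≡N) (+-identityʳ p))) (lt≢0⇒< z)) 1+n≰n
    step {m} {σ₁} s (p , suc r , i≡ , p+r≡N , scan , m≡) z =
      conseq (visit-spec refl refl refl i≡ (scalar≡ s thrᵛ _) p<N 1≤thr (static-same n k N V sz s st) scan)
        λ {σ′} {τ} _ (i′≡ , scan′ , τ≤) →
          array σ′ Aᵃ 1 * killTime b + sumFrom visitTime (suc p) r ,
          (suc p , r , i′≡ , trans (sym (+-suc p r)) p+r≡N , scan′ , refl) ,
          (begin
            4 + τ + (array σ′ Aᵃ 1 * killTime b + sumFrom visitTime (suc p) r)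
              ≡⟨ +-assoc (4 + τ) (array σ′ Aᵃ 1 * killTime b) (sumFrom visitTime (suc p) r) ⟨
            4 + τ + array σ′ Aᵃ 1 * killTime b + sumFrom visitTime (suc p) r
              ≤⟨ +-monoˡ-≤ (sumFrom visitTime (suc p) r) τ≤ ⟩
            array σ₁ Aᵃ 1 * killTime b + visitTime p + sumFrom visitTime (suc p) r
              ≡⟨ +-assoc (array σ₁ Aᵃ 1 * killTime b) (visitTime p) _ ⟩
            array σ₁ Aᵃ 1 * killTime b + sumFrom visitTime p (suc r)
              ≡⟨ m≡ ⟨
            m ∎)
      where
      p<N : p < N
      p<N = subst (suc p ≤_) p+r≡N (m<m+n p (s≤s z≤n))

  -- Each phase halves the root, so `h` of them suffice. Kills are charged to the root and not to a
  -- phase, so one `A 1 * killTime b` pays for those of all phases together.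
  phases-spec : ∀ {σ A h} → array σ Aᵃ ≡ A → scalar σ lenᵛ ≡ 0 → A 1 < 2 ^ h →
    St σ → Live A 0 (array σ Vᵃ) →
    Wp phases (λ σ′ τ → let len = scalar σ′ lenᵛ in
      array σ′ Aᵃ 1 ≡ 0 × Live (array σ′ Aᵃ) len (array σ′ Vᵃ) ×
      len * k ≤ h * (n + n) × τ ≤ A 1 * killTime b + h * phaseTime N b + 3) σ
  phases-spec {σ} {A₀} {h} refl len≡0 A1< st live = conseq
    (while-rule I (λ _ → _) step (h , A1< , subst (λ l → Live A₀ l (array σ Vᵃ)) (sym len≡0) live ,
      ≤-reflexive (cong (λ l → l * k + h * (n + n)) len≡0) , refl))
    λ _ (m′ , (h′ , _ , live′ , len≤ , _) , A1≡0 , τ≤) →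
      A1≡0 , live′ , ≤-trans (m≤m+n _ (h′ * (n + n))) len≤ , ≤-trans (m≤m+n _ m′) τ≤
    where
    I : ℕ → Store → Set
    I m σ = ∃[ h′ ] (A 1 < 2 ^ h′ × Live A len (array σ Vᵃ) ×
      len * k + h′ * (n + n) ≤ h * (n + n) × m ≡ A 1 * killTime b + h′ * phaseTime N b)
      where
      A = array σ Aᵃ
      len = scalar σ lenᵛ
    step : ∀ {m σ₁ v} → Same phase σ σ₁ → I m σ₁ → array σ₁ Aᵃ 1 ≡ suc v →
           Wp phase (λ σ′ τ → ∃[ m′ ] (I m′ σ′ × suc (2 + τ + m′) ≤ m)) σ₁
    step s (zero , A1< , _) A1≡ = contradiction (subst (_< 1) A1≡ A1<) λ { (s≤s ()) }
    step {m} {σ₁} s (suc h′ , A1< , live , len≤ , m≡) A1≡ =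
      conseq (phase-spec refl refl refl (subst (1 ≤_) (sym A1≡) (s≤s z≤n)) (static-same n k N V sz s st) live)
        λ {σ′} {τ} _ (live′ , halved′ , picks , τ≤) →
          let R = array σ′ Aᵃ 1
              K = killTime b
          in R * K + h′ * phaseTime N b ,
             (h′ , half-bound halved′ , live′ , picks-bound (scalar σ′ lenᵛ) picks , refl) ,
             (begin
               3 + τ + (R * K + h′ * phaseTime N b)  ≡⟨ +-assoc (3 + τ) (R * K) _ ⟨
               3 + (τ + R * K + h′ * phaseTime N b)  ≤⟨ +-monoʳ-≤ 3 (+-monoˡ-≤ (h′ * phaseTime N b) τ≤) ⟩
               3 + (A₁ 1 * K + (11 + N * (47 + chainTime b)) + h′ * phaseTime N b)
                 ≡⟨ r (A₁ 1 * K) (N * (47 + chainTime b)) (h′ * phaseTime N b) ⟩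
               A₁ 1 * K + suc h′ * phaseTime N b     ≡⟨ m≡ ⟨
               m                                     ∎)
      where
      open ≤-Reasoning
      A₁ = array σ₁ Aᵃ
      r : ∀ x y z → 3 + (x + (11 + y) + z) ≡ x + (14 + y + z)
      r = solve-∀
      half-bound : ∀ {x} → x + x ≤ A₁ 1 → x < 2 ^ h′
      half-bound {x} x≤ = ≰⇒> λ 2^≤x → <⇒≱ A1< (≤-trans (≤-reflexive (2^suc h′)) (≤-trans (+-mono-≤ 2^≤x 2^≤x) x≤))
      picks-bound : ∀ l → l * k ≤ scalar σ₁ lenᵛ * k + (n + n) → l * k + h′ * (n + n) ≤ h * (n + n)
      picks-bound l p = begin
        l * k + h′ * (n + n)                            ≤⟨ +-monoˡ-≤ (h′ * (n + n)) p ⟩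
        scalar σ₁ lenᵛ * k + (n + n) + h′ * (n + n)     ≡⟨ +-assoc (scalar σ₁ lenᵛ * k) (n + n) _ ⟩
        scalar σ₁ lenᵛ * k + suc h′ * (n + n)           ≤⟨ len≤ ⟩
        h * (n + n)                                     ∎

-- Preprocessing

-- The difference with `≐` resets the depth to 0 at a root, which is listed as its own parent. The
-- backward index serves twice: as a position whose subtree size is found, and as a tree node, whose
-- children have larger indices and are complete unless it is 0.
forwardBody backwardBody : Cmd
forwardBody =
    vᵛ ≔ Vᵃ ⟨ var iᵛ ⟩
  ⨾ Dᵃ ⟨ var vᵛ ⟩≔ (lit 1 ⊖ (var vᵛ ≐ Pᵃ ⟨ var iᵛ ⟩)) ⊗ (Dᵃ ⟨ Pᵃ ⟨ var iᵛ ⟩ ⟩ ⊕ lit 1)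
  ⨾ depᵃ ⟨ var iᵛ ⟩≔ Dᵃ ⟨ var vᵛ ⟩
  ⨾ Aᵃ ⟨ var Nᵛ ⊕ var iᵛ ⟩≔ (Dᵃ ⟨ var vᵛ ⟩ ≐ var kᵛ)
  ⨾ nxtᵃ ⟨ var iᵛ ⟩≔ headᵃ ⟨ var vᵛ ⟩
  ⨾ headᵃ ⟨ var vᵛ ⟩≔ var iᵛ ⊕ lit 1
  ⨾ Cᵃ ⟨ var iᵛ ⟩≔ var vᵛ
  ⨾ iᵛ ≔ var iᵛ ⊕ lit 1
backwardBody =
    iᵛ ≔ var iᵛ ⊖ lit 1
  ⨾ vᵛ ≔ depᵃ ⟨ var iᵛ ⟩
  ⨾ mᵛ ≔ Sᵃ ⟨ var vᵛ ⊕ lit 1 ⟩ ⊕ lit 1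
  ⨾ szᵃ ⟨ var iᵛ ⟩≔ var mᵛ
  ⨾ Sᵃ ⟨ var vᵛ ⟩≔ Sᵃ ⟨ var vᵛ ⟩ ⊕ var mᵛ
  ⨾ Sᵃ ⟨ var vᵛ ⊕ lit 1 ⟩≔ lit 0
  ⨾ Aᵃ ⟨ var iᵛ ⟩≔ Aᵃ ⟨ var iᵛ ⊕ var iᵛ ⟩ ⊕ Aᵃ ⟨ var iᵛ ⊕ var iᵛ ⊕ lit 1 ⟩

module Arrays (V P : ℕ → ℕ) (N : ℕ) where

  -- Indexed by vertex: the latest occurrence of the parent label is the parent itself,
  -- as the labels of a tree are distinct.
  depthOf : ℕ → ℕ → ℕ
  depthOf zero    = λ _ → 0
  depthOf (suc i) = depthOf i [ V i ↦ (1 ∸ δ (V i) (P i)) * (depthOf i (P i) + 1) ]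

  depth : ℕ → ℕ
  depth i = depthOf (suc i) (V i)

  depthOf≤ : ∀ m x → depthOf m x ≤ m
  depthOf≤ zero    x = z≤n
  depthOf≤ (suc m) x with V m ≡ᵇ x
  ... | false = m≤n⇒m≤1+n (depthOf≤ m x)
  ... | true  = ≤-trans (*-mono-≤ (m∸n≤m 1 (δ (V m) (P m))) (+-monoˡ-≤ 1 (depthOf≤ m (P m))))
                  (≤-reflexive (trans (*-identityˡ _) (+-comm m 1)))

  -- Reading the positions i, …, i + r − 1 backwards: at each depth, the number of
  -- positions in the subtrees whose parent is still to come.
  pending : ℕ → ℕ → ℕ → ℕ
  pending zero    i = λ _ → 0
  pending (suc r) i =
    S [ depth i ↦ S (depth i) + (S (depth i + 1) + 1) ] [ depth i + 1 ↦ 0 ]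
    where
    S = pending r (suc i)

  subtreeSize : ℕ → ℕ
  subtreeSize i = pending (N ∸ suc i) (suc i) (depth i + 1) + 1

  -- Reading a position moves the entry at depth d + 1 to depth d and adds one, so each position
  -- read is counted once. The range N + 2 includes d + 1, as depths are at most `N`. The bound on
  -- single entries excludes overflow.
  pending-total : ∀ r i → i + r ≡ N → sumTo (N + 2) (pending r i) ≡ r
  pending-total zero    i e = sumTo-zero (N + 2) _ λ _ _ → refl
  pending-total (suc r) i e = +-cancelʳ-≡ (S (d + 1) + S d) _ _ (begin
    total (S₁ [ d + 1 ↦ 0 ]) + (S (d + 1) + S d)  ≡⟨ +-assoc (total (S₁ [ d + 1 ↦ 0 ])) _ _ ⟨
    total (S₁ [ d + 1 ↦ 0 ]) + S (d + 1) + S d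
      ≡⟨ cong (λ x → total (S₁ [ d + 1 ↦ 0 ]) + x + S d) (update-≢ S a d≢d+1) ⟨
    total (S₁ [ d + 1 ↦ 0 ]) + S₁ (d + 1) + S d   ≡⟨ cong (_+ S d) (sumTo-update S₁ 0 d+1<) ⟩
    total S₁ + 0 + S d                            ≡⟨ cong (_+ S d) (+-identityʳ (total S₁)) ⟩
    total S₁ + S d                                ≡⟨ sumTo-update S a (<-trans d<d+1 d+1<) ⟩
    total S + a
      ≡⟨ cong (_+ a) (pending-total r (suc i) (trans (sym (+-suc i r)) e)) ⟩
    r + a                                         ≡⟨ shuffle r (S d) (S (d + 1)) ⟩
    suc r + (S (d + 1) + S d)                     ∎)
    where
    open ≡-Reasoning
    total = sumTo (N + 2)
    S = pending r (suc i)
    d = depth i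
    a = S d + (S (d + 1) + 1)
    S₁ = S [ d ↦ a ]
    d<d+1 : d < d + 1
    d<d+1 = m<m+n d (s≤s z≤n)
    d≢d+1 : d ≢ d + 1
    d≢d+1 = <⇒≢ d<d+1
    i<N : i < N
    i<N = subst (i <_) e (m<m+n i (s≤s z≤n))
    d+1< : d + 1 < N + 2
    d+1< = ≤-<-trans (+-monoˡ-≤ 1 (≤-trans (depthOf≤ (suc i) (V i)) i<N)) (+-monoʳ-< N (s≤s (s≤s z≤n)))
    shuffle : ∀ r x y → r + (x + (y + 1)) ≡ suc r + (y + x)
    shuffle = solve-∀

  pending≤ : ∀ {r i d} → i + suc r ≡ N → d ≡ depth i →
    pending r (suc i) d + (pending r (suc i) (d + 1) + 1) ≤ N
  pending≤ {r} {i} e refl = ≤-trans (≤-reflexive (sym top)) (≤-trans (term≤sumTo (pending (suc r) i) d<)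
    (≤-trans (≤-reflexive (pending-total (suc r) i e)) (≤-trans (m≤n+m (suc r) i) (≤-reflexive e))))
    where
    S = pending r (suc i)
    d = depth i
    top : pending (suc r) i d ≡ S d + (S (d + 1) + 1)
    top = trans (update-≢ (S [ d ↦ _ ]) 0 (<⇒≢ (m<m+n d (s≤s z≤n)) ∘ sym)) (update-≡ S d _)
    d< : d < N + 2
    d< = ≤-<-trans (≤-trans (depthOf≤ (suc i) (V i)) (subst (suc i ≤_) e (m<m+n i (s≤s z≤n)))) (m<m+n N (s≤s z≤n))

-- Correctness of the two passes

module Passes (W : ℕ) (4≤W : 4 ≤ W) (V P : ℕ → ℕ) (k N : ℕ) (4N<W : N + N + (N + N) + 1 < W) where

  open Logic W 4≤W
  open Arrays V P N

  target : ℕ → ℕ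
  target q = δ (depth q) k

  small : ∀ {x} → x ≤ N + N + 1 → x < W
  small x≤ = ≤-<-trans (≤-trans x≤ (+-monoˡ-≤ 1 (m≤m+n (N + N) (N + N)))) 4N<W

  N+1-small : ∀ {x} → x ≤ N → x + 1 < W
  N+1-small x≤N = small (+-monoˡ-≤ 1 (≤-trans x≤N (m≤m+n N N)))

  snoc-≡ : ∀ {f g : ℕ → ℕ} {m a} → (∀ x → x < m → f x ≡ g x) → a ≡ g m →
           ∀ x → x < suc m → (f [ m ↦ a ]) x ≡ g x
  snoc-≡ {f} {m = m} h e x x<1+m with m<1+n⇒m<n∨m≡n x<1+m
  ... | inj₁ x< = trans (update-≢ f _ (<⇒≢ x< ∘ sym)) (h x x<)
  ... | inj₂ refl = trans (update-≡ f x _) e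

  -- `rest≡` is there for `N = 0`: cell 1 is then no tree node, yet must read 0 for the phases to
  -- stop at once.
  record Forward (i : ℕ) (σ : Store) : Set where
    field
      D≡    : array σ Dᵃ ≡ depthOf i
      head≡ : array σ headᵃ ≡ lastOcc V i
      dep≡  : ∀ x → x < i → array σ depᵃ x ≡ depth x
      next≡ : ∀ x → x < i → array σ nxtᵃ x ≡ lastOcc V x (V x)
      copy≡ : ∀ x → x < i → array σ Cᵃ x ≡ V x
      leaf≡ : ∀ x → x < i → array σ Aᵃ (N + x) ≡ target x
      node≡ : ∀ x → x < N → array σ Aᵃ x ≡ 0
      rest≡ : ∀ x → N + i ≤ x → array σ Aᵃ x ≡ 0

  forward-spec : ∀ {σ} → array σ Vᵃ ≡ V → array σ Pᵃ ≡ P → scalar σ Nᵛ ≡ N → scalar σ kᵛ ≡ k →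
    scalar σ iᵛ ≡ 0 → Forward 0 σ →
    Wp (while (var iᵛ ≺ var Nᵛ) forwardBody)
       (λ σ′ τ → scalar σ′ iᵛ ≡ N × Forward N σ′ × τ ≤ N * suc (3 + duration forwardBody) + 4) σ
  forward-spec {σ} V≡ P≡ N≡ k≡ i≡0 start =
    conseq (for-rule {j = N} (duration forwardBody) I (λ _ → _) step (0 , i≡0 , +-identityʳ N , start))
      λ { {σ′} s ((c , i , i≡ , c+i≡N , inv) , exit , τ≤) →
          let i≡N = ≤-antisym (≤-trans (m≤n+m i c) (≤-reflexive c+i≡N))
                      (subst₂ _≤_ (trans (scalar≡ s Nᵛ _) N≡) i≡ (lt≡0⇒≥ exit))
          in trans i≡ i≡N , subst (λ i → Forward i σ′) i≡N inv , τ≤ }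
    where
    I : ℕ → Store → Set
    I c σ = ∃[ i ] (scalar σ iᵛ ≡ i × c + i ≡ N × Forward i σ)
    step : ∀ {c σ₁ v} → Same forwardBody σ σ₁ → I c σ₁ → bit (scalar σ₁ iᵛ <ᵇ scalar σ₁ Nᵛ) ≡ suc v →
           ∃[ c′ ] (c ≡ suc c′ × Wp forwardBody (λ σ′ τ → I c′ σ′ × τ ≤ duration forwardBody) σ₁)
    step {zero} s (i , i≡ , refl , _) z =
      contradiction (subst₂ _<_ i≡ (trans (scalar≡ s Nᵛ _) N≡) (lt≢0⇒< z)) 1+n≰n
    step {suc c} {σ₁} s (i , refl , c+i≡N , inv) z = c , refl , block safe ((suc i , +-comm i 1 , trans (+-suc c i) c+i≡N , record
      { D≡ = D′≡
      ; head≡ = cong₂ _[ V₁ i ↦_] head≡ (+-comm i 1) ∙ cong (λ x → lastOcc V i [ x ↦ suc i ]) Vi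
      ; dep≡ = snoc-≡ dep≡ (cong₂ (λ f x → f x) D′≡ Vi)
      ; next≡ = snoc-≡ next≡ (cong₂ (λ f x → f x) head≡ Vi)
      ; copy≡ = snoc-≡ copy≡ Vi
      ; leaf≡ = leaf′
      ; node≡ = λ x x<N → trans (update-≢ A₁ _ (<⇒≢ (<-≤-trans x<N N≤cell) ∘ sym)) (node≡ x x<N)
      ; rest≡ = λ x h → trans (update-≢ A₁ _ (<⇒≢ (subst (_< x) (sym cell≡) (subst (_≤ x) (+-suc N i) h))))
                          (rest≡ x (≤-trans (+-monoʳ-≤ N (n≤1+n i)) h))
      }) , ≤-refl)
      where
      open Forward inv
      infixr 5 _∙_
      _∙_ : ∀ {A : Set} {x y z : A} → x ≡ y → y ≡ z → x ≡ z
      _∙_ = trans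
      V₁ = array σ₁ Vᵃ
      P₁ = array σ₁ Pᵃ
      D₁ = array σ₁ Dᵃ
      A₁ = array σ₁ Aᵃ
      N₁ = scalar σ₁ Nᵛ
      k₁ = scalar σ₁ kᵛ
      Vi : V₁ i ≡ V i
      Vi = cong (λ f → f i) (trans (array≡ s Vᵃ _) V≡)
      Pi : P₁ i ≡ P i
      Pi = cong (λ f → f i) (trans (array≡ s Pᵃ _) P≡)
      new : ℕ
      new = (1 ∸ δ (V₁ i) (P₁ i)) * (D₁ (P₁ i) + 1)
      D′≡ : D₁ [ V₁ i ↦ new ] ≡ depthOf (suc i)
      D′≡ = trans (cong₂ (λ v p → D₁ [ v ↦ (1 ∸ δ v p) * (D₁ p + 1) ]) Vi Pi)
                  (cong (λ D → D [ V i ↦ (1 ∸ δ (V i) (P i)) * (D (P i) + 1) ]) D≡)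
      i<N : i < N
      i<N = ≤-trans (s≤s (m≤n+m i c)) (≤-reflexive c+i≡N)
      cell≡ : N₁ + i ≡ N + i
      cell≡ = cong (_+ i) (trans (scalar≡ s Nᵛ _) N≡)
      N≤cell : N ≤ N₁ + i
      N≤cell = subst (N ≤_) (sym cell≡) (m≤m+n N i)
      leaf′ : ∀ x → x < suc i →
        (A₁ [ N₁ + i ↦ δ ((D₁ [ V₁ i ↦ new ]) (V₁ i)) k₁ ]) (N + x) ≡ target x
      leaf′ x x<1+i with m<1+n⇒m<n∨m≡n x<1+i
      ... | inj₁ x< = trans (update-≢ A₁ _ λ e → <⇒≢ x< (sym (+-cancelˡ-≡ N i x (trans (sym cell≡) e)))) (leaf≡ x x<)
      ... | inj₂ refl = trans (cong (λ y → (A₁ [ y ↦ δ ((D₁ [ V₁ i ↦ new ]) (V₁ i)) k₁ ]) (N + i)) cell≡) (trans (update-≡ A₁ (N + i) _)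
                          (cong₂ δ (cong₂ (λ f x → f x) D′≡ Vi) (trans (scalar≡ s kᵛ _) k≡)))
      D+1< : D₁ (P₁ i) + 1 < W
      D+1< = N+1-small (≤-trans (≤-reflexive (cong (λ f → f (P₁ i)) D≡)) (≤-trans (depthOf≤ i (P₁ i)) (<⇒≤ i<N)))
      safe : SafeBlock forwardBody σ₁
      safe = _ , (_ , _ , (_ , _ , D+1<) ,
                  ≤-<-trans (≤-trans (*-monoˡ-≤ (D₁ (P₁ i) + 1) (m∸n≤m 1 (δ (V₁ i) (P₁ i)))) (≤-reflexive (*-identityˡ _))) D+1<)
           , _ , ((_ , _ , small (≤-trans (≤-reflexive cell≡) (≤-trans (+-monoʳ-≤ N (<⇒≤ i<N)) (m≤m+n _ 1)))) , _)
           , _ , (_ , _ , _ , N+1-small (<⇒≤ i<N)) , _ , _ , _ , N+1-small (<⇒≤ i<N)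

  -- `bound` prevents overflow while the tree is built, without knowing what a cell sums over:
  -- leaves are at most 1 with index below 2N, and a node inherits the bound since its children have
  -- at least twice its index. `node≡` is needed at node 0, which is its own left child.
  record Backward (i : ℕ) (leaf : ℕ → ℕ) (σ : Store) : Set where
    field
      S≡    : array σ Sᵃ ≡ pending (N ∸ i) i
      size≡ : ∀ x → i ≤ x → x < N → array σ szᵃ x ≡ subtreeSize x
      tree  : ∀ j → i ≤ j → 1 ≤ j → j < N → array σ Aᵃ j ≡ array σ Aᵃ (j + j) + array σ Aᵃ (suc (j + j))
      bound : ∀ j → i ≤ j → 1 ≤ j → j < N + N → array σ Aᵃ j * j ≤ N + N
      leaf≡ : ∀ x → N ≤ x → array σ Aᵃ x ≡ leaf x
      node≡ : ∀ x → x < i → array σ Aᵃ x ≡ 0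

  backward-spec : ∀ {σ leaf} → (∀ x → x < N → array σ depᵃ x ≡ depth x) → scalar σ iᵛ ≡ N →
    Backward N leaf σ →
    Wp (while (var iᵛ) backwardBody)
       (λ σ′ τ → Backward 0 leaf σ′ × τ ≤ N * suc (1 + duration backwardBody) + 2) σ
  backward-spec {σ} {leaf} dep≡ i≡N start =
    conseq (for-rule {j = N} (duration backwardBody) I (λ _ → _) step (i≡N , ≤-refl , start))
      λ { {σ′} s ((i , i≡ , _ , inv) , exit , τ≤) →
          subst (λ i → Backward i leaf σ′) (trans (sym i≡) exit) inv , τ≤ }
    where
    I : ℕ → Store → Set
    I i σ = scalar σ iᵛ ≡ i × i ≤ N × Backward i leaf σ
    step : ∀ {c σ₁ v} → Same backwardBody σ σ₁ → I c σ₁ → scalar σ₁ iᵛ ≡ suc v →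
           ∃[ c′ ] (c ≡ suc c′ × Wp backwardBody (λ σ′ τ → I c′ σ′ × τ ≤ duration backwardBody) σ₁)
    step {c} {σ₁} {i} s (i≡ , c≤N , inv) z with trans (sym i≡) z
    ... | refl = i , refl , block safe ((pred≡ , <⇒≤ c≤N , record
      { S≡ = S′≡
      ; size≡ = size′
      ; tree = tree′
      ; bound = bound′
      ; leaf≡ = λ x N≤x → trans (update-≢ A₁ _ (<⇒≢ (subst (_< x) (sym pred≡) (≤-trans c≤N N≤x)))) (leaf≡ x N≤x)
      ; node≡ = λ x x<i → trans (update-≢ A₁ _ (<⇒≢ (subst (x <_) (sym pred≡) x<i) ∘ sym)) (node≡ x (m<n⇒m<1+n x<i))
      }) , ≤-refl)
      where
      open Backward inv
      A₁ = array σ₁ Aᵃ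
      S₁ = array σ₁ Sᵃ
      i₁ = scalar σ₁ iᵛ ∸ 1
      pred≡ : i₁ ≡ i
      pred≡ = cong (_∸ 1) i≡
      d₁ = array σ₁ depᵃ i₁
      d≡ : d₁ ≡ depth i
      d≡ = trans (cong₂ (λ f x → f x) (array≡ s depᵃ _) pred≡) (dep≡ i c≤N)
      r = N ∸ suc i
      N∸i : N ∸ i ≡ suc r
      N∸i = trans (sym (cong (_∸ i) (m∸n+n≡m c≤N))) (trans (cong (_∸ i) (+-suc r i)) (m+n∸n≡m (suc r) i))
      S′≡ : S₁ [ d₁ ↦ S₁ d₁ + (S₁ (d₁ + 1) + 1) ] [ d₁ + 1 ↦ 0 ] ≡ pending (N ∸ i) i
      S′≡ = trans (cong₂ (λ S d → S [ d ↦ S d + (S (d + 1) + 1) ] [ d + 1 ↦ 0 ]) S≡ d≡)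
                  (cong (λ m → pending m i) (sym N∸i))
      S+< : S₁ d₁ + (S₁ (d₁ + 1) + 1) ≤ N
      S+< = subst (λ S → S d₁ + (S (d₁ + 1) + 1) ≤ N) (sym S≡)
              (pending≤ {r} {i} (trans (+-suc i r) (m+[n∸m]≡n c≤N)) d≡)
      size′ : ∀ x → i ≤ x → x < N → (array σ₁ szᵃ [ i₁ ↦ S₁ (d₁ + 1) + 1 ]) x ≡ subtreeSize x
      size′ x i≤x x<N with i₁ ≟ x
      ... | yes i₁≡x rewrite sym i₁≡x = trans (update-≡ (array σ₁ szᵃ) i₁ _)
              (trans (cong₂ (λ S d → S (d + 1) + 1) S≡ d≡) (cong subtreeSize (sym pred≡)))
      ... | no i₁≢x = trans (update-≢ (array σ₁ szᵃ) _ i₁≢x)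
              (size≡ x (≤∧≢⇒< i≤x (i₁≢x ∘ trans pred≡)) x<N)
      w = A₁ (i₁ + i₁) + A₁ (i₁ + i₁ + 1)
      w≡ : w ≡ A₁ (i + i) + A₁ (suc (i + i))
      w≡ = cong₂ (λ x y → A₁ x + A₁ y) (cong₂ _+_ pred≡ pred≡)
             (trans (+-comm _ 1) (cong (λ x → suc (x + x)) pred≡))
      A′ = A₁ [ i₁ ↦ w ]
      above : ∀ {x} → i < x → A′ x ≡ A₁ x
      above i<x = update-≢ A₁ w (<⇒≢ (subst (_< _) (sym pred≡) i<x))
      at-i : A′ i ≡ w
      at-i = subst (λ x → A′ x ≡ w) pred≡ (update-≡ A₁ i₁ w)
      tree′ : ∀ j → i ≤ j → 1 ≤ j → j < N → A′ j ≡ A′ (j + j) + A′ (suc (j + j))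
      tree′ j i≤j 1≤j j<N = trans value≡ (sym (cong₂ _+_
          (above (≤-<-trans i≤j (m<m+n j 1≤j))) (above (≤-<-trans i≤j (s≤s (m≤m+n j j))))))
        where
        value≡ : A′ j ≡ A₁ (j + j) + A₁ (suc (j + j))
        value≡ with m≤n⇒m<n∨m≡n i≤j
        ... | inj₁ i<j = trans (above i<j) (tree j i<j 1≤j j<N)
        ... | inj₂ refl = trans at-i w≡
      2i<2N : suc (i + i) < N + N
      2i<2N = subst (_≤ N + N) (cong suc (+-suc i i)) (+-mono-≤ c≤N c≤N)
      bound′ : ∀ j → i ≤ j → 1 ≤ j → j < N + N → A′ j * j ≤ N + N
      bound′ j i≤j 1≤j j< with m≤n⇒m<n∨m≡n i≤j
      ... | inj₁ i<j = subst (λ x → x * j ≤ N + N) (sym (above i<j)) (bound j i<j 1≤j j<)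
      ... | inj₂ refl = subst (λ x → x * i ≤ N + N) (sym (trans at-i w≡))
        (double-cancel-≤ (≤-trans (≤-trans twice (+-mono-≤
          (bound (i + i) (m<m+n i 1≤j) (≤-trans 1≤j (m≤m+n i i)) (<-trans (n<1+n _) 2i<2N))
          (bound (suc (i + i)) (s≤s (m≤m+n i i)) (s≤s z≤n) 2i<2N))) (n≤1+n _)))
        where
        x = A₁ (i + i)
        y = A₁ (suc (i + i))
        dist : ∀ i x y → (x + y) * i + (x + y) * i + y ≡ x * (i + i) + y * suc (i + i)
        dist = solve-∀
        twice : (x + y) * i + (x + y) * i ≤ x * (i + i) + y * suc (i + i)
        twice = ≤-trans (m≤m+n _ y) (≤-reflexive (dist i x y))
      cell≤ : ∀ x → x < N + N → i < x → A₁ x ≤ N + N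
      cell≤ (suc x) x< i<x = ≤-trans (m≤m*n (A₁ (suc x)) (suc x)) (bound (suc x) i<x (s≤s z≤n) x<)
      left≤ : A₁ (i + i) ≤ N + N
      left≤ with m≤n⇒m<n∨m≡n (z≤n {i})
      ... | inj₁ 0<i = cell≤ (i + i) (<-trans (n<1+n _) 2i<2N) (m<m+n i 0<i)
      ... | inj₂ 0≡i = subst (λ x → A₁ (x + x) ≤ N + N) 0≡i (subst (_≤ N + N) (sym (node≡ 0 (s≤s z≤n))) z≤n)
      w< : w < W
      w< = subst (_< W) (sym w≡) (≤-<-trans (+-mono-≤ left≤ (cell≤ (suc (i + i)) 2i<2N (s≤s (m≤m+n i i))))
             (≤-<-trans (m≤m+n _ 1) 4N<W))
      d+1< : d₁ + 1 < W
      d+1< = N+1-small (≤-trans (≤-reflexive d≡) (≤-trans (depthOf≤ (suc i) (V i)) c≤N))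
      S<W : S₁ d₁ + (S₁ (d₁ + 1) + 1) < W
      S<W = small (≤-trans S+< (≤-trans (m≤m+n N N) (m≤m+n _ 1)))
      safe : SafeBlock backwardBody σ₁
      safe = _ , _ , ((_ , _ , d+1<) , _ , ≤-<-trans (m≤n+m _ (S₁ d₁)) S<W) , _
           , (_ , _ , _ , S<W) , ((_ , _ , d+1<) , _)
           , _ , (_ , _ , small (≤-trans (n≤1+n _) (≤-trans (subst (λ x → suc (x + x) ≤ N + N) (sym pred≡) (<⇒≤ 2i<2N)) (m≤m+n _ 1))))
           , ((_ , _ , small (≤-trans (n≤1+n _) (≤-trans (subst (λ x → suc (x + x) ≤ N + N) (sym pred≡) (<⇒≤ 2i<2N)) (m≤m+n _ 1)))) , _
             , small (+-monoˡ-≤ 1 (≤-trans (n≤1+n _) (subst (λ x → suc (x + x) ≤ N + N) (sym pred≡) (<⇒≤ 2i<2N)))))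
           , w<

-- Trees

mutual
  sizeT : ∀ {A} → RoseTree A → ℕ
  sizeT (node v ts) = suc (sizeF ts)

  sizeF : ∀ {A} → List (RoseTree A) → ℕ
  sizeF []       = 0
  sizeF (t ∷ ts) = sizeT t + sizeF ts

mutual
  length-vertices : ∀ {A} (t : RoseTree A) → length (vertices t) ≡ sizeT t
  length-vertices (node v ts) = cong suc (length-verticesF ts)

  length-verticesF : ∀ {A} (ts : List (RoseTree A)) → length (verticesF ts) ≡ sizeF ts
  length-verticesF []       = refl
  length-verticesF (t ∷ ts) = trans (length-++ (vertices t)) (cong₂ _+_ (length-vertices t) (length-verticesF ts))

mutual
  length-parents : ∀ {A} (p : A) t → length (parents p t) ≡ sizeT t
  length-parents p (node v ts) = cong suc (length-parentsF v ts)

  length-parentsF : ∀ {A} (p : A) ts → length (parentsF p ts) ≡ sizeF ts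
  length-parentsF p []       = refl
  length-parentsF p (t ∷ ts) = trans (length-++ (parents p t)) (cong₂ _+_ (length-parents p t) (length-parentsF p ts))

mutual
  -- Distinctness between a vertex and its descendants, arranged along the recursion that computes
  -- depths.
  NoRepeat : ∀ {A} → RoseTree A → Set
  NoRepeat (node v ts) = All (v ≢_) (verticesF ts) × NoRepeatF ts

  NoRepeatF : ∀ {A} → List (RoseTree A) → Set
  NoRepeatF []       = ⊤
  NoRepeatF (t ∷ ts) = NoRepeat t × NoRepeatF ts

Unique-++ : ∀ {A : Set} (xs : List A) {ys} → Unique (xs ++ ys) → Unique xs × Unique ys
Unique-++ []       u        = [] , u
Unique-++ (x ∷ xs) (px ∷ u) = let (ux , uy) = Unique-++ xs u in (All.++⁻ˡ xs px ∷ ux) , uy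

mutual
  noRepeat : ∀ {A} (t : RoseTree A) → Unique (vertices t) → NoRepeat t
  noRepeat (node v ts) (v∉ ∷ u) = v∉ , noRepeatF ts u

  noRepeatF : ∀ {A} (ts : List (RoseTree A)) → Unique (verticesF ts) → NoRepeatF ts
  noRepeatF []       u = tt
  noRepeatF (t ∷ ts) u = let (u₁ , u₂) = Unique-++ (vertices t) u in noRepeat t u₁ , noRepeatF ts u₂

module _ {n : ℕ} (f : ℕ → ℕ) where

  Reads : ℕ → List (Fin n) → Set
  Reads o []       = ⊤
  Reads o (x ∷ xs) = f o ≡ toℕ x × Reads (suc o) xs

  Reads-++ : ∀ o xs {ys} → Reads o (xs ++ ys) → Reads o xs × Reads (o + length xs) ys
  Reads-++ o []       {ys} r = tt , subst (λ o → Reads o ys) (sym (+-identityʳ o)) r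
  Reads-++ o (x ∷ xs) {ys} (e , r) =
    let (r₁ , r₂) = Reads-++ (suc o) xs r
    in (e , r₁) , subst (λ o → Reads o ys) (sym (+-suc o (length xs))) r₂

  Reads-word : ∀ o xs → (∀ i → f (o + i) ≡ word xs i) → Reads o xs
  Reads-word o []       h = tt
  Reads-word o (x ∷ xs) h = trans (cong f (sym (+-identityʳ o))) (h 0) ,
    Reads-word (suc o) xs λ i → trans (cong f (sym (+-suc o i))) (h (suc i))

  Reads-lookup : ∀ o xs → Reads o xs → ∀ {i} → o ≤ i → i < o + length xs → ∃[ x ] (x ∈ xs × f i ≡ toℕ x)
  Reads-lookup o []       r o≤i i< = contradiction (≤-trans i< (≤-trans (≤-reflexive (+-identityʳ o)) o≤i)) 1+n≰n
  Reads-lookup o (x ∷ xs) (e , r) {i} o≤i i< with m≤n⇒m<n∨m≡n o≤i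
  ... | inj₂ refl = x , here refl , e
  ... | inj₁ o<i  =
    let (y , y∈ , e′) = Reads-lookup (suc o) xs r o<i (subst (i <_) (+-suc o _) i<) in y , there y∈ , e′

  Reads-injective : ∀ o xs → Reads o xs → Unique xs → ∀ {i j} →
    o ≤ i → i < o + length xs → o ≤ j → j < o + length xs → f i ≡ f j → i ≡ j
  Reads-injective o [] r u {i} o≤i i< = contradiction (≤-trans i< (≤-trans (≤-reflexive (+-identityʳ o)) o≤i)) 1+n≰n
  Reads-injective o (x ∷ xs) (e , r) (x∉ ∷ u) {i} {j} o≤i i< o≤j j< fi≡fj
    with m≤n⇒m<n∨m≡n o≤i | m≤n⇒m<n∨m≡n o≤j
  ... | inj₂ refl | inj₂ refl = refl
  ... | inj₁ o<i  | inj₁ o<j  =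
    Reads-injective (suc o) xs r u o<i (subst (i <_) (+-suc o _) i<) o<j (subst (j <_) (+-suc o _) j<) fi≡fj
  ... | inj₂ refl | inj₁ o<j  =
    let (y , y∈ , e′) = Reads-lookup (suc o) xs r o<j (subst (j <_) (+-suc o _) j<)
    in contradiction (toℕ-injective (trans (sym e) (trans fi≡fj e′))) (All.lookup x∉ y∈)
  ... | inj₁ o<i  | inj₂ refl =
    let (y , y∈ , e′) = Reads-lookup (suc o) xs r o<i (subst (i <_) (+-suc o _) i<)
    in contradiction (toℕ-injective (trans (sym e) (trans (sym fi≡fj) e′))) (All.lookup x∉ y∈)

-- Depths, subtree sizes and root paths in the preorder layout

module Layout {n : ℕ} (V P : ℕ → ℕ) (N : ℕ) where

  open Arrays V P N

  sz : ℕ → ℕ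
  sz = subtreeSize

  mutual
    Placed : Fin n → ℕ → RoseTree (Fin n) → Set
    Placed p o (node v ts) = V o ≡ toℕ v × P o ≡ toℕ p × PlacedF v (suc o) ts

    PlacedF : Fin n → ℕ → List (RoseTree (Fin n)) → Set
    PlacedF p o []       = ⊤
    PlacedF p o (t ∷ ts) = Placed p o t × PlacedF p (o + sizeT t) ts

  mutual
    placed : ∀ p o t → Reads V o (vertices t) → Reads P o (parents p t) → Placed p o t
    placed p o (node v ts) (e , r) (e′ , r′) = e , e′ , placedF v (suc o) ts r r′

    placedF : ∀ p o ts → Reads V o (verticesF ts) → Reads P o (parentsF p ts) → PlacedF p o ts
    placedF p o []       r r′ = tt
    placedF p o (t ∷ ts) r r′ =
      let (r₁ , r₂)   = Reads-++ V o (vertices t) r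
          (r₁′ , r₂′) = Reads-++ P o (parents p t) r′
      in placed p o t r₁ r₁′ ,
         placedF p (o + sizeT t) ts
           (subst (λ l → Reads V (o + l) (verticesF ts)) (length-vertices t) r₂)
           (subst (λ l → Reads P (o + l) (parentsF p ts)) (length-parents p t) r₂′)

  mutual
    Depths : ℕ → ℕ → RoseTree (Fin n) → Set
    Depths d o (node v ts) = depth o ≡ d × V o ≡ toℕ v × DepthsF (suc d) (suc o) ts

    DepthsF : ℕ → ℕ → List (RoseTree (Fin n)) → Set
    DepthsF d o []       = ⊤
    DepthsF d o (t ∷ ts) = Depths d o t × DepthsF d (o + sizeT t) ts

  Avoids : ℕ → List (Fin n) → Set
  Avoids x vs = ∀ {w} → w ∈ vs → toℕ w ≢ x

  mutual
    -- The second conclusion makes the induction work: a parent's entry in the depth table survives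
    -- the subtrees of earlier children, as its label does not occur in them. The alternatives for
    -- the origin are a proper parent and a root listed as its own parent.
    depths : ∀ p d o t → Placed p o t → NoRepeat t →
      (depthOf o (toℕ p) + 1 ≡ d × Avoids (toℕ p) (vertices t)) ⊎ (root t ≡ p × d ≡ 0) →
      Depths d o t × (∀ {x} → Avoids x (vertices t) → depthOf (o + sizeT t) x ≡ depthOf o x)
    depths p d o (node v ts) (Vo , Po , pl) (v∉ , nr) origin =
      (depth≡ , Vo , proj₁ below) ,
      λ {x} av → trans (cong (λ m → depthOf m x) (+-suc o (sizeF ts)))
        (trans (proj₂ below (av ∘ there))
               (update-≢ (depthOf o) _ (λ e → av (here refl) (trans (sym Vo) e))))
      where
      parent = depthOf o (P o) + 1
      depth≡′ : (depthOf o (toℕ p) + 1 ≡ d × Avoids (toℕ p) (v ∷ verticesF ts)) ⊎ (v ≡ p × d ≡ 0) →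
                 (1 ∸ δ (V o) (P o)) * parent ≡ d
      depth≡′ (inj₁ (e , av)) = trans
        (cong (λ x → (1 ∸ x) * parent) (δ-≢ λ Vo≡Po → av (here refl) (trans (sym Vo) (trans Vo≡Po Po))))
        (trans (*-identityˡ parent) (trans (cong (λ x → depthOf o x + 1) Po) e))
      depth≡′ (inj₂ (e , d≡0)) = trans
        (cong (λ x → (1 ∸ x) * parent) (trans (cong (λ x → δ x (P o)) (trans Vo (trans (cong toℕ e) (sym Po)))) (δ-refl (P o))))
        (sym d≡0)
      depth≡ : depth o ≡ d
      depth≡ = trans (update-≡ (depthOf o) (V o) _) (depth≡′ origin)
      below = depthsF v (suc d) (suc o) ts pl nr
        (trans (+-comm _ 1) (cong suc (trans (cong (depthOf (suc o)) (sym Vo)) depth≡)))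
        λ w∈ e → All.lookup v∉ w∈ (sym (toℕ-injective e))

    depthsF : ∀ p d o ts → PlacedF p o ts → NoRepeatF ts →
      depthOf o (toℕ p) + 1 ≡ d → Avoids (toℕ p) (verticesF ts) →
      DepthsF d o ts × (∀ {x} → Avoids x (verticesF ts) → depthOf (o + sizeF ts) x ≡ depthOf o x)
    depthsF p d o [] _ _ _ _ = tt , λ {x} _ → cong (λ m → depthOf m x) (+-identityʳ o)
    depthsF p d o (t ∷ ts) (pl , pls) (nr , nrs) e av =
      (proj₁ first , proj₁ rest) ,
      λ {x} avx → trans (cong (λ m → depthOf m x) (sym (+-assoc o (sizeT t) (sizeF ts))))
        (trans (proj₂ rest (avx ∘ ∈-++⁺ʳ (vertices t))) (proj₂ first (avx ∘ ∈-++⁺ˡ)))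
      where
      first = depths p d o t pl nr (inj₁ (e , av ∘ ∈-++⁺ˡ))
      rest = depthsF p d (o + sizeT t) ts pls nrs
        (trans (cong (_+ 1) (proj₂ first (av ∘ ∈-++⁺ˡ))) e) (av ∘ ∈-++⁺ʳ (vertices t))

  mutual
    Sizes : ℕ → RoseTree (Fin n) → Set
    Sizes o (node v ts) = sz o ≡ suc (sizeF ts) × SizesF (suc o) ts

    SizesF : ℕ → List (RoseTree (Fin n)) → Set
    SizesF o []       = ⊤
    SizesF o (t ∷ ts) = Sizes o t × SizesF (o + sizeT t) ts

  -- Read backwards, a whole forest whose roots have depth `d` leaves a single trace, its size at
  -- depth `d`.
  record Absorbs (d s : ℕ) (R S : ℕ → ℕ) : Set where
    constructor absorbs
    field
      at    : S d ≡ R d + s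
      under : ∀ {x} → x < d → S x ≡ R x
      over  : ∀ {x} → d < x → S x ≡ 0

  mutual
    -- Nothing deeper than `d` is pending to the right of a tree whose root has depth `d`. So when
    -- this root is read, the entry at depth d + 1 consists of its own children's subtrees only.
    sizes : ∀ t {d o r r′ o′} → Depths d o t → r ≡ sizeT t + r′ → o + sizeT t ≡ o′ → o + r ≡ N →
      (∀ {x} → d < x → pending r′ o′ x ≡ 0) →
      Absorbs d (sizeT t) (pending r′ o′) (pending r o) × Sizes o t
    sizes (node v ts) {d} {o} {r′ = r′} {o′} (depth≡ , _ , dps) refl o′≡ N≡ zeros
      with sizesF ts {suc d} {suc o} dps refl (trans (sym (+-suc o _)) o′≡) (trans (sym (+-suc o _)) N≡)
             (λ h → zeros (<-trans (n<1+n d) h))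
    ... | absorbs at under over , szs = absorbs at′ under′ over′ , size≡ , szs
      where
      S = pending (sizeF ts + r′) (suc o)
      R = pending r′ o′
      children : S (d + 1) ≡ sizeF ts
      children = trans (cong S (+-comm d 1)) (trans at (cong (_+ sizeF ts) (zeros (n<1+n d))))
      S₁ = S [ d ↦ S d + (S (d + 1) + 1) ]
      S₂ = S₁ [ d + 1 ↦ 0 ]
      pending≡ : pending (suc (sizeF ts + r′)) o ≡ S₂
      pending≡ = cong (λ d → S [ d ↦ S d + (S (d + 1) + 1) ] [ d + 1 ↦ 0 ]) depth≡
      d<d+1 : d < d + 1
      d<d+1 = m<m+n d (s≤s z≤n)
      at′ : pending (suc (sizeF ts + r′)) o d ≡ R d + suc (sizeF ts)
      at′ = trans (cong (λ f → f d) pending≡) (trans (update-≢ S₁ 0 (<⇒≢ d<d+1 ∘ sym))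
        (trans (update-≡ S d _) (cong₂ _+_ (under (n<1+n d)) (trans (cong (_+ 1) children) (+-comm _ 1)))))
      under′ : ∀ {x} → x < d → pending (suc (sizeF ts + r′)) o x ≡ R x
      under′ {x} x<d = trans (cong (λ f → f x) pending≡) (trans (update-≢ S₁ 0 (<⇒≢ (<-trans x<d d<d+1) ∘ sym))
        (trans (update-≢ S _ (<⇒≢ x<d ∘ sym)) (under (m<n⇒m<1+n x<d))))
      over′ : ∀ {x} → d < x → pending (suc (sizeF ts + r′)) o x ≡ 0
      over′ {x} d<x with d + 1 ≟ x
      ... | yes refl = trans (cong (λ f → f x) pending≡) (update-≡ S₁ (d + 1) 0)
      ... | no ne = trans (cong (λ f → f x) pending≡) (trans (update-≢ S₁ 0 ne)
        (trans (update-≢ S _ (<⇒≢ d<x)) (over (≤∧≢⇒< d<x (ne ∘ trans (+-comm d 1))))))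
      rest≡ : N ∸ suc o ≡ sizeF ts + r′
      rest≡ = trans (cong (_∸ suc o) (trans (sym N≡) (+-suc o _))) (m+n∸m≡n (suc o) _)
      size≡ : sz o ≡ suc (sizeF ts)
      size≡ = trans (cong₂ (λ r d → pending r (suc o) (d + 1) + 1) rest≡ depth≡)
        (trans (cong (_+ 1) children) (+-comm _ 1))

    sizesF : ∀ ts {d o r r′ o′} → DepthsF d o ts → r ≡ sizeF ts + r′ → o + sizeF ts ≡ o′ → o + r ≡ N →
      (∀ {x} → d < x → pending r′ o′ x ≡ 0) →
      Absorbs d (sizeF ts) (pending r′ o′) (pending r o) × SizesF o ts
    sizesF [] {d} {o} {r} _ refl o′≡ N≡ zeros with trans (sym (+-identityʳ o)) o′≡
    ... | refl = absorbs (sym (+-identityʳ _)) (λ _ → refl) zeros , tt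
    sizesF (t ∷ ts) {d} {o} {r′ = r′} {o′} (dp , dps) refl o′≡ N≡ zeros
      with sizesF ts {r = sizeF ts + r′} dps refl (trans (+-assoc o _ _) o′≡)
             (trans (+-assoc o _ _) (trans (cong (o +_) (sym (+-assoc (sizeT t) _ _))) N≡)) zeros
    ... | absorbs at under over , szs
      with sizes t {r′ = sizeF ts + r′} dp (+-assoc (sizeT t) (sizeF ts) r′) refl N≡ over
    ... | absorbs at′ under′ over′ , sz =
      absorbs (trans at′ (trans (cong (_+ sizeT t) at) (shuffle (pending r′ o′ d) (sizeF ts) (sizeT t))))
        (λ h → trans (under′ h) (under h)) over′ , sz , szs
      where
      shuffle : ∀ r f t → r + f + t ≡ r + (t + f)
      shuffle = solve-∀

  mutual
    ends : ∀ o t → Sizes o t → ∀ {i} → o ≤ i → i < o + sizeT t → i + sz i ≤ o + sizeT t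
    ends o (node v ts) (e , szs) {i} o≤i i< with m≤n⇒m<n∨m≡n o≤i
    ... | inj₂ refl = ≤-reflexive (cong (o +_) e)
    ... | inj₁ o<i  = subst (i + sz i ≤_) (sym (+-suc o _)) (endsF (suc o) ts szs o<i (subst (i <_) (+-suc o _) i<))

    endsF : ∀ o ts → SizesF o ts → ∀ {i} → o ≤ i → i < o + sizeF ts → i + sz i ≤ o + sizeF ts
    endsF o [] _ o≤i i< = contradiction (≤-trans i< (≤-trans (≤-reflexive (+-identityʳ o)) o≤i)) 1+n≰n
    endsF o (t ∷ ts) (s , szs) {i} o≤i i< with i <? o + sizeT t
    ... | yes i<t = ≤-trans (ends o t s o≤i i<t) (+-monoʳ-≤ o (m≤m+n _ _))
    ... | no i≮t  = subst (i + sz i ≤_) (+-assoc o _ _)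
      (endsF (o + sizeT t) ts szs (≮⇒≥ i≮t) (subst (i <_) (sym (+-assoc o _ _)) i<))

  sumFrom-+ : ∀ f o a b → sumFrom f o (a + b) ≡ sumFrom f o a + sumFrom f (o + a) b
  sumFrom-+ f o zero    b = cong (λ o → sumFrom f o b) (sym (+-identityʳ o))
  sumFrom-+ f o (suc a) b = trans (cong (f o +_) (trans (sumFrom-+ f (suc o) a b)
    (cong (λ x → sumFrom f (suc o) a + sumFrom f x b) (sym (+-suc o a))))) (sym (+-assoc (f o) _ _))

  ancestors : ℕ → ℕ → ℕ → ℕ
  ancestors q = sumFrom (λ i → cov sz i q)

  mutual
    -- On the way down to `q`, each node passed covers `q` and raises the depth by one.
    enough-ancestors : ∀ d o t → Depths d o t → Sizes o t → ∀ {q} → o ≤ q → q < o + sizeT t →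
      suc (depth q) ≤ d + ancestors q o (sizeT t)
    enough-ancestors d o (node v ts) (depth≡ , _ , dps) (size≡ , szs) {q} o≤q q< =
      subst (λ c → suc (depth q) ≤ d + (c + ancestors q (suc o) (sizeF ts)))
        (sym (cov⇐ sz o≤q (subst (λ s → q < o + s) (sym size≡) q<)))
        (subst (suc (depth q) ≤_) (sym (+-suc d _)) inner)
      where
      inner : suc (depth q) ≤ suc d + ancestors q (suc o) (sizeF ts)
      inner with m≤n⇒m<n∨m≡n o≤q
      ... | inj₂ refl = s≤s (≤-trans (≤-reflexive depth≡) (m≤m+n d _))
      ... | inj₁ o<q  = enough-ancestorsF (suc d) (suc o) ts dps szs o<q (subst (q <_) (+-suc o _) q<)

    enough-ancestorsF : ∀ d o ts → DepthsF d o ts → SizesF o ts → ∀ {q} → o ≤ q → q < o + sizeF ts →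
      suc (depth q) ≤ d + ancestors q o (sizeF ts)
    enough-ancestorsF d o [] _ _ o≤q q< =
      contradiction (≤-trans q< (≤-trans (≤-reflexive (+-identityʳ o)) o≤q)) 1+n≰n
    enough-ancestorsF d o (t ∷ ts) (dp , dps) (s , szs) {q} o≤q q<
      rewrite sumFrom-+ (λ i → cov sz i q) o (sizeT t) (sizeF ts) with q <? o + sizeT t
    ... | yes q<t = ≤-trans (enough-ancestors d o t dp s o≤q q<t) (+-monoʳ-≤ d (m≤m+n _ _))
    ... | no q≮t  = ≤-trans
      (enough-ancestorsF d (o + sizeT t) ts dps szs (≮⇒≥ q≮t) (subst (q <_) (sym (+-assoc o _ _)) q<))
      (+-monoʳ-≤ d (m≤n+m _ (ancestors q o (sizeT t))))

  -- The end of a root path, all of whose ancestors carry labels of the path.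
  Ends : ℕ → ℕ → ℕ → List (Fin n) → Set
  Ends d o s p = ∃[ q ] (o ≤ q × q < o + s × suc (depth q) ≡ d + length p ×
    (∀ {i} → o ≤ i → i < o + s → 1 ≤ cov sz i q → ∃[ v ] (v ∈ p × V i ≡ toℕ v)))

  mutual
    path-end : ∀ d o t {p} → Depths d o t → Sizes o t → RootPath t p → Ends d o (sizeT t) p
    path-end d o (node v ts) (depth≡ , Vo , dps) (size≡ , szs) here =
      o , ≤-refl , m<m+n o (s≤s z≤n) , trans (cong suc depth≡) (+-comm 1 d) ,
      λ o≤i _ c → v , here refl , trans (cong V (≤-antisym (proj₁ (cov⇒ sz c)) o≤i)) Vo
    path-end d o (node v ts) (depth≡ , Vo , dps) (size≡ , szs) (down t∈ path)
      with path-endF (suc d) (suc o) ts dps szs t∈ path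
    ... | q , o<q , q< , depth-q , labels =
      q , <⇒≤ o<q , subst (q <_) (sym (+-suc o _)) q< , trans depth-q (sym (+-suc d _)) , labels′
      where
      labels′ : ∀ {i} → o ≤ i → i < o + suc (sizeF ts) → 1 ≤ cov sz i q → ∃[ w ] (w ∈ v ∷ _ × V i ≡ toℕ w)
      labels′ {i} o≤i i< c with m≤n⇒m<n∨m≡n o≤i
      ... | inj₂ refl = v , here refl , Vo
      ... | inj₁ o<i  = let (w , w∈ , e) = labels o<i (subst (i <_) (+-suc o _) i<) c in w , there w∈ , e

    -- Positions in the other trees do not cover `q`: to the right they start after it, and to the
    -- left their intervals end before it.
    path-endF : ∀ d o ts {t p} → DepthsF d o ts → SizesF o ts → t ∈ ts → RootPath t p → Ends d o (sizeF ts) p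
    path-endF d o (t ∷ ts) (dp , dps) (s , szs) (here refl) path with path-end d o t dp s path
    ... | q , o≤q , q< , depth-q , labels = q , o≤q , <-≤-trans q< (+-monoʳ-≤ o (m≤m+n _ _)) , depth-q ,
      λ o≤i _ c → labels o≤i (≤-<-trans (proj₁ (cov⇒ sz c)) q<) c
    path-endF d o (t ∷ ts) {p = p} (dp , dps) (s , szs) (there t∈) path
      with path-endF d (o + sizeT t) ts dps szs t∈ path
    ... | q , o≤q , q< , depth-q , labels =
      q , ≤-trans (m≤m+n o _) o≤q , subst (q <_) (+-assoc o _ _) q< , depth-q , labels′
      where
      labels′ : ∀ {i} → o ≤ i → i < o + (sizeT t + sizeF ts) → 1 ≤ cov sz i q → ∃[ w ] (w ∈ p × V i ≡ toℕ w)
      labels′ {i} o≤i i< c with i <? o + sizeT t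
      ... | yes i<t = contradiction (<-≤-trans (proj₂ (cov⇒ sz {i} c)) (≤-trans (ends o t s o≤i i<t) o≤q)) (<-irrefl refl)
      ... | no i≮t  = labels (≮⇒≥ i≮t) (subst (i <_) (sym (+-assoc o _ _)) i<) c

-- The input forest as an instance of the covering problem

module Forest {n : ℕ} (Z : List (Tree n)) where

  N : ℕ
  N = totalSize Z

  V P : ℕ → ℕ
  V = word (concatMap (λ T → vertices (shape T)) Z)
  P = word (concatMap (λ T → parents (root (shape T)) (shape T)) Z)

  open Arrays V P N
  open Layout {n} V P N

  labels : List (Tree n) → List (Fin n)
  labels = concatMap (λ T → vertices (shape T))

  labels≡ : ∀ Z → labels Z ≡ verticesF (map shape Z)
  labels≡ []      = refl
  labels≡ (T ∷ Z) = cong (vertices (shape T) ++_) (labels≡ Z)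

  totalSize≡ : ∀ (Z : List (Tree n)) → totalSize Z ≡ sizeF (map shape Z)
  totalSize≡ []      = refl
  totalSize≡ (T ∷ Z) = cong₂ _+_ (length-vertices (shape T)) (totalSize≡ Z)

  forest : List (RoseTree (Fin n))
  forest = map shape Z

  -- The depth table need not be cleared between trees: the value at a root does not depend on it,
  -- and every other vertex reads an entry written within its own tree.
  forest-depths : ∀ o Z → Reads V o (labels Z) →
    Reads P o (concatMap (λ T → parents (root (shape T)) (shape T)) Z) → DepthsF 0 o (map shape Z)
  forest-depths o []      r r′ = tt
  forest-depths o (T ∷ Z) r r′ =
    let t = shape T
        (r₁ , r₂)   = Reads-++ V o (vertices t) r
        (r₁′ , r₂′) = Reads-++ P o (parents (root t) t) r′
    in proj₁ (depths (root t) 0 o t (placed (root t) o t r₁ r₁′) (noRepeat t (distinct T)) (inj₂ (refl , refl))) ,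
       forest-depths (o + sizeT t) Z
         (subst (λ l → Reads V (o + l) (labels Z)) (length-vertices t) r₂)
         (subst (λ l → Reads P (o + l) (concatMap (λ T → parents (root (shape T)) (shape T)) Z))
           (length-parents (root t) t) r₂′)

  readsV : Reads V 0 (labels Z)
  readsV = Reads-word V 0 (labels Z) λ _ → refl

  all-depths : DepthsF 0 0 forest
  all-depths = forest-depths 0 Z readsV (Reads-word P 0 _ λ _ → refl)

  all-sizes : SizesF 0 forest
  all-sizes = proj₂ (sizesF forest {r′ = 0} all-depths (trans (totalSize≡ Z) (sym (+-identityʳ _)))
    (sym (totalSize≡ Z)) refl λ _ → refl)

  -- Intervals do not cross tree boundaries, so both positions lie in the tree that holds `q`, whose
  -- labels are distinct.
  one-per-label : ∀ o Z → Reads V o (labels Z) → SizesF o (map shape Z) → ∀ {q i j} →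
    q < o + sizeF (map shape Z) → o ≤ i → o ≤ j → 1 ≤ cov sz i q → 1 ≤ cov sz j q → V i ≡ V j → i ≡ j
  one-per-label o [] r s {q} {i} q< o≤i _ c _ _ =
    contradiction (≤-trans q< (≤-trans (≤-reflexive (+-identityʳ o)) (≤-trans o≤i (proj₁ (cov⇒ sz {i} c))))) 1+n≰n
  one-per-label o (T ∷ Z) r (s , ss) {q} {i} {j} q< o≤i o≤j cᵢ cⱼ e
    with Reads-++ V o (vertices (shape T)) r | q <? o + sizeT (shape T)
  ... | r₁ , _ | yes q<T = Reads-injective V o (vertices (shape T)) r₁ (distinct T)
        o≤i (inside i cᵢ) o≤j (inside j cⱼ) e
    where
    inside : ∀ x → 1 ≤ cov sz x q → x < o + length (vertices (shape T))
    inside x c = ≤-<-trans (proj₁ (cov⇒ sz {x} c)) (subst (λ l → q < o + l) (sym (length-vertices (shape T))) q<T)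
  ... | _ , r₂ | no q≮T = one-per-label (o + sizeT (shape T)) Z
        (subst (λ l → Reads V (o + l) (labels Z)) (length-vertices (shape T)) r₂) ss
        (subst (q <_) (sym (+-assoc o _ _)) q<) (beyond i o≤i cᵢ) (beyond j o≤j cⱼ) cᵢ cⱼ e
    where
    beyond : ∀ x → o ≤ x → 1 ≤ cov sz x q → o + sizeT (shape T) ≤ x
    beyond x o≤x c = ≮⇒≥ λ x<T → q≮T (<-≤-trans (proj₂ (cov⇒ sz {x} c)) (ends o (shape T) s o≤x x<T))

  in-forest : ∀ {i} → i < N → i < sizeF forest
  in-forest = subst (_ <_) (totalSize≡ Z)

  forest-instance : ∀ k → Instance n k N V sz (λ q → δ (depth q) k)
  forest-instance k = record
    { vertex<   = λ i<N →
        let (v , _ , e) = Reads-lookup V 0 (verticesF forest) (subst (Reads V 0) (labels≡ Z) readsV) z≤n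
                            (subst (_ <_) (sym (length-verticesF forest)) (in-forest i<N))
        in subst (_< n) (sym e) (toℕ<n v)
    ; end≤      = λ i<N → ≤-trans (endsF 0 forest all-sizes z≤n (in-forest i<N)) (≤-reflexive (sym (totalSize≡ Z)))
    ; separated = λ {q} q<N _ _ → one-per-label 0 Z readsV all-sizes (in-forest q<N) z≤n z≤n
    ; deep      = deep
    }
    where
    deep : ∀ {q} → q < N → 1 ≤ δ (depth q) k → k ≤ sumTo N (λ i → cov sz i q)
    deep {q} q<N h with δ (depth q) k in e
    ... | suc _ = begin
      k                                 ≡⟨ δ≢0⇒≡ e ⟨
      depth q                           ≤⟨ n≤1+n _ ⟩
      suc (depth q)                     ≤⟨ enough-ancestorsF 0 0 forest all-depths all-sizes z≤n (in-forest q<N) ⟩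
      ancestors q 0 (sizeF forest)      ≡⟨ cong (ancestors q 0) (totalSize≡ Z) ⟨
      ancestors q 0 N                   ≡⟨ sumTo-sumFrom _ 0 N ⟩
      sumTo N (λ i → cov sz i q)        ∎
      where open ≤-Reasoning

  path-target : ∀ {k p} → KHopRootPath k Z p → ∃[ q ] (q < N × depth q ≡ k ×
    (∀ {i} → i < N → 1 ≤ cov sz i q → ∃[ v ] (v ∈ p × V i ≡ toℕ v)))
  path-target (T , T∈ , path , length≡) with path-endF 0 0 forest all-depths all-sizes (∈-map⁺ shape T∈) path
  ... | q , _ , q< , depth≡ , labels =
    q , subst (q <_) (sym (totalSize≡ Z)) q< , suc-injective (trans depth≡ length≡) ,
    λ i<N c → labels z≤n (in-forest i<N) c

-- The program

-- Scalar 0 is n on input and the length of the list on output, so n is moved away first.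
initialise main hittingSet : Cmd
initialise = nᵛ ≔ var lenᵛ ⨾ lenᵛ ≔ lit 0 ⨾ iᵛ ≔ lit 0
main =
    initialise
  ⨾ while (var iᵛ ≺ var Nᵛ) forwardBody
  ⨾ while (var iᵛ) backwardBody
  ⨾ phases
hittingSet = if (lit 1 ≺ var lenᵛ) main (lenᵛ ≔ lit 0)

-- `b` grows with n, but for `N = 0` the time must not.
maxPhases : ℕ → ℕ → ℕ
maxPhases zero    b = 0
maxPhases (suc N) b = b

-- 49 and 43 are the times of one iteration of the forward and the backward pass.
total-time : ∀ {t₁ t₂ t₃ a} N b → 1 ≤ b → a ≤ N →
  t₁ ≤ N * 49 + 4 → t₂ ≤ N * 43 + 2 → t₃ ≤ a * killTime b + maxPhases N b * phaseTime N b + 3 →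
  suc (3 + (6 + (t₁ + (t₂ + t₃)))) ≤ 19 + 472 * (N * (b * b))
total-time {t₁} {t₂} {t₃} {a} N b 1≤b a≤N h₁ h₂ h₃ = begin
  10 + (t₁ + (t₂ + t₃))
    ≤⟨ +-monoʳ-≤ 10 (+-mono-≤ h₁ (+-mono-≤ h₂ (≤-trans h₃ (+-monoˡ-≤ 3 (+-mono-≤ kills (phases≤ N)))))) ⟩
  10 + (N * 49 + 4 + (N * 43 + 2 + (N * (165 * (b * b)) + N * (215 * (b * b)) + 3)))
    ≡⟨ collect N (b * b) ⟩
  19 + (N * 92 + N * (380 * (b * b)))
    ≤⟨ +-monoʳ-≤ 19 (+-monoˡ-≤ _ (*-monoʳ-≤ N (≤-trans (≤-reflexive (sym (*-identityʳ 92))) (*-monoʳ-≤ 92 1≤b²)))) ⟩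
  19 + (N * (92 * (b * b)) + N * (380 * (b * b)))
    ≡⟨ merge N (b * b) ⟩
  19 + 472 * (N * (b * b)) ∎
  where
  open ≤-Reasoning
  1≤b² : 1 ≤ b * b
  1≤b² = *-mono-≤ 1≤b 1≤b
  b≤b² : b ≤ b * b
  b≤b² = ≤-trans (≤-reflexive (sym (*-identityʳ b))) (*-monoʳ-≤ b 1≤b)
  collect : ∀ N x → 10 + (N * 49 + 4 + (N * 43 + 2 + (N * (165 * x) + N * (215 * x) + 3))) ≡ 19 + (N * 92 + N * (380 * x))
  collect = solve-∀
  merge : ∀ N x → 19 + (N * (92 * x) + N * (380 * x)) ≡ 19 + 472 * (N * x)
  merge = solve-∀
  -- `killTime b` with all durations evaluated: 17 for `segment`, 44 and 12 for a round of the loops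
  -- in `query` and `update`.
  kill-poly : ∀ b → suc (1 + (17 + (2 + (b * 44 + 4)) +
      suc (1 + (b * suc (5 + (12 + (2 + (b * 44 + 4) + 4))) + 6 + (2 + (b * 12 + 2)))))) ≡
    44 * (b * b) + 84 * b + 37
  kill-poly = solve-∀
  sum165 : ∀ x → 44 * x + 84 * x + 37 * x ≡ 165 * x
  sum165 = solve-∀
  kill≤ : killTime b ≤ 165 * (b * b)
  kill≤ = begin
    killTime b                             ≡⟨ kill-poly b ⟩
    44 * (b * b) + 84 * b + 37             ≤⟨ +-mono-≤ (+-monoʳ-≤ (44 * (b * b)) (*-monoʳ-≤ 84 b≤b²)) (*-monoʳ-≤ 37 1≤b²) ⟩
    44 * (b * b) + 84 * (b * b) + 37 * (b * b) ≡⟨ sum165 (b * b) ⟩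
    165 * (b * b)                          ∎
  kills : a * killTime b ≤ N * (165 * (b * b))
  kills = *-mono-≤ a≤N kill≤
  chain-poly : ∀ b → 61 + (suc (1 + (17 + (2 + (b * 44 + 4)) + 9)) +
      suc (1 + (17 + (2 + (b * 44 + 4)) + suc (1 + 5)))) ≡ 88 * b + 127
  chain-poly = solve-∀
  sum215 : ∀ x → 88 * x + 127 * x ≡ 215 * x
  sum215 = solve-∀
  chain≤ : 61 + chainTime b ≤ 215 * b
  chain≤ = begin
    61 + chainTime b      ≡⟨ chain-poly b ⟩
    88 * b + 127          ≤⟨ +-monoʳ-≤ (88 * b) (*-monoʳ-≤ 127 1≤b) ⟩
    88 * b + 127 * b      ≡⟨ sum215 b ⟩
    215 * b               ∎
  phases≤ : ∀ N → maxPhases N b * phaseTime N b ≤ N * (215 * (b * b))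
  phases≤ zero      = z≤n
  phases≤ M@(suc _) = begin
    b * (14 + M * (47 + chainTime b))
      ≤⟨ *-monoʳ-≤ b (+-monoˡ-≤ (M * (47 + chainTime b)) (*-mono-≤ {1} {M} (s≤s z≤n) (≤-refl {14}))) ⟩
    b * (M * 14 + M * (47 + chainTime b))   ≡⟨ cong (b *_) (*-distribˡ-+ M 14 (47 + chainTime b)) ⟨
    b * (M * (61 + chainTime b))            ≤⟨ *-monoʳ-≤ b (*-monoʳ-≤ M chain≤) ⟩
    b * (M * (215 * b))                     ≡⟨ shuffle b M ⟩
    M * (215 * (b * b))                     ∎
    where
    shuffle : ∀ b m → b * (m * (215 * b)) ≡ m * (215 * (b * b))
    shuffle = solve-∀

-- Correctness of the whole program

module Correctness {n : ℕ} (k : ℕ) (Z : List (Tree n)) (W : ℕ) (4≤W : 4 ≤ W) (b : ℕ)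
  (4N<W : totalSize Z + totalSize Z + (totalSize Z + totalSize Z) + 1 < W)
  (2N<2^b : totalSize Z + totalSize Z < 2 ^ b)
  (product<W : totalSize Z * (n + n) < W) (1≤k : 1 ≤ k) (k≤n : k ≤ n) (2≤n : 2 ≤ n) (1≤b : 1 ≤ b) where

  open Forest Z
  open Arrays V P N
  open Logic W 4≤W
  open Passes W 4≤W V P k N 4N<W

  inst : Instance n k N V subtreeSize target
  inst = forest-instance k

  N<W : N + N + 1 < W
  N<W = ≤-<-trans (+-monoˡ-≤ 1 (m≤m+n (N + N) (N + N))) 4N<W

  open Counting inst
  open Greedy W 4≤W inst b N<W 2N<2^b product<W 1≤k k≤n

  Final : Store → ℕ → Set
  Final σ τ = array σ Aᵃ 1 ≡ 0 × Live (array σ Aᵃ) (scalar σ lenᵛ) (array σ Vᵃ) ×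
    scalar σ lenᵛ * k ≤ b * (n + n) × τ ≤ 19 + 472 * (N * (b * b))

  phases-fit : ∀ N {x} → (N ≡ 0 → x ≡ 0) → x < 2 ^ b → x < 2 ^ maxPhases N b
  phases-fit zero    h _  = s≤s (≤-reflexive (h refl))
  phases-fit (suc N) _ x< = x<

  maxPhases≤ : ∀ N → maxPhases N b ≤ b
  maxPhases≤ zero    = z≤n
  maxPhases≤ (suc N) = ≤-refl

  correct : Wp hittingSet Final (input k Z)
  correct = if-rule _
    (λ _ → block-then _ (forward-spec refl refl refl refl refl start
      then λ {σ₁} {t₁} s₁ (i≡N , fw , t₁≤) →
        backward-spec (Forward.dep≡ fw) i≡N (turn s₁ fw)
      then λ {σ₂} {t₂} s₂ (bw , t₂≤) →
        let A≤N = proj₁ (root-bound fw bw)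
            A≡0 = proj₂ (root-bound fw bw)
        in conseq (phases-spec {h = maxPhases N b} refl (trans (scalar≡ s₂ lenᵛ _) (scalar≡ s₁ lenᵛ _))
                    (phases-fit N A≡0 (≤-<-trans (≤-trans A≤N (m≤m+n N N)) 2N<2^b)) (static s₁ s₂ fw bw)
                    (live fw bw (array σ₂ Vᵃ) A≤N))
          λ _ (A1≡0 , lv , len≤ , t₃≤) →
            A1≡0 , lv , ≤-trans len≤ (*-monoˡ-≤ (n + n) (maxPhases≤ N)) ,
            total-time N b 1≤b A≤N t₁≤ t₂≤ t₃≤))
    (λ n≤1 → contradiction (≤-trans 2≤n (lt≡0⇒≥ {1} n≤1)) 1+n≰n)
    where
    σ₀ = exe initialise (input k Z)
    start : Forward 0 σ₀
    start = record
      { D≡ = refl ; head≡ = refl ; dep≡ = λ _ () ; next≡ = λ _ () ; copy≡ = λ _ ()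
      ; leaf≡ = λ _ () ; node≡ = λ _ _ → refl ; rest≡ = λ _ _ → refl }
    turn : ∀ {σ₁} → Same (while (var iᵛ ≺ var Nᵛ) forwardBody) σ₀ σ₁ → Forward N σ₁ →
           Backward N (array σ₁ Aᵃ) σ₁
    turn {σ₁} s fw = record
      { S≡ = trans (array≡ s Sᵃ _) (cong (λ r → pending r N) (sym (n∸n≡0 N)))
      ; size≡ = λ _ N≤x x<N → contradiction (≤-trans x<N N≤x) 1+n≰n
      ; tree = λ _ N≤x _ x<N → contradiction (≤-trans x<N N≤x) 1+n≰n
      ; bound = bound
      ; leaf≡ = λ _ _ → refl
      ; node≡ = Forward.node≡ fw }
      where
      bound : ∀ j → N ≤ j → 1 ≤ j → j < N + N → array σ₁ Aᵃ j * j ≤ N + N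
      bound j N≤j _ j< = ≤-trans (*-monoˡ-≤ j leaf≤1) (≤-trans (≤-reflexive (*-identityˡ j)) (<⇒≤ j<))
        where
        q = j ∸ N
        j≡ : N + q ≡ j
        j≡ = m+[n∸m]≡n N≤j
        leaf≤1 : array σ₁ Aᵃ j ≤ 1
        leaf≤1 = subst (λ x → array σ₁ Aᵃ x ≤ 1) j≡
          (≤-trans (≤-reflexive (Forward.leaf≡ fw q (+-cancelˡ-< N q N (subst (_< N + N) (sym j≡) j<))))
                   (δ≤1 (depth q) k))
    leaf-target : ∀ {σ₁ σ₂} → Forward N σ₁ → Backward 0 (array σ₁ Aᵃ) σ₂ →
                  ∀ {q} → q < N → array σ₂ Aᵃ (N + q) ≡ target q
    leaf-target fw bw {q} q<N = trans (Backward.leaf≡ bw (N + q) (m≤m+n N q)) (Forward.leaf≡ fw q q<N)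
    seg-tree : ∀ {σ₂ leaf} → Backward 0 leaf σ₂ → SegTree N (array σ₂ Aᵃ)
    seg-tree bw j = Backward.tree bw j z≤n
    root-bound : ∀ {σ₁ σ₂} → Forward N σ₁ → Backward 0 (array σ₁ Aᵃ) σ₂ →
                 array σ₂ Aᵃ 1 ≤ N × (N ≡ 0 → array σ₂ Aᵃ 1 ≡ 0)
    root-bound {σ₁} {σ₂} fw bw = bounded , empty
      where
      empty : N ≡ 0 → array σ₂ Aᵃ 1 ≡ 0
      empty N≡0 = trans (Backward.leaf≡ bw 1 (≤-trans (≤-reflexive N≡0) z≤n))
        (Forward.rest≡ fw 1 (≤-trans (≤-reflexive (cong (λ x → x + x) N≡0)) z≤n))
      bounded : array σ₂ Aᵃ 1 ≤ N
      bounded with m≤n⇒m<n∨m≡n (z≤n {N})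
      ... | inj₂ 0≡N = ≤-trans (≤-reflexive (empty (sym 0≡N))) z≤n
      ... | inj₁ 1≤N = ≤-trans (≤-reflexive (root≡leaves (seg-tree bw) 1≤N))
        (≤-trans (sumTo-mono N λ q q<N → ≤-trans (≤-reflexive (leaf-target fw bw q<N)) (δ≤1 (depth q) k))
                 (≤-reflexive (trans (sumTo-const N 1) (*-identityʳ N))))
    static : ∀ {σ₁ σ₂ leaf} → Same (while (var iᵛ ≺ var Nᵛ) forwardBody) σ₀ σ₁ →
      Same (while (var iᵛ) backwardBody) σ₁ σ₂ → Forward N σ₁ → Backward 0 leaf σ₂ →
      Static n k N V subtreeSize σ₂
    static s₁ s₂ fw bw = record
      { k≡ = trans (scalar≡ s₂ kᵛ _) (scalar≡ s₁ kᵛ _)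
      ; N≡ = trans (scalar≡ s₂ Nᵛ _) (scalar≡ s₁ Nᵛ _)
      ; n≡ = trans (scalar≡ s₂ nᵛ _) (scalar≡ s₁ nᵛ _)
      ; size≡ = λ {i} → Backward.size≡ bw i z≤n
      ; head≡ = λ v → cong (λ f → f v) (trans (array≡ s₂ headᵃ _) (Forward.head≡ fw))
      ; next≡ = λ {i} i<N → trans (cong (λ f → f i) (array≡ s₂ nxtᵃ _)) (Forward.next≡ fw i i<N)
      ; copy≡ = λ {i} i<N → trans (cong (λ f → f i) (array≡ s₂ Cᵃ _)) (Forward.copy≡ fw i i<N) }
    live : ∀ {σ₁ σ₂} → Forward N σ₁ → Backward 0 (array σ₁ Aᵃ) σ₂ → ∀ out →
           array σ₂ Aᵃ 1 ≤ N → Live (array σ₂ Aᵃ) 0 out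
    live fw bw out A≤N = record
      { tree = seg-tree bw ; room = A≤N ; leaf≤ = λ q<N → ≤-reflexive (leaf-target fw bw q<N)
      ; hit = λ q<N → inj₁ (leaf-target fw bw q<N)
      ; out< = λ () ; out-injective = λ () ; spent = λ () }

  applyUpTo-tabulate : ∀ (f : ℕ → ℕ) m → applyUpTo f m ≡ tabulate {n = m} (f ∘ toℕ)
  applyUpTo-tabulate f zero    = refl
  applyUpTo-tabulate f (suc m) = cong (f 0 ∷_) (applyUpTo-tabulate (f ∘ suc) m)

  -- A root of 0 means that the target at the end of each path has been killed, so a chosen vertex
  -- labels a position covering it; such labels lie on the path.
  extract : ∀ {σ τ} → Final σ τ → ∃[ H ] (Outputs {n} σ H × Unique H ×
    length H * k ≤ b * (n + n) × IsHittingSet H (KHopRootPath k Z))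
  extract {σ} (A1≡0 , lv , len≤ , _) = H , outputs , unique , length≤ , hits
    where
    open Live lv
    len = scalar σ lenᵛ
    out = array σ Vᵃ
    element : Fin len → Fin n
    element x = fromℕ< (out< (toℕ<n x))
    H : List (Fin n)
    H = tabulate element
    toℕ-element : ∀ x → toℕ (element x) ≡ out (toℕ x)
    toℕ-element x = toℕ-fromℕ< (out< (toℕ<n x))
    outputs : Outputs σ H
    outputs = trans (map-upTo out len) (trans (applyUpTo-tabulate out len)
      (trans (sym (tabulate-cong toℕ-element)) (sym (map-tabulate element toℕ))))
    unique : Unique H
    unique = tabulate⁺ λ {x} {y} e → toℕ-injective (out-injective (toℕ<n x) (toℕ<n y)
      (trans (sym (toℕ-element x)) (trans (cong toℕ e) (toℕ-element y))))
    length≤ : length H * k ≤ b * (n + n)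
    length≤ = subst (λ l → l * k ≤ b * (n + n)) (sym (length-tabulate element)) len≤
    dead : ∀ {q} → q < N → array σ Aᵃ (N + q) ≡ 0
    dead {q} q<N = n≤0⇒n≡0 (≤-trans (term≤sumTo (λ q → array σ Aᵃ (N + q)) q<N)
      (≤-reflexive (trans (sym (root≡leaves tree (≤-trans (s≤s z≤n) q<N))) A1≡0)))
    hits : IsHittingSet H (KHopRootPath k Z)
    hits p path with path-target path
    ... | q , q<N , depth≡ , labels with hit q<N
    ...   | inj₁ e = contradiction
      (trans (sym (dead q<N)) (trans e (trans (cong (λ x → δ x k) depth≡) (δ-refl k)))) λ ()
    ...   | inj₂ (x , i , x<len , i<N , c , out≡) with labels i<N c
    ...     | v , v∈p , V≡v = Any.map (λ v≡u → subst (_∈ H) (trans v≡ v≡u) (∈-tabulate⁺ x′)) v∈p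
      where
      x′ : Fin len
      x′ = fromℕ< x<len
      v≡ : element x′ ≡ v
      v≡ = toℕ-injective (trans (toℕ-element x′) (trans (cong out (toℕ-fromℕ< x<len)) (trans out≡ V≡v)))

-- Word size

n≤2^⌈log₂n⌉ : ∀ n → n ≤ 2 ^ ⌈log₂ n ⌉
n≤2^⌈log₂n⌉ n = go n (<-wellFounded n)
  where
  open ≤-Reasoning
  go : ∀ n a → n ≤ 2 ^ ⌈log2⌉ n a
  go 0 _ = z≤n
  go 1 _ = ≤-refl
  go (suc (suc n)) (WellFounded.acc rs) = begin
    2 + n                              ≡⟨ cong (2 +_) (⌊n/2⌋+⌈n/2⌉≡n n) ⟨
    2 + (⌊ n /2⌋ + ⌈ n /2⌉)            ≤⟨ +-monoʳ-≤ 2 (+-monoˡ-≤ ⌈ n /2⌉ (⌊n/2⌋≤⌈n/2⌉ n)) ⟩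
    2 + (⌈ n /2⌉ + ⌈ n /2⌉)            ≡⟨ cong suc (+-suc ⌈ n /2⌉ ⌈ n /2⌉) ⟨
    suc ⌈ n /2⌉ + suc ⌈ n /2⌉          ≤⟨ +-mono-≤ half half ⟩
    2 ^ l + 2 ^ l                      ≡⟨ 2^suc l ⟨
    2 ^ suc l                          ∎
    where
    l = ⌈log2⌉ (suc ⌈ n /2⌉) _
    half = go (suc ⌈ n /2⌉) (rs (⌈n/2⌉<n n))

1+n≤2^n : ∀ n → suc n ≤ 2 ^ n
1+n≤2^n zero    = ≤-refl
1+n≤2^n (suc n) = subst (suc (suc n) ≤_) (sym (2^suc n))
  (+-mono-≤ (≤-trans (s≤s z≤n) (1+n≤2^n n)) (1+n≤2^n n))

1≤2^ : ∀ m → 1 ≤ 2 ^ m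
1≤2^ m = m^n>0 2 m

module _ {d n N m : ℕ} (1≤m : 1 ≤ m) (n≤2^m : n ≤ 2 ^ m) (1≤n : 1 ≤ n) (N≤ : N ≤ d * n ^ d) where

  -- The constant factor and the power of n each take `d * m` bits, by d < 2 ^ d and n ≤ 2 ^ m.
  -- Doubling takes at most m more.
  polynomial-bits : N + N < 2 ^ ((d + d + 1) * m)
  polynomial-bits = begin-strict
    N + N                        <⟨ +-mono-< N<X N<X ⟩
    X + X                        ≡⟨ cong (X +_) (+-identityʳ X) ⟨
    2 * X                        ≤⟨ *-monoˡ-≤ X (^-monoʳ-≤ 2 1≤m) ⟩
    2 ^ m * X                    ≡⟨ cong (2 ^ m *_) (^-distribˡ-+-* 2 (d * m) (m * d)) ⟨
    2 ^ m * 2 ^ (d * m + m * d)  ≡⟨ ^-distribˡ-+-* 2 m _ ⟨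
    2 ^ (m + (d * m + m * d))    ≡⟨ cong (2 ^_) (exponent d m) ⟩
    2 ^ ((d + d + 1) * m)        ∎
    where
    open ≤-Reasoning
    X = 2 ^ (d * m) * 2 ^ (m * d)
    exponent : ∀ d m → m + (d * m + m * d) ≡ (d + d + 1) * m
    exponent = solve-∀
    1≤n^d : 1 ≤ n ^ d
    1≤n^d = m^n>0 n {{>-nonZero 1≤n}} d
    N<X : N < X
    N<X = begin-strict
      N                           ≤⟨ N≤ ⟩
      d * n ^ d                   <⟨ m<n+m (d * n ^ d) 1≤n^d ⟩
      suc d * n ^ d               ≤⟨ *-mono-≤ (1+n≤2^n d) (^-monoˡ-≤ d n≤2^m) ⟩
      2 ^ d * (2 ^ m) ^ d         ≡⟨ cong (2 ^ d *_) (^-*-assoc 2 m d) ⟩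
      2 ^ d * 2 ^ (m * d)         ≤⟨ *-monoˡ-≤ (2 ^ (m * d)) (^-monoʳ-≤ 2 (m≤m*n d m {{>-nonZero 1≤m}})) ⟩
      X                           ∎

module WordSize {d n k : ℕ} (Z : List (Tree n)) (1≤n : 1 ≤ n) (k≤n : k ≤ n)
  (N≤ : totalSize Z ≤ d * n ^ d) where

  -- The word bound splits as `X * Y`: `X` holds 2N, and `Y` leaves room for the factor 2n in the
  -- product compared with the threshold, as well as for the small constants.
  e L N W X Y : ℕ
  e = d + d + 1
  L = ⌈log₂ n ⌉
  N = totalSize Z
  W = wordBound (e + 4) n
  X = 2 ^ (e * suc L)
  Y = 2 ^ (4 * suc L)

  W≡ : W ≡ X * Y
  W≡ = trans (cong (2 ^_) (*-distribʳ-+ (suc L) e 4)) (^-distribˡ-+-* 2 (e * suc L) (4 * suc L))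

  n+n≤ : n + n ≤ 2 ^ suc L
  n+n≤ = ≤-trans (+-mono-≤ (n≤2^⌈log₂n⌉ n) (n≤2^⌈log₂n⌉ n)) (≤-reflexive (sym (2^suc L)))

  n≤ : n ≤ 2 ^ suc L
  n≤ = ≤-trans (m≤m+n n n) n+n≤

  2N<X : N + N < X
  2N<X = polynomial-bits {d} {n} {N} {suc L} (s≤s z≤n) n≤ 1≤n N≤

  16≤Y : 16 ≤ Y
  16≤Y = ^-monoʳ-≤ 2 (m≤m*n 4 (suc L))

  2^suc≤Y : 2 ^ suc L ≤ Y
  2^suc≤Y = ^-monoʳ-≤ 2 (m≤n*m (suc L) 4)

  Y≤W : Y ≤ W
  Y≤W = ≤-trans (≤-reflexive (sym (*-identityˡ Y))) (≤-trans (*-monoˡ-≤ Y (1≤2^ (e * suc L))) (≤-reflexive (sym W≡)))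

  X+X≤W : X + X ≤ W
  X+X≤W = ≤-trans (≤-reflexive (double X)) (≤-trans (*-monoʳ-≤ X (≤-trans (s≤s (s≤s z≤n)) 16≤Y)) (≤-reflexive (sym W≡)))
    where
    double : ∀ x → x + x ≡ x * 2
    double = solve-∀

  4≤W : 4 ≤ W
  4≤W = ≤-trans (s≤s (s≤s (s≤s (s≤s z≤n)))) (≤-trans 16≤Y Y≤W)

  4N<W : N + N + (N + N) + 1 < W
  4N<W = <-≤-trans (subst (_< X + X) (sym (+-assoc (N + N) (N + N) 1))
    (+-mono-<-≤ 2N<X (≤-trans (≤-reflexive (+-comm (N + N) 1)) 2N<X))) X+X≤W

  product<W : N * (n + n) < W
  product<W = ≤-<-trans (*-monoʳ-≤ N (≤-trans n+n≤ 2^suc≤Y))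
    (<-≤-trans (*-monoˡ-< Y {{>-nonZero (≤-trans (s≤s z≤n) 16≤Y)}} (≤-<-trans (m≤m+n N N) 2N<X))
      (≤-reflexive (sym W≡)))

  n<W : n < W
  n<W = <-≤-trans (m<m+n n 1≤n) (≤-trans n+n≤ (≤-trans 2^suc≤Y Y≤W))

  N<W : N < W
  N<W = ≤-<-trans (≤-trans (m≤m+n N N) (≤-trans (m≤m+n _ (N + N)) (m≤m+n _ 1))) 4N<W

  input-fits : FitsIn W (input k Z)
  input-fits = record { scalars = scalars ; arrays = arrays }
    where
    0<W : 0 < W
    0<W = ≤-trans (s≤s z≤n) 4≤W
    scalars : ∀ x → scalar (input k Z) x < W
    scalars 0 = n<W
    scalars 1 = ≤-<-trans k≤n n<W
    scalars 2 = N<W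
    scalars (suc (suc (suc _))) = 0<W
    word< : ∀ (vs : List (Fin n)) i → word vs i < W
    word< []       _       = 0<W
    word< (v ∷ vs) zero    = <-trans (toℕ<n v) n<W
    word< (v ∷ vs) (suc i) = word< vs i
    arrays : ∀ a i → array (input k Z) a i < W
    arrays 0 = word< (concatMap (λ T → vertices (shape T)) Z)
    arrays 1 = word< (concatMap (λ T → parents (root (shape T)) (shape T)) Z)
    arrays (suc (suc _)) _ = 0<W

root∈vertices : ∀ {A} (t : RoseTree A) → root t ∈ vertices t
root∈vertices (node v ts) = here refl

vertices⊆verticesF : ∀ {A} {t : RoseTree A} {ts} → t ∈ ts → ∀ {v} → v ∈ vertices t → v ∈ verticesF ts
vertices⊆verticesF (here refl)            v∈ = ∈-++⁺ˡ v∈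
vertices⊆verticesF {ts = s ∷ _} (there t∈) v∈ = ∈-++⁺ʳ (vertices s) (vertices⊆verticesF t∈ v∈)

-- A path with an edge has two distinct vertices.
no-paths : ∀ {n k p} (Z : List (Tree n)) → n ≤ 1 → 1 ≤ k → ¬ KHopRootPath k Z p
no-paths Z n≤1 1≤k (T , _ , path , length≡) = go (shape T) (distinct T) path length≡
  where
  all-equal : ∀ {n} → n ≤ 1 → (u v : Fin n) → u ≡ v
  all-equal n≤1 u v = toℕ-injective (trans (zero-label u) (sym (zero-label v)))
    where
    zero-label : ∀ u → toℕ u ≡ 0
    zero-label u = n≤0⇒n≡0 (≤-pred (≤-trans (toℕ<n u) n≤1))
  go : ∀ t → Unique (vertices t) → ∀ {p} → RootPath t p → length p ≢ suc _
  go (node v ts) u here refl = contradiction 1≤k λ ()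
  go (node v ts) (v∉ ∷ _) (down {t = t} t∈ _) _ =
    All.lookup v∉ (vertices⊆verticesF t∈ (root∈vertices t)) (all-equal n≤1 v (root t))

theorem3p7 : ∃[ P ] ∀ (d : ℕ) → ∃[ b ] ∃[ c ]
    ∀ (n k : ℕ) (Z : List (Tree n)) →
    1 ≤ k → k ≤ n →
    totalSize Z ≤ d * n ^ d →
    ∃[ σ ] ∃[ t ] ∃[ H ]
    ( Runs (wordBound b n) P (input k Z) σ t
    × t ≤ timeBound c n (totalSize Z)
    × Outputs {n} σ H
    × Unique H
    × length H * k ≤ c * (n * ⌈log₂ n ⌉)
    × IsHittingSet H (KHopRootPath k Z) )
theorem3p7 = hittingSet , λ d → d + d + 1 + 4 , constant (d + d + 1) , solve d
  where
  constant : ℕ → ℕ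
  -- One constant for both bounds: the first two summands come from the time with `b = e * L`, the
  -- last from the size `b * (n + n)`.
  constant e = 19 + 472 * (e * e) + (e + e)

  solve : ∀ d n k (Z : List (Tree n)) → 1 ≤ k → k ≤ n → totalSize Z ≤ d * n ^ d →
    ∃[ σ ] ∃[ t ] ∃[ H ]
    ( Runs (wordBound (d + d + 1 + 4) n) hittingSet (input k Z) σ t
    × t ≤ timeBound (constant (d + d + 1)) n (totalSize Z)
    × Outputs {n} σ H
    × Unique H
    × length H * k ≤ constant (d + d + 1) * (n * ⌈log₂ n ⌉)
    × IsHittingSet H (KHopRootPath k Z) )
  solve d n k Z 1≤k k≤n N≤ with 2 ≤? n
  ... | no 2≰n =
    let (σ , t , exec , _ , len≡0 , t≤) = run trivial input-fits
    in σ , t , [] , (input-fits , exec) , ≤-trans t≤ constant-time ,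
       cong (λ l → map (array σ 0) (upTo l)) len≡0 , [] , z≤n , λ p path → contradiction path (no-paths Z n≤1 1≤k)
    where
    open WordSize {d} {n} {k} Z (≤-trans 1≤k k≤n) k≤n N≤
    open Logic W 4≤W
    n≤1 : n ≤ 1
    n≤1 = ≤-pred (≰⇒> 2≰n)
    trivial : Wp hittingSet (λ σ t → scalar σ lenᵛ ≡ 0 × t ≤ 6) (input k Z)
    trivial = if-rule _ (λ 1<n → contradiction (lt≢0⇒< {1} 1<n) 2≰n) λ _ → block _ (refl , ≤-refl)
    constant-time : 6 ≤ timeBound (constant e) n N
    constant-time = ≤-trans (m≤m+n 6 _) (m≤m*n (constant e) (suc (N * ⌈log₂ n ⌉ ^ 2)))
  ... | yes 2≤n =
    let (σ , t , exec , _ , final) = run correct input-fits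
        (H , outputs , unique , length≤ , hits) = extract {σ} {t} final
    in σ , t , H , (input-fits , exec) , ≤-trans (proj₂ (proj₂ (proj₂ final))) time≤ ,
       outputs , unique , ≤-trans length≤ size≤ , hits
    where
    open WordSize {d} {n} {k} Z (≤-trans 1≤k k≤n) k≤n N≤
    1≤L : 1 ≤ L
    1≤L = n≢0⇒n>0 λ L≡0 → contradiction (≤-trans 2≤n (subst (λ l → n ≤ 2 ^ l) L≡0 (n≤2^⌈log₂n⌉ n))) λ { (s≤s ()) }
    1≤eL : 1 ≤ e * L
    1≤eL = *-mono-≤ (m≤n+m 1 (d + d)) 1≤L
    -- As a multiple of `L` itself, `b` turns directly into the logarithms of both bounds.
    open Correctness k Z W 4≤W (e * L) 4N<W
      (polynomial-bits {d} {n} {N} {L} 1≤L (n≤2^⌈log₂n⌉ n) (≤-trans 1≤k k≤n) N≤) product<W 1≤k k≤n 2≤n 1≤eL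
      hiding (N<W)
    open Logic W 4≤W using (run)
    open ≤-Reasoning
    time≤ : 19 + 472 * (N * (e * L * (e * L))) ≤ timeBound (constant e) n N
    time≤ = begin
      19 + 472 * (N * (e * L * (e * L)))      ≡⟨ cong (19 +_) (regroup N e L) ⟩
      19 + 472 * (e * e) * (N * L ^ 2)
        ≤⟨ +-mono-≤ (≤-trans (m≤m+n 19 (472 * (e * e))) (m≤m+n _ (e + e)))
             (*-monoˡ-≤ (N * L ^ 2) (≤-trans (m≤n+m (472 * (e * e)) 19) (m≤m+n _ (e + e)))) ⟩
      constant e + constant e * (N * L ^ 2)   ≡⟨ *-suc (constant e) (N * L ^ 2) ⟨
      timeBound (constant e) n N              ∎
      where
      regroup : ∀ N e L → 472 * (N * (e * L * (e * L))) ≡ 472 * (e * e) * (N * (L * (L * 1)))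
      regroup = solve-∀
    size≤ : e * L * (n + n) ≤ constant e * (n * L)
    size≤ = ≤-trans (≤-reflexive (regroup e L n)) (*-monoˡ-≤ (n * L) (m≤n+m (e + e) (19 + 472 * (e * e))))
      where
      regroup : ∀ e L n → e * L * (n + n) ≡ (e + e) * (n * L)
      regroup = solve-∀
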